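{- Let $K$ be a commutative ring. Then (1) $E(-1):=\sum_{i\ge 0}(-1)^ie_i=1-G_{(1)}$ in $\widehat\Lambda$; and (2) the linear map $I\colon\Lambda\to\Lambda$ defined by $I(g_\lambda)=\sum_{\mu\subset\lambda}g_\mu$ is invertible and its inverse satisfies $$I^{ -1}=E(-1)^\perp=\mathrm{id}_\Lambda-G_{(1)}^\perp=\sum_{i\ge 0}(-1)^ie_i^\perp.$$
   Context: $K$ is a commutative ring. $\Lambda$ is the ring of symmetric formal power series of bounded degree in $x=(x_1,x_2,\dots)$ over $K$; $\widehat\Lambda$ its completion. $e_i$ are the elementary symmetric functions, $s_\lambda$ Schur functions. The Hall inner product $(\,,)\colon\widehat\Lambda\times\Lambda\to K$ is $(\sum a_\lambda s_\lambda,\sum b_\lambda s_\lambda)=\sum a_\lambda b_\lambda$. The coproduct is $\Delta(f)(x,y)=f(x,y)$. For $F\in\widehat\Lambda$, $F^\perp(f)=\sum(F,f_1)f_2$ where $\Delta(f)=\sum f_1\otimes f_2$. For partitions $\mu\subset\lambda$, a reverse plane partition of shape $\lambda/\mu$ is a filling of the boxes by positive integers weakly increasing in rows and columns; $g_{\lambda/\mu}=\sum_T\prod_i x_i^{T(i)}$ over such $T$, with $T(i)$ the number of columns containing $i$; $g_\lambda=g_{\lambda/\emptyset}$. $\{g_\lambda\}$ is a basis of $\Lambda$, and $G_\lambda\in\widehat\Lambda$ (stable Grothendieck polynomials) are defined by $(G_\lambda,g_\mu)=\delta_{\lambda\mu}$. -}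

module Defs where

-- Symmetric functions in infinitely many variables x = (x1, x2, ...) over a
-- commutative ring K, represented by their coefficients in the monomial basis:
-- a symmetric formal power series F is determined by the function
-- ν ↦ [x^ν] F = [m_ν] F on partitions ν (coefficients of the other monomials
-- are obtained by permuting exponents).  A partition is a weakly decreasing
-- list of positive naturals.  Functions are defined on all of List ℕ but only
-- their values on partitions matter (all equalities below quantify over
-- partitions only).

open import Level using (Level) renaming (_⊔_ to _⊔ˡ_)
open import Algebra.Bundles using (CommutativeRing)
open import Data.Nat using (ℕ; zero; suc; _∸_; _≤_; _<_; _≤?_; _≤ᵇ_; _<ᵇ_; _≡ᵇ_; _⊓_; _⊔_)
open import Data.Nat.Properties using (<⇒≱; m≤m⊔n; m≤n⊔m; ≤-<-trans)
open import Data.Bool using (Bool; true; false; if_then_else_; _∧_; _∨_)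
open import Data.List using (List; []; _∷_; map; concatMap; foldr; foldl; length; upTo; zip; _++_)
open import Data.Nat.ListAction using (sum)
open import Data.Product using (_×_; _,_; proj₁; proj₂)
open import Data.Maybe using (Maybe; just; nothing)
open import Data.Empty using (⊥-elim)
open import Relation.Nullary using (yes; no)

data IsPartition : List ℕ → Set where
  []  : IsPartition []
  [_] : ∀ {a} → 1 ≤ a → IsPartition (a ∷ [])
  _∷_ : ∀ {a b l} → b ≤ a → IsPartition (b ∷ l) → IsPartition (a ∷ b ∷ l)

size : List ℕ → ℕ
size = sum

_==_ : List ℕ → List ℕ → Bool
[] == [] = true
[] == (_ ∷ _) = false
(_ ∷ _) == [] = false
(a ∷ as) == (b ∷ bs) = (a ≡ᵇ b) ∧ (as == bs)

count : {A : Set} → (A → Bool) → List A → ℕ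
count p = foldr (λ x n → if p x then suc n else n) 0

filterᵇ : {A : Set} → (A → Bool) → List A → List A
filterᵇ p = foldr (λ x xs → if p x then x ∷ xs else xs) []

allᵇ : {A : Set} → (A → Bool) → List A → Bool
allᵇ p = foldr (λ x b → p x ∧ b) true

anyᵇ : {A : Set} → (A → Bool) → List A → Bool
anyᵇ p = foldr (λ x b → p x ∨ b) false

-- partitions of n with all parts ≤ m, listed in decreasing lexicographic
-- order (first argument is fuel; fuel n suffices for partitions of n)
parts : ℕ → ℕ → ℕ → List (List ℕ)
parts zero    zero    m = [] ∷ []
parts zero    (suc n) m = []
parts (suc f) zero    m = [] ∷ []
parts (suc f) (suc n) m =
  concatMap (λ k → map (k ∷_) (parts f (suc n ∸ k) k))
            (map ((suc n ⊓ m) ∸_) (upTo (suc n ⊓ m)))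

partitionsOf : ℕ → List (List ℕ)
partitionsOf n = parts n n n

partitionsUpTo : ℕ → List (List ℕ)
partitionsUpTo d = concatMap partitionsOf (upTo (suc d))

contained : List ℕ → List ℕ → Bool
contained [] _ = true
contained (_ ∷ _) [] = false
contained (a ∷ as) (b ∷ bs) = (a ≤ᵇ b) ∧ contained as bs

subpartitions : List ℕ → List (List ℕ)
subpartitions λ' = filterᵇ (λ μ → contained μ λ') (partitionsUpTo (size λ'))

merge : List ℕ → List ℕ → List ℕ
merge [] l = l
merge (a ∷ as) [] = a ∷ as
merge (a ∷ as) (b ∷ bs) =
  if b ≤ᵇ a then a ∷ merge as (b ∷ bs) else b ∷ merge (a ∷ as) bs

boxesFrom : ℕ → List ℕ → List (ℕ × ℕ)
boxesFrom r [] = []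
boxesFrom r (a ∷ as) = map (λ c → (r , c)) (upTo a) ++ boxesFrom (suc r) as

boxes : List ℕ → List (ℕ × ℕ)
boxes = boxesFrom 0

valueLists : ℕ → ℕ → List (List ℕ)
valueLists m zero = [] ∷ []
valueLists m (suc k) = concatMap (λ v → map (v ∷_) (valueLists m k)) (map suc (upTo m))

Filling : Set
Filling = List ((ℕ × ℕ) × ℕ)

fillingsOf : List ℕ → ℕ → List Filling
fillingsOf λ' m = map (zip (boxes λ')) (valueLists m (size λ'))

valAt : Filling → ℕ → ℕ → Maybe ℕ
valAt [] r c = nothing
valAt (((r' , c') , v) ∷ F) r c = if (r ≡ᵇ r') ∧ (c ≡ᵇ c') then just v else valAt F r c

okAt : (ℕ → Bool) → Maybe ℕ → Bool
okAt p nothing = true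
okAt p (just w) = p w

monotone : Bool → Filling → Bool
monotone strictCols F =
  allᵇ (λ { ((r , c) , v) →
         okAt (λ w → v ≤ᵇ w) (valAt F r (suc c)) ∧
         okAt (λ w → if strictCols then v <ᵇ w else v ≤ᵇ w) (valAt F (suc r) c) }) F

headOr0 : List ℕ → ℕ
headOr0 [] = 0
headOr0 (a ∷ _) = a

colCount : List ℕ → Filling → ℕ → ℕ
colCount λ' F i =
  count (λ c → anyᵇ (λ { ((_ , c') , v) → (c ≡ᵇ c') ∧ (v ≡ᵇ i) }) F) (upTo (headOr0 λ'))

entryCount : Filling → ℕ → ℕ
entryCount F i = count (λ { (_ , v) → v ≡ᵇ i }) F

-- [x^ν] g_λ : number of reverse plane partitions T of shape λ with
-- (T(1), T(2), …) = (ν₁, ν₂, …, ν_ℓ, 0, 0, …)  (entries must then lie in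
-- {1, …, ℓ(ν)})
rppCount : List ℕ → List ℕ → ℕ
rppCount λ' ν =
  count (λ F → monotone false F ∧ (map (colCount λ' F) (map suc (upTo (length ν))) == ν))
        (fillingsOf λ' (length ν))

kostka : List ℕ → List ℕ → ℕ
kostka ν λ' =
  count (λ F → monotone true F ∧ (map (entryCount F) (map suc (upTo (length λ'))) == λ'))
        (fillingsOf ν (length λ'))

module SymFun {c ℓ} (R : CommutativeRing c ℓ) where
  open CommutativeRing R renaming (Carrier to K)

  fromℕ : ℕ → K
  fromℕ zero = 0#
  fromℕ (suc n) = 1# + fromℕ n

  sign : ℕ → K
  sign zero = 1#
  sign (suc i) = - sign i

  sumK : List K → K
  sumK = foldr _+_ 0#

  -- Λ̂ : symmetric formal power series, given by monomial coefficients
  Λ̂ : Set c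
  Λ̂ = List ℕ → K

  _≈̂_ : Λ̂ → Λ̂ → Set ℓ
  F ≈̂ G = ∀ ν → IsPartition ν → F ν ≈ G ν

  Bounded : ℕ → Λ̂ → Set ℓ
  Bounded d f = ∀ ν → IsPartition ν → d < size ν → f ν ≈ 0#

  record Λ : Set (c ⊔ˡ ℓ) where
    field
      coeff   : Λ̂
      deg     : ℕ
      bounded : Bounded deg coeff
  open Λ public

  _≈Λ_ : Λ → Λ → Set ℓ
  f ≈Λ g = coeff f ≈̂ coeff g

  _+Λ_ : Λ → Λ → Λ
  coeff (f +Λ g) ν = coeff f ν + coeff g ν
  deg (f +Λ g) = deg f ⊔ deg g
  bounded (f +Λ g) ν p lt =
    trans (+-cong (bounded f ν p (≤-<-trans (m≤m⊔n (deg f) (deg g)) lt))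
                  (bounded g ν p (≤-<-trans (m≤n⊔m (deg f) (deg g)) lt)))
          (+-identityˡ 0#)

  _·Λ_ : K → Λ → Λ
  coeff (a ·Λ f) ν = a * coeff f ν
  deg (a ·Λ f) = deg f
  bounded (a ·Λ f) ν p lt = trans (*-congˡ (bounded f ν p lt)) (zeroʳ a)

  -- Schur functions: [x^λ] s_ν = K_{νλ}.  Schur coefficients of a series
  -- F in degree n, computed by unitriangularity of the Kostka matrix,
  -- running over partitions of n in decreasing lexicographic order:
  --   a_λ = [x^λ] F - Σ_{ν >lex λ} a_ν K_{νλ}
  schurList : Λ̂ → ℕ → List (List ℕ × K)
  schurList F n = foldl step [] (partitionsOf n)
    where
      step : List (List ℕ × K) → List ℕ → List (List ℕ × K)
      step acc λ' = acc ++ ((λ' , (F λ' - sumK (map (λ { (ν , a) → a * fromℕ (kostka ν λ') }) acc))) ∷ [])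

  lookupK : List ℕ → List (List ℕ × K) → K
  lookupK λ' [] = 0#
  lookupK λ' ((ν , a) ∷ xs) = if ν == λ' then a else lookupK λ' xs

  schurCoeff : Λ̂ → List ℕ → K
  schurCoeff F λ' = lookupK λ' (schurList F (size λ'))

  -- Hall inner product (Σ a_λ s_λ , Σ b_λ s_λ) = Σ a_λ b_λ, where the
  -- second argument has degree ≤ d
  hall : Λ̂ → ℕ → Λ̂ → K
  hall F d f = sumK (map (λ λ' → schurCoeff F λ' * schurCoeff f λ') (partitionsUpTo d))

  ⟨_,_⟩ : Λ̂ → Λ → K
  ⟨ F , f ⟩ = hall F (deg f) (coeff f)

  -- F^⊥ f = Σ (F, f₁) f₂ with Δ f = f(x,y).  The coefficient of m_ν(y) in
  -- f(x,y) is the symmetric function of x with m_μ-coefficient [m_{μ∪ν}] f,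
  -- so [m_ν] F^⊥ f = (F , μ ↦ [m_{μ∪ν}] f).  (For |ν| > deg f this is 0;
  -- the guard only makes the degree bound definitional.)
  perpCoeff : Λ̂ → Λ → List ℕ → K
  perpCoeff F f ν with size ν ≤? deg f
  ... | yes _ = hall F (deg f) (λ μ → coeff f (merge μ ν))
  ... | no  _ = 0#

  _⊥ : Λ̂ → Λ → Λ
  coeff ((F ⊥) f) = perpCoeff F f
  deg ((F ⊥) f) = deg f
  bounded ((F ⊥) f) ν p lt with size ν ≤? deg f
  ... | yes q = ⊥-elim (<⇒≱ lt q)
  ... | no  _ = refl

  -- g_λ, with [x^ν] g_λ = number of RPPs (which is 0 when |ν| > |λ|,
  -- since Σ T(i) ≤ |λ|; the guard only makes the degree bound definitional)
  gCoeff : List ℕ → List ℕ → K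
  gCoeff λ' ν with size ν ≤? size λ'
  ... | yes _ = fromℕ (rppCount λ' ν)
  ... | no  _ = 0#

  g : List ℕ → Λ
  coeff (g λ') = gCoeff λ'
  deg (g λ') = size λ'
  bounded (g λ') ν p lt with size ν ≤? size λ'
  ... | yes q = ⊥-elim (<⇒≱ lt q)
  ... | no  _ = refl

  IsG : List ℕ → Λ̂ → Set ℓ
  IsG λ' G = ∀ μ → IsPartition μ → ⟨ G , g μ ⟩ ≈ (if μ == λ' then 1# else 0#)

  oneΛ̂ : Λ̂
  oneΛ̂ [] = 1#
  oneΛ̂ (_ ∷ _) = 0#

  allOnes : List ℕ → Bool
  allOnes = allᵇ (λ a → a ≡ᵇ 1)

  e : ℕ → Λ̂
  e i ν = if allOnes ν ∧ (length ν ≡ᵇ i) then 1# else 0#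

  -- E(-1) = Σ_{i≥0} (-1)^i e_i ; coefficientwise only i ≤ |ν| contribute
  E-1 : Λ̂
  E-1 ν = sumK (map (λ i → sign i * e i ν) (upTo (suc (size ν))))

  record IsLinear (I : Λ → Λ) : Set (c ⊔ˡ ℓ) where
    field
      cong     : ∀ f h → f ≈Λ h → I f ≈Λ I h
      additive : ∀ f h → I (f +Λ h) ≈Λ (I f +Λ I h)
      scalar   : ∀ a f → I (a ·Λ f) ≈Λ (a ·Λ I f)

  IsI : (Λ → Λ) → Set ℓ
  IsI I = ∀ λ' → IsPartition λ' →
            coeff (I (g λ')) ≈̂ (λ ν → sumK (map (λ μ → coeff (g μ) ν) (subpartitions λ')))

-- Let T f = f(1, x₁, x₂, …), that is [m_ν] T f = Σ_k [m_{ν∪k}] f.  The entries of a reverse plane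
-- partition other than the largest one form a reverse plane partition of a smaller shape, and the
-- number of reverse plane partitions is symmetric in the weight; hence T g_λ = Σ_{μ⊂λ} g_μ, and I = T
-- because the g_λ span Λ.  Symmetry means that the two steps λ ⊃ ν ⊃ μ can be exchanged, which is
-- shown by adding the columns one at a time.
-- In top degree g_λ is s_λ, so T s_λ is the sum of the s_ν with λ/ν a horizontal strip.  Since
-- (E(-1), s_ν) is (-1)^k if ν is the column 1ᵏ and 0 otherwise, (E(-1), T f) is the constant term
-- of f; applied to f(x, y) as a function of x this makes E(-1)^⊥ a two-sided inverse of T.
-- Applied to g_λ it gives Σ_{μ⊂λ} (E(-1), g_μ) = δ_{λ∅}, whence (E(-1), g_μ) = δ_{μ∅} − δ_{μ(1)},
-- which is the pairing of 1 − G_(1) with g_μ; the pairing is nondegenerate.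
module Submission where

open import Defs
open import Level using (Level)
open import Algebra.Bundles using (CommutativeRing)
open import Data.Nat using (ℕ; suc)
open import Data.List using (List; []; _∷_; map; upTo)
open import Data.Product using (_×_; _,_)

-- Weights are sorted lists, and this is the obstacle: setting a variable to 1 inserts a part at its
-- sorted place, whereas the largest entry owns the last exponent. Hence symmetry in the weight has
-- to come first. It is proved by comparing generating functions with natural coefficients, not by
-- an involution on fillings. A lone column with heights from `m` to `l`, `m < l`, has the symmetric
-- weight `x + y + (l - m - 1)xy`; the difficulty is that neighbouring columns bound each other, and
-- the exchange identities isolate this interaction. The count `chains` serves twice. A weight with
-- as many units as there are boxes forces strict columns, so `chains` also gives the Kostka
-- numbers: their unitriangularity and the rule for `T s_λ` are read off from `chains` in top
-- degree. Schur coefficients are defined by an elimination procedure. They are handled through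
-- existence and uniqueness of the solution of a unitriangular system, so that no division occurs
-- and `K` may be any commutative ring.

module Combinatorics where
  open import Algebra.Bundles using (CommutativeSemiring)
  open import Data.Bool using (Bool; true; false; T; if_then_else_; _∧_; _∨_)
  open import Data.Bool.Properties using (T?; T-∧)
  open import Data.Empty using (⊥-elim)
  open import Data.List using (concatMap; foldr; length; applyUpTo; zip; reverse; replicate; _++_; _∷ʳ_)
  import Data.List.Properties as List
  open import Data.List.Membership.Propositional using (_∈_)
  open import Data.List.Membership.Propositional.Properties
  open import Data.List.Relation.Binary.Permutation.Propositional
    using (_↭_; refl; prep; swap; trans; ↭-refl; ↭-trans; ↭-sym; ↭-reflexive)
  open import Data.List.Relation.Binary.Permutation.Propositional.Properties using (↭-reverse; shift; ++⁺ˡ; ++⁺ʳ)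
  open import Data.List.Relation.Unary.All using (All; []; _∷_)
  import Data.List.Relation.Unary.All as All
  import Data.List.Relation.Unary.All.Properties as All
  open import Data.List.Relation.Unary.AllPairs using (AllPairs; []; _∷_)
  import Data.List.Relation.Unary.AllPairs as AllPairs
  import Data.List.Relation.Unary.AllPairs.Properties as AllPairs
  open import Data.List.Relation.Unary.Any using (here; there)
  open import Data.List.Relation.Unary.Unique.Propositional using (Unique)
  import Data.List.Relation.Unary.Unique.Propositional.Properties as Unique
  open import Data.Maybe using (Maybe; just; nothing; fromMaybe)
  open import Data.Nat
    using (zero; _+_; _*_; _∸_; _⊓_; _≤_; _<_; _≡ᵇ_; _≤ᵇ_; _<ᵇ_; z≤n; s≤s; _<?_; _≤?_)
  import Data.Nat.Properties as ℕ
  open import Data.Nat.ListAction.Properties using (sum-↭; sum-++)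
  open import Data.Nat.Solver using (module +-*-Solver)
  open import Data.Product using (_,_; proj₁; proj₂; ∃; uncurry)
  open import Data.Sum using (_⊎_; inj₁; inj₂)
  open import Data.Unit using (tt)
  open import Function using (_∘_; id)
  open import Function.Bundles using (module Equivalence)
  open import Relation.Nullary using (¬_; yes; no)
  open import Relation.Binary.Definitions using (tri<; tri≈; tri>)
  open import Relation.Binary.PropositionalEquality as ≡
    using (_≡_; _≢_; refl; cong; cong₂; subst; module ≡-Reasoning)

  -- Finite sums

  private variable
    a b : Level
    A : Set a
    B : Set b

  ∧-intro : ∀ {x y} → T x → T y → T (x ∧ y)
  ∧-intro p q = Equivalence.from T-∧ (p , q)

  ∧-elim : ∀ {x y} → T (x ∧ y) → T x × T y
  ∧-elim = Equivalence.to T-∧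

  ==⇒≡ : ∀ xs ys → T (xs == ys) → xs ≡ ys
  ==⇒≡ []       []       _ = refl
  ==⇒≡ (x ∷ xs) (y ∷ ys) p with q , r ← ∧-elim {x ≡ᵇ y} p =
    cong₂ _∷_ (ℕ.≡ᵇ⇒≡ x y q) (==⇒≡ xs ys r)

  ==-refl : ∀ xs → T (xs == xs)
  ==-refl []       = tt
  ==-refl (x ∷ xs) = ∧-intro {x ≡ᵇ x} (ℕ.≡⇒≡ᵇ x x refl) (==-refl xs)

  ≡⇒== : ∀ {xs ys} → xs ≡ ys → T (xs == ys)
  ≡⇒== {xs} refl = ==-refl xs

  T-ext : ∀ {x y} → (T x → T y) → (T y → T x) → x ≡ y
  T-ext {true}  {true}  _ _ = refl
  T-ext {true}  {false} f _ = ⊥-elim (f tt)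
  T-ext {false} {true}  _ g = ⊥-elim (g tt)
  T-ext {false} {false} _ _ = refl

  -- Used at the natural numbers for counting and at `K` for coefficients. As a fold of a map,
  -- `∑ xs f` at `K` is `sumK (map f xs)` by definition.
  module Summation {c ℓ} (S : CommutativeSemiring c ℓ) where
    private module S = CommutativeSemiring S
    open CommutativeSemiring S
      using (Carrier; _≈_; 0#; 1#)
      renaming (_+_ to _⊕_; _*_ to _⊛_)
    open import Relation.Binary.Reasoning.Setoid S.setoid
    open import Algebra.Properties.CommutativeSemigroup S.+-commutativeSemigroup using (interchange)

    ∑ : List A → (A → Carrier) → Carrier
    ∑ xs f = foldr _⊕_ 0# (map f xs)

    ind : Bool → Carrier
    ind x = if x then 1# else 0#

    ind-true : ∀ {x} → T x → ind x ≈ 1#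
    ind-true {true} _ = S.refl

    ind-false : ∀ {x} → ¬ T x → ind x ≈ 0#
    ind-false {true}  p = ⊥-elim (p tt)
    ind-false {false} _ = S.refl

    ind-cong : ∀ {x y} → (T x → T y) → (T y → T x) → ind x ≈ ind y
    ind-cong f g = S.reflexive (cong ind (T-ext f g))

    ind-∧ : ∀ x y → ind (x ∧ y) ≈ ind x ⊛ ind y
    ind-∧ true  y = S.sym (S.*-identityˡ _)
    ind-∧ false y = S.sym (S.zeroˡ _)

    ind-*-zero : ∀ {x} {y} → ¬ T x → ind x ⊛ y ≈ 0#
    ind-*-zero p = S.trans (S.*-congʳ (ind-false p)) (S.zeroˡ _)

    ind-*-one : ∀ {x} {y} → T x → ind x ⊛ y ≈ y
    ind-*-one p = S.trans (S.*-congʳ (ind-true p)) (S.*-identityˡ _)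

    ∑-cong : ∀ (xs : List A) {f g} → (∀ x → x ∈ xs → f x ≈ g x) → ∑ xs f ≈ ∑ xs g
    ∑-cong []       p = S.refl
    ∑-cong (x ∷ xs) p = S.+-cong (p x (here refl)) (∑-cong xs (λ y q → p y (there q)))

    ∑-zero : ∀ (xs : List A) {f} → (∀ x → x ∈ xs → f x ≈ 0#) → ∑ xs f ≈ 0#
    ∑-zero []       p = S.refl
    ∑-zero (x ∷ xs) p = S.trans (S.+-cong (p x (here refl)) (∑-zero xs (λ y q → p y (there q)))) (S.+-identityˡ 0#)

    ∑-+ : ∀ (xs : List A) f g → ∑ xs (λ x → f x ⊕ g x) ≈ ∑ xs f ⊕ ∑ xs g
    ∑-+ []       f g = S.sym (S.+-identityˡ 0#)
    ∑-+ (x ∷ xs) f g = S.trans (S.+-congˡ (∑-+ xs f g)) (interchange _ _ _ _)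

    ∑-*ˡ : ∀ (xs : List A) y f → ∑ xs (λ x → y ⊛ f x) ≈ y ⊛ ∑ xs f
    ∑-*ˡ []       y f = S.sym (S.zeroʳ y)
    ∑-*ˡ (x ∷ xs) y f = S.trans (S.+-congˡ (∑-*ˡ xs y f)) (S.sym (S.distribˡ y _ _))

    ∑-*ʳ : ∀ (xs : List A) f y → ∑ xs (λ x → f x ⊛ y) ≈ ∑ xs f ⊛ y
    ∑-*ʳ xs f y = begin
      ∑ xs (λ x → f x ⊛ y)  ≈⟨ ∑-cong xs (λ x _ → S.*-comm (f x) y) ⟩
      ∑ xs (λ x → y ⊛ f x)  ≈⟨ ∑-*ˡ xs y f ⟩
      y ⊛ ∑ xs f            ≈⟨ S.*-comm y _ ⟩
      ∑ xs f ⊛ y            ∎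

    ∑-++ : ∀ (xs ys : List A) f → ∑ (xs ++ ys) f ≈ ∑ xs f ⊕ ∑ ys f
    ∑-++ []       ys f = S.sym (S.+-identityˡ _)
    ∑-++ (x ∷ xs) ys f = S.trans (S.+-congˡ (∑-++ xs ys f)) (S.sym (S.+-assoc _ _ _))

    ∑-map : ∀ (h : A → B) xs f → ∑ (map h xs) f ≡ ∑ xs (f ∘ h)
    ∑-map h []       f = refl
    ∑-map h (x ∷ xs) f = cong (f (h x) ⊕_) (∑-map h xs f)

    ∑-concatMap : ∀ (h : A → List B) xs f → ∑ (concatMap h xs) f ≈ ∑ xs (λ x → ∑ (h x) f)
    ∑-concatMap h []       f = S.refl
    ∑-concatMap h (x ∷ xs) f = S.trans (∑-++ (h x) (concatMap h xs) f) (S.+-congˡ (∑-concatMap h xs f))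

    ∑-filterᵇ : ∀ {A : Set} (p : A → Bool) xs f → ∑ (filterᵇ p xs) f ≈ ∑ xs (λ x → ind (p x) ⊛ f x)
    ∑-filterᵇ p []       f = S.refl
    ∑-filterᵇ p (x ∷ xs) f with p x
    ... | true  = S.+-cong (S.sym (S.*-identityˡ _)) (∑-filterᵇ p xs f)
    ... | false = S.trans (∑-filterᵇ p xs f) (S.trans (S.sym (S.+-identityˡ _)) (S.+-congʳ (S.sym (S.zeroˡ _))))

    ∑-swap : ∀ (xs : List A) (ys : List B) (f : A → B → Carrier) →
             ∑ xs (λ x → ∑ ys (f x)) ≈ ∑ ys (λ y → ∑ xs (λ x → f x y))
    ∑-swap []       ys f = S.sym (∑-zero ys (λ _ _ → S.refl))
    ∑-swap (x ∷ xs) ys f = S.trans (S.+-congˡ (∑-swap xs ys f)) (S.sym (∑-+ ys (f x) _))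

    ∑-single : ∀ {xs : List A} {f x} → Unique xs → x ∈ xs →
               (∀ y → y ∈ xs → y ≢ x → f y ≈ 0#) → ∑ xs f ≈ f x
    ∑-single {xs = x ∷ xs} (x∉ ∷ u) (here refl) z =
      S.trans (S.+-congˡ (∑-zero xs (λ y q → z y (there q) (λ y≡x → All.lookup x∉ q (≡.sym y≡x)))))
              (S.+-identityʳ _)
    ∑-single {xs = w ∷ xs} (w∉ ∷ u) (there p) z =
      S.trans (S.+-cong (z w (here refl) (All.lookup w∉ p)) (∑-single u p (λ y q → z y (there q))))
              (S.+-identityˡ _)

    ∑-upTo-suc : ∀ n f → ∑ (upTo (suc n)) f ≈ ∑ (upTo n) f ⊕ f n
    ∑-upTo-suc n f = begin
      ∑ (upTo (suc n)) f    ≡⟨ cong (λ xs → ∑ xs f) (List.upTo-∷ʳ n) ⟨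
      ∑ (upTo n ∷ʳ n) f     ≈⟨ ∑-++ (upTo n) (n ∷ []) f ⟩
      ∑ (upTo n) f ⊕ (f n ⊕ 0#) ≈⟨ S.+-congˡ (S.+-identityʳ _) ⟩
      ∑ (upTo n) f ⊕ f n    ∎

    -- Double counting: both sums are the total of the matrix `m x y`, which carries `g y` where
    -- `p x` holds and `y` is `F x`, and is zero elsewhere. `p` and `q` cut out the supports between
    -- which `F` and `G` are inverse, so neither list has to be filtered first.
    ∑-bij : ∀ {xs : List A} {ys : List (List ℕ)} {f g} (p : A → Bool) (q : List ℕ → Bool) (F : A → List ℕ) (G : List ℕ → A) →
            Unique xs → Unique ys →
            (∀ x → ¬ T (p x) → f x ≈ 0#) → (∀ y → ¬ T (q y) → g y ≈ 0#) →
            (∀ x → x ∈ xs → T (p x) → F x ∈ ys × T (q (F x)) × G (F x) ≡ x × f x ≈ g (F x)) →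
            (∀ y → y ∈ ys → T (q y) → G y ∈ xs × T (p (G y)) × F (G y) ≡ y) →
            ∑ xs f ≈ ∑ ys g
    ∑-bij {xs = xs} {ys} {f} {g} p q F G u v fz gz to from = begin
      ∑ xs f                    ≈⟨ ∑-cong xs row ⟩
      ∑ xs (λ x → ∑ ys (m x))   ≈⟨ ∑-swap xs ys m ⟩
      ∑ ys (λ y → ∑ xs (λ x → m x y)) ≈⟨ ∑-cong ys col ⟩
      ∑ ys g                    ∎
      where
      m : _ → List ℕ → Carrier
      m x y = ind (p x ∧ (F x == y)) ⊛ g y

      m-zero : ∀ x y → ¬ (T (p x) × F x ≡ y) → m x y ≈ 0#
      m-zero x y n = ind-*-zero (λ t → n (proj₁ (∧-elim t) , ==⇒≡ _ _ (proj₂ (∧-elim {p x} t))))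

      m-one : ∀ x y → T (p x) → F x ≡ y → m x y ≈ g y
      m-one x y px refl = ind-*-one (∧-intro px (==-refl (F x)))

      row : ∀ x → x ∈ xs → f x ≈ ∑ ys (m x)
      row x x∈ with T? (p x)
      ... | no ¬px = S.trans (fz x ¬px) (S.sym (∑-zero ys (λ y _ → m-zero x y (¬px ∘ proj₁))))
      ... | yes px with F∈ , _ , _ , eq ← to x x∈ px =
        S.trans eq (S.sym (S.trans
          (∑-single v F∈ (λ y _ y≢ → m-zero x y (λ z → y≢ (≡.sym (proj₂ z)))))
          (m-one x (F x) px refl)))

      col : ∀ y → y ∈ ys → ∑ xs (λ x → m x y) ≈ g y
      col y y∈ with T? (q y)
      ... | no ¬qy = S.trans (∑-zero xs (λ x x∈ → m-zero x y (λ { (px , refl) → ¬qy (proj₁ (proj₂ (to x x∈ px))) })))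
                             (S.sym (gz y ¬qy))
      ... | yes qy with G∈ , pG , FG ← from y y∈ qy =
        S.trans (∑-single u G∈ (λ x x∈ x≢ → m-zero x y (λ { (px , refl) → x≢ (≡.sym (proj₁ (proj₂ (proj₂ (to x x∈ px))))) })))
                (m-one (G y) y pG FG)

    ∑-δ : ∀ {ys : List (List ℕ)} {y} (f : List ℕ → Carrier) → Unique ys → y ∈ ys → ∑ ys (λ z → ind (y == z) ⊛ f z) ≈ f y
    ∑-δ {y = y} f u y∈ = S.trans (∑-single u y∈ (λ z _ z≢ → ind-*-zero (z≢ ∘ ≡.sym ∘ ==⇒≡ y z)))
                                 (ind-*-one (==-refl y))

    ∑-⊆ : ∀ {xs ys : List (List ℕ)} {f g : List ℕ → Carrier} (p : List ℕ → Bool) → Unique xs → Unique ys →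
          (∀ x → x ∈ xs → T (p x) × x ∈ ys × f x ≈ g x) →
          (∀ y → y ∈ ys → T (p y) → y ∈ xs) →
          ∑ xs f ≈ ∑ ys (λ y → ind (p y) ⊛ g y)
    ∑-⊆ {xs = xs} {ys} {f} {g} p u v to from =
      S.trans (∑-cong xs (λ x x∈ → S.trans (proj₂ (proj₂ (to x x∈))) (S.sym (ind-*-one (proj₁ (to x x∈))))))
              (∑-bij p p id id u v
                (λ _ → ind-*-zero) (λ _ → ind-*-zero)
                (λ x x∈ px → proj₁ (proj₂ (to x x∈)) , px , refl , S.refl)
                (λ y y∈ py → from y y∈ py , py , refl))

  open Summation ℕ.+-*-commutativeSemiring public

  count-∑ : ∀ {A : Set} (p : A → Bool) xs → count p xs ≡ ∑ xs (ind ∘ p)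
  count-∑ p []       = refl
  count-∑ p (x ∷ xs) with p x
  ... | true  = cong suc (count-∑ p xs)
  ... | false = count-∑ p xs

  ∑-mono : ∀ (xs : List A) {f g} → (∀ x → x ∈ xs → f x ≤ g x) → ∑ xs f ≤ ∑ xs g
  ∑-mono []       p = z≤n
  ∑-mono (x ∷ xs) p = ℕ.+-mono-≤ (p x (here refl)) (∑-mono xs (λ y q → p y (there q)))

  -- The equality case of `∑-mono`. It turns an equality of totals into a statement about every
  -- single column or entry.
  ∑-≡⇒≡ : ∀ (xs : List A) {f g} → (∀ x → x ∈ xs → f x ≤ g x) → ∑ xs g ≤ ∑ xs f → ∀ x → x ∈ xs → f x ≡ g x
  ∑-≡⇒≡ (y ∷ xs) {f} {g} p q x (here refl) = ℕ.≤-antisym (p x (here refl)) (ℕ.+-cancelʳ-≤ (∑ xs f) _ _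
    (ℕ.≤-trans (ℕ.+-monoʳ-≤ (g x) (∑-mono xs (λ z r → p z (there r)))) q))
  ∑-≡⇒≡ (y ∷ xs) {f} {g} p q x (there r) = ∑-≡⇒≡ xs (λ z r → p z (there r)) (ℕ.+-cancelˡ-≤ (f y) _ _
    (ℕ.≤-trans (ℕ.+-monoˡ-≤ (∑ xs g) (p y (here refl))) q)) x r

  ∈-∑-≤ : ∀ {xs : List A} {x} f → x ∈ xs → f x ≤ ∑ xs f
  ∈-∑-≤ f (here refl) = ℕ.m≤m+n _ _
  ∈-∑-≤ f (there p)   = ℕ.≤-trans (∈-∑-≤ f p) (ℕ.m≤n+m _ _)

  -- Partitions

  row : List ℕ → ℕ → ℕ
  row []      r       = 0
  row (a ∷ l) zero    = a
  row (a ∷ l) (suc r) = row l r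

  -- The conjugate partition, with columns counted from 0.
  col : List ℕ → ℕ → ℕ
  col l j = ∑ l (λ a → ind (j <ᵇ a))

  -- The exponent contributed by an entry that fills exactly `λ′/μ`: column `j` of the skew shape
  -- has a box when its two heights differ.
  skewCols : List ℕ → List ℕ → ℕ
  skewCols λ′ μ = ∑ (upTo (headOr0 λ′)) (λ j → ind (col μ j <ᵇ col λ′ j))

  head-pos : ∀ {a l} → IsPartition (a ∷ l) → 1 ≤ a
  head-pos [ p ]   = p
  head-pos (p ∷ q) = ℕ.≤-trans (head-pos q) p

  tail-partition : ∀ {a l} → IsPartition (a ∷ l) → IsPartition l
  tail-partition [ p ]   = []
  tail-partition (p ∷ q) = q

  tail-head : ∀ {a l} → IsPartition (a ∷ l) → headOr0 l ≤ a
  tail-head [ p ]   = z≤n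
  tail-head (p ∷ q) = p

  cons-partition : ∀ {a l} → 1 ≤ a → headOr0 l ≤ a → IsPartition l → IsPartition (a ∷ l)
  cons-partition {l = []}    p q _ = [ p ]
  cons-partition {l = b ∷ l} p q r = q ∷ r

  -- Unlike `IsPartition` this allows zeros: lists of column heights are padded with zeros up to the
  -- width of the outer shape.
  data Decreasing : List ℕ → Set where
    []   : Decreasing []
    cons : ∀ {a l} → headOr0 l ≤ a → Decreasing l → Decreasing (a ∷ l)

  decreasing : ∀ {l} → IsPartition l → Decreasing l
  decreasing {[]}    p = []
  decreasing {a ∷ l} p = cons (tail-head p) (decreasing (tail-partition p))

  row≤head : ∀ {l} → Decreasing l → ∀ r → row l r ≤ headOr0 l
  row≤head []         r       = z≤n
  row≤head (cons h p) zero    = ℕ.≤-refl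
  row≤head (cons h p) (suc r) = ℕ.≤-trans (row≤head p r) h

  row-suc : ∀ {l} → IsPartition l → ∀ r → row l (suc r) ≤ row l r
  row-suc {[]}    p r       = z≤n
  row-suc {a ∷ l} p zero    = ℕ.≤-trans (row≤head (decreasing (tail-partition p)) 0) (tail-head p)
  row-suc {a ∷ l} p (suc r) = row-suc (tail-partition p) r

  row-head : ∀ l → row l 0 ≡ headOr0 l
  row-head []      = refl
  row-head (a ∷ l) = refl

  row-length : ∀ l {r} → length l ≤ r → row l r ≡ 0
  row-length []      _       = refl
  row-length (a ∷ l) (s≤s p) = row-length l p

  row-ext : ∀ {λ′ μ} → IsPartition λ′ → IsPartition μ → (∀ r → row λ′ r ≡ row μ r) → λ′ ≡ μ
  row-ext {[]}    {[]}    p q eq = refl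
  row-ext {[]}    {b ∷ μ} p q eq with () ← subst (1 ≤_) (≡.sym (eq 0)) (head-pos q)
  row-ext {a ∷ l} {[]}    p q eq with () ← subst (1 ≤_) (eq 0) (head-pos p)
  row-ext {a ∷ l} {b ∷ μ} p q eq =
    cong₂ _∷_ (eq 0) (row-ext (tail-partition p) (tail-partition q) (eq ∘ suc))

  ≤-ext : ∀ {m n} → (∀ i → i < m → i < n) → m ≤ n
  ≤-ext {m} {n} f with m ≤? n
  ... | yes p = p
  ... | no ¬p = ⊥-elim (ℕ.<-irrefl refl (f n (ℕ.≰⇒> ¬p)))

  ind≤1 : ∀ x → ind x ≤ 1
  ind≤1 true  = ℕ.≤-refl
  ind≤1 false = z≤n

  ind-<-one : ∀ {j a} → j < a → ind (j <ᵇ a) ≡ 1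
  ind-<-one p = ind-true (ℕ.<⇒<ᵇ p)

  ind-<-zero : ∀ {j a} → a ≤ j → ind (j <ᵇ a) ≡ 0
  ind-<-zero {j} {a} p = ind-false (λ t → ℕ.<⇒≱ (ℕ.<ᵇ⇒< j a t) p)

  col-zero : ∀ {l} → Decreasing l → ∀ {j} → headOr0 l ≤ j → col l j ≡ 0
  col-zero []         q = refl
  col-zero (cons h p) q = cong₂ _+_ (ind-<-zero q) (col-zero p (ℕ.≤-trans h q))

  -- Together with `<row⇒<col`: both inequalities say that the box `(r , j)` lies in the diagram.
  -- This is how comparisons pass between rows and columns.
  <col⇒<row : ∀ {l} → Decreasing l → ∀ {r j} → r < col l j → j < row l r
  <col⇒<row (cons {a} h p) {r} {j} q with j <? a
  <col⇒<row (cons {a} h p) {zero}  {j} q | yes j<a = j<a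
  <col⇒<row (cons {a} {l} h p) {suc r} {j} q | yes j<a =
    <col⇒<row p (ℕ.≤-pred (subst (suc r <_) (cong (_+ col l j) (ind-<-one j<a)) q))
  <col⇒<row (cons {a} h p) {r} {j} q | no j≮a with () ← subst (r <_) (col-zero (cons h p) (ℕ.≮⇒≥ j≮a)) q

  <row⇒<col : ∀ {l} → Decreasing l → ∀ {r j} → j < row l r → r < col l j
  <row⇒<col (cons {l = l} h p) {zero}  {j} q = subst (0 <_) (cong (_+ col l j) (≡.sym (ind-<-one q))) (s≤s z≤n)
  <row⇒<col (cons {l = l} h p) {suc r} {j} q =
    subst (suc r <_) (cong (_+ col l j) (≡.sym (ind-<-one j<a))) (s≤s (<row⇒<col p q))
    where j<a = ℕ.≤-trans q (row≤head (cons h p) (suc r))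

  col≤length : ∀ l j → col l j ≤ length l
  col≤length []      j = z≤n
  col≤length (a ∷ l) j = ℕ.+-mono-≤ (ind≤1 (j <ᵇ a)) (col≤length l j)

  col-suc : ∀ l j → col l (suc j) ≤ col l j
  col-suc l j = ∑-mono l (λ a _ → step a)
    where
    step : ∀ a → ind (suc j <ᵇ a) ≤ ind (j <ᵇ a)
    step a with suc j <? a
    ... | yes p = ℕ.≤-reflexive (≡.trans (ind-<-one p) (≡.sym (ind-<-one (ℕ.<-trans (ℕ.n<1+n j) p))))
    ... | no ¬p = ℕ.≤-trans (ℕ.≤-reflexive (ind-<-zero (ℕ.≮⇒≥ ¬p))) z≤n

  ∑-ind-< : ∀ {a} n → a ≤ n → ∑ (upTo n) (λ j → ind (j <ᵇ a)) ≡ a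
  ∑-ind-< zero z≤n = refl
  ∑-ind-< {a} (suc n) q with ℕ.m≤n⇒m<n∨m≡n q
  ... | inj₁ (s≤s a≤n) = ≡.trans (∑-upTo-suc n _)
    (≡.trans (cong₂ _+_ (∑-ind-< n a≤n) (ind-<-zero a≤n)) (ℕ.+-identityʳ a))
  ... | inj₂ refl = ≡.trans (∑-upTo-suc n _)
    (≡.trans (cong₂ _+_ (≡.trans (∑-cong (upTo n) below) (∑-ind-< n ℕ.≤-refl)) (ind-<-one (ℕ.n<1+n n))) (ℕ.+-comm n 1))
    where
    below : ∀ j → j ∈ upTo n → ind (j <ᵇ suc n) ≡ ind (j <ᵇ n)
    below j j∈ = ≡.trans (ind-<-one (ℕ.m≤n⇒m≤1+n (∈-upTo⁻ j∈))) (≡.sym (ind-<-one (∈-upTo⁻ j∈)))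

  size-col : ∀ {l} → IsPartition l → ∀ n → headOr0 l ≤ n → size l ≡ ∑ (upTo n) (col l)
  size-col {[]}    p n q = ≡.sym (∑-zero (upTo n) (λ _ _ → refl))
  size-col {a ∷ l} p n q = ≡.trans
    (cong₂ _+_ (≡.sym (∑-ind-< n q)) (size-col (tail-partition p) n (ℕ.≤-trans (tail-head p) q)))
    (≡.sym (∑-+ (upTo n) (λ j → ind (j <ᵇ a)) (col l)))

  contained⇒row : ∀ μ λ′ → T (contained μ λ′) → ∀ r → row μ r ≤ row λ′ r
  contained⇒row []      λ′       c r       = z≤n
  contained⇒row (a ∷ μ) (b ∷ λ′) c zero    = ℕ.≤ᵇ⇒≤ a b (proj₁ (∧-elim c))
  contained⇒row (a ∷ μ) (b ∷ λ′) c (suc r) = contained⇒row μ λ′ (proj₂ (∧-elim {a ≤ᵇ b} c)) r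

  row⇒contained : ∀ {μ λ′} → IsPartition μ → (∀ r → row μ r ≤ row λ′ r) → T (contained μ λ′)
  row⇒contained {[]}             p c = tt
  row⇒contained {a ∷ μ} {[]}     p c = ⊥-elim (ℕ.<⇒≱ (head-pos p) (c 0))
  row⇒contained {a ∷ μ} {b ∷ λ′} p c = ∧-intro (ℕ.≤⇒≤ᵇ (c 0)) (row⇒contained (tail-partition p) (c ∘ suc))

  contained-refl : ∀ {λ′} → IsPartition λ′ → T (contained λ′ λ′)
  contained-refl p = row⇒contained p (λ _ → ℕ.≤-refl)

  contained-trans : ∀ {λ′ μ ν} → IsPartition λ′ → T (contained λ′ μ) → T (contained μ ν) → T (contained λ′ ν)
  contained-trans {λ′} {μ} {ν} p c d =
    row⇒contained p (λ r → ℕ.≤-trans (contained⇒row λ′ μ c r) (contained⇒row μ ν d r))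

  contained⇒size : ∀ μ λ′ → T (contained μ λ′) → size μ ≤ size λ′
  contained⇒size []      λ′       c = z≤n
  contained⇒size (a ∷ μ) (b ∷ λ′) c with p , q ← ∧-elim {a ≤ᵇ b} c =
    ℕ.+-mono-≤ (ℕ.≤ᵇ⇒≤ a b p) (contained⇒size μ λ′ q)

  contained-size-≡ : ∀ μ {λ′} → IsPartition λ′ → T (contained μ λ′) → size λ′ ≤ size μ → μ ≡ λ′
  contained-size-≡ []      {[]}     p c s = refl
  contained-size-≡ []      {b ∷ λ′} p c s with () ← ℕ.≤-trans (head-pos p) (ℕ.≤-trans (ℕ.m≤m+n b (size λ′)) s)
  contained-size-≡ (a ∷ μ) {b ∷ λ′} p c s with q , r ← ∧-elim {a ≤ᵇ b} c =
    cong₂ _∷_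
      (ℕ.≤-antisym a≤b (ℕ.+-cancelʳ-≤ (size λ′) _ _ (ℕ.≤-trans s (ℕ.+-monoʳ-≤ a (contained⇒size μ λ′ r)))))
      (contained-size-≡ μ (tail-partition p) r (ℕ.+-cancelˡ-≤ a _ _ (ℕ.≤-trans (ℕ.+-monoˡ-≤ (size λ′) a≤b) s)))
    where a≤b = ℕ.≤ᵇ⇒≤ a b q

  contained⇒col : ∀ {μ λ′} → IsPartition μ → IsPartition λ′ → T (contained μ λ′) → ∀ j → col μ j ≤ col λ′ j
  contained⇒col {μ} {λ′} p q c j = ≤-ext (λ i i< →
    <row⇒<col (decreasing q) (ℕ.≤-trans (<col⇒<row (decreasing p) i<) (contained⇒row μ λ′ c i)))

  col⇒contained : ∀ {μ λ′} → IsPartition μ → IsPartition λ′ → (∀ j → col μ j ≤ col λ′ j) → T (contained μ λ′)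
  col⇒contained p q c = row⇒contained p (λ r → ≤-ext (λ j j< →
    <col⇒<row (decreasing q) (ℕ.≤-trans (<row⇒<col (decreasing p) j<) (c j))))

  contained⇒head : ∀ μ λ′ → T (contained μ λ′) → headOr0 μ ≤ headOr0 λ′
  contained⇒head μ λ′ c = ℕ.≤-trans (ℕ.≤-reflexive (≡.sym (row-head μ)))
    (ℕ.≤-trans (contained⇒row μ λ′ c 0) (ℕ.≤-reflexive (row-head λ′)))

  col-ext : ∀ {μ λ′} → IsPartition μ → IsPartition λ′ → (∀ j → col μ j ≡ col λ′ j) → μ ≡ λ′
  col-ext {μ} {λ′} p q eq = row-ext p q (λ r → ℕ.≤-antisym
    (contained⇒row μ λ′ (col⇒contained p q (ℕ.≤-reflexive ∘ eq)) r)
    (contained⇒row λ′ μ (col⇒contained q p (ℕ.≤-reflexive ∘ ≡.sym ∘ eq)) r))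

  -- Column by column: a nonempty column of `λ′/μ` has at least one box. Equality characterises
  -- horizontal strips.
  skewCols+size≤ : ∀ {μ λ′} → IsPartition μ → IsPartition λ′ → T (contained μ λ′) → skewCols λ′ μ + size μ ≤ size λ′
  skewCols+size≤ {μ} {λ′} p q c = begin
    skewCols λ′ μ + size μ  ≡⟨ cong (skewCols λ′ μ +_) (size-col p n (contained⇒head μ λ′ c)) ⟩
    skewCols λ′ μ + ∑ (upTo n) (col μ) ≡⟨ ∑-+ (upTo n) _ (col μ) ⟨
    ∑ (upTo n) (λ j → ind (col μ j <ᵇ col λ′ j) + col μ j) ≤⟨ ∑-mono (upTo n) (λ j _ → step j) ⟩
    ∑ (upTo n) (col λ′)     ≡⟨ size-col q n ℕ.≤-refl ⟨
    size λ′                 ∎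
    where
    open ℕ.≤-Reasoning
    n = headOr0 λ′
    step : ∀ j → ind (col μ j <ᵇ col λ′ j) + col μ j ≤ col λ′ j
    step j with col μ j <? col λ′ j
    ... | yes lt = ℕ.≤-trans (ℕ.≤-reflexive (cong (_+ col μ j) (ind-<-one lt))) lt
    ... | no ≮ = ℕ.≤-trans (ℕ.≤-reflexive (cong (_+ col μ j) (ind-<-zero (ℕ.≮⇒≥ ≮)))) (contained⇒col p q c j)

  -- Stopping at the first zero keeps zero parts out; `n` limits the number of rows read.
  fromRows : ℕ → (ℕ → ℕ) → List ℕ
  fromRows zero    ρ = []
  fromRows (suc n) ρ = if ρ 0 ≡ᵇ 0 then [] else ρ 0 ∷ fromRows n (ρ ∘ suc)

  antitone : ∀ {ρ : ℕ → ℕ} → (∀ r → ρ (suc r) ≤ ρ r) → ∀ r → ρ r ≤ ρ 0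
  antitone anti zero    = ℕ.≤-refl
  antitone anti (suc r) = ℕ.≤-trans (anti r) (antitone anti r)

  row-fromRows : ∀ n {ρ} → (∀ r → ρ (suc r) ≤ ρ r) → ρ n ≡ 0 → ∀ r → row (fromRows n ρ) r ≡ ρ r
  row-fromRows zero    anti z r = ≡.sym (ℕ.n≤0⇒n≡0 (ℕ.≤-trans (antitone anti r) (ℕ.≤-reflexive z)))
  row-fromRows (suc n) {ρ} anti z r with ρ 0 in eq
  row-fromRows (suc n) {ρ} anti z r | zero = ≡.sym (ℕ.n≤0⇒n≡0 (ℕ.≤-trans (antitone anti r) (ℕ.≤-reflexive eq)))
  row-fromRows (suc n) {ρ} anti z zero    | suc a = ≡.sym eq
  row-fromRows (suc n) {ρ} anti z (suc r) | suc a = row-fromRows n (anti ∘ suc) z r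

  fromRows-partition : ∀ n {ρ} → (∀ r → ρ (suc r) ≤ ρ r) → IsPartition (fromRows n ρ)
  fromRows-head : ∀ n {ρ} → headOr0 (fromRows n ρ) ≤ ρ 0
  fromRows-head zero    = z≤n
  fromRows-head (suc n) {ρ} with ρ 0
  ... | zero  = z≤n
  ... | suc a = ℕ.≤-refl
  fromRows-partition zero    anti = []
  fromRows-partition (suc n) {ρ} anti with ρ 0 in eq
  ... | zero  = []
  ... | suc a = cons-partition (s≤s z≤n)
    (ℕ.≤-trans (fromRows-head n) (ℕ.≤-trans (anti 0) (ℕ.≤-reflexive eq)))
    (fromRows-partition n (anti ∘ suc))

  -- Enumeration of partitions in decreasing lexicographic order.

  data _≻_ : List ℕ → List ℕ → Set where
    -- No constructor treats proper prefixes: two different partitions of the same size differ at a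
    -- position where both have a part.
    here  : ∀ {a b l m} → b < a → (a ∷ l) ≻ (b ∷ m)
    there : ∀ {a l m} → l ≻ m → (a ∷ l) ≻ (a ∷ m)

  ≻⇒≢ : ∀ {l m} → l ≻ m → l ≢ m
  ≻⇒≢ (here p)  refl = ℕ.<-irrefl refl p
  ≻⇒≢ (there p) refl = ≻⇒≢ p refl

  -- Lists with a common head form a block ordered by tails, and the blocks are ordered by heads.
  -- The argument yields the order of `parts` and, with inequality for both relations, the absence
  -- of repetitions.
  concatMap-cons-AllPairs : ∀ {R : ℕ → ℕ → Set} {S : List ℕ → List ℕ → Set} {xs} {f : ℕ → List (List ℕ)} →
    (∀ {x y l m} → R x y → S (x ∷ l) (y ∷ m)) → (∀ {x l m} → S l m → S (x ∷ l) (x ∷ m)) →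
    AllPairs R xs → (∀ x → AllPairs S (f x)) →
    AllPairs S (concatMap (λ x → map (x ∷_) (f x)) xs)
  concatMap-cons-AllPairs {xs = xs} {f} h t u v = AllPairs.concat⁺
    (All.map⁺ (All.universal (λ x → AllPairs.map⁺ (AllPairs.map t (v x))) xs))
    (AllPairs.map⁺ (AllPairs.map (λ r → All.map⁺ (All.universal (λ _ → All.map⁺ (All.universal (λ _ → h r) _)) _)) u))

  concatMap-cons-Unique : ∀ {xs} {f : ℕ → List (List ℕ)} → Unique xs → (∀ x → Unique (f x)) →
                          Unique (concatMap (λ x → map (x ∷_) (f x)) xs)
  concatMap-cons-Unique = concatMap-cons-AllPairs (λ { n refl → n refl }) (λ { n refl → n refl })

  ∈-concatMap-cons⁻ : ∀ {f : ℕ → List (List ℕ)} xs {l} → l ∈ concatMap (λ x → map (x ∷_) (f x)) xs →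
                      ∃ λ x → ∃ λ m → x ∈ xs × m ∈ f x × l ≡ x ∷ m
  ∈-concatMap-cons⁻ {f} (x ∷ xs) p with ∈-++⁻ (map (x ∷_) (f x)) p
  ... | inj₁ q with m , m∈ , eq ← ∈-map⁻ (x ∷_) q = x , m , here refl , m∈ , eq
  ... | inj₂ q with y , m , y∈ , r ← ∈-concatMap-cons⁻ xs q = y , m , there y∈ , r

  ∈-concatMap-cons⁺ : ∀ {f : ℕ → List (List ℕ)} {xs x m} → x ∈ xs → m ∈ f x →
                      x ∷ m ∈ concatMap (λ x → map (x ∷_) (f x)) xs
  ∈-concatMap-cons⁺ {f} {x ∷ xs} (here refl) q = ∈-++⁺ˡ (∈-map⁺ (x ∷_) q)
  ∈-concatMap-cons⁺ {f} {x ∷ xs} (there p)   q = ∈-++⁺ʳ (map (x ∷_) (f x)) (∈-concatMap-cons⁺ p q)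

  countdown : ℕ → List ℕ
  countdown n = map (n ∸_) (upTo n)

  ∈-countdown⁻ : ∀ {n k} → k ∈ countdown n → 1 ≤ k × k ≤ n
  ∈-countdown⁻ {n} p with i , i∈ , refl ← ∈-map⁻ (n ∸_) p = ℕ.m<n⇒0<n∸m (∈-upTo⁻ i∈) , ℕ.m∸n≤m n i

  ∈-countdown⁺ : ∀ {n k} → 1 ≤ k → k ≤ n → k ∈ countdown n
  ∈-countdown⁺ {n} {k} p q = subst (_∈ countdown n) (ℕ.m∸[m∸n]≡n q)
    (∈-map⁺ (n ∸_) (∈-upTo⁺ (ℕ.∸-monoʳ-< {n} {k} {0} p q)))

  countdown-AllPairs : ∀ n → AllPairs (λ k j → j < k) (countdown n)
  countdown-AllPairs n = AllPairs.map⁺ (AllPairs.applyUpTo⁺₁ id n (λ i<j j<n → ℕ.∸-monoʳ-< i<j (ℕ.<⇒≤ j<n)))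

  parts-sound : ∀ f n m {l} → l ∈ parts f n m → IsPartition l × size l ≡ n × headOr0 l ≤ m
  parts-sound zero    zero    m (here refl) = [] , refl , z≤n
  parts-sound (suc f) zero    m (here refl) = [] , refl , z≤n
  parts-sound (suc f) (suc n) m p
    with k , l , k∈ , l∈ , refl ← ∈-concatMap-cons⁻ (countdown (suc n ⊓ m)) p
    with 1≤k , k≤ ← ∈-countdown⁻ k∈
    with q , s , h ← parts-sound f (suc n ∸ k) k l∈ =
    cons-partition 1≤k h q
    , ≡.trans (cong (k +_) s) (ℕ.m+[n∸m]≡n (ℕ.≤-trans k≤ (ℕ.m⊓n≤m (suc n) m)))
    , ℕ.≤-trans k≤ (ℕ.m⊓n≤n (suc n) m)

  parts-complete : ∀ f n m {l} → n ≤ f → IsPartition l → size l ≡ n → headOr0 l ≤ m → l ∈ parts f n m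
  parts-complete zero    zero    m {[]}    _ p s h = here refl
  parts-complete (suc f) zero    m {[]}    _ p s h = here refl
  parts-complete zero    zero    m {a ∷ l} _ p s h with refl ← ℕ.m+n≡0⇒m≡0 a s with () ← head-pos p
  parts-complete (suc f) zero    m {a ∷ l} _ p s h with refl ← ℕ.m+n≡0⇒m≡0 a s with () ← head-pos p
  parts-complete (suc f) (suc n) m {a ∷ l} (s≤s n≤f) p s h =
    ∈-concatMap-cons⁺
      (∈-countdown⁺ (head-pos p) (ℕ.⊓-glb (subst (a ≤_) s (ℕ.m≤m+n a (size l))) h))
      (parts-complete f (suc n ∸ a) a
        -- Parts are positive, so one unit of fuel per part is enough.
        (ℕ.≤-trans (ℕ.∸-monoʳ-≤ (suc n) (head-pos p)) n≤f)
        (tail-partition p)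
        (≡.trans (≡.sym (ℕ.m+n∸m≡n a (size l))) (cong (_∸ a) s))
        (tail-head p))

  parts-decreasing : ∀ f n m → AllPairs _≻_ (parts f n m)
  parts-decreasing zero    zero    m = [] ∷ []
  parts-decreasing zero    (suc n) m = []
  parts-decreasing (suc f) zero    m = [] ∷ []
  parts-decreasing (suc f) (suc n) m =
    concatMap-cons-AllPairs here there (countdown-AllPairs (suc n ⊓ m)) (λ k → parts-decreasing f (suc n ∸ k) k)

  ∈-partitionsOf⁻ : ∀ {n l} → l ∈ partitionsOf n → IsPartition l × size l ≡ n
  ∈-partitionsOf⁻ {n} p with q , s , _ ← parts-sound n n n p = q , s

  head≤size : ∀ l → headOr0 l ≤ size l
  head≤size []      = z≤n
  head≤size (a ∷ l) = ℕ.m≤m+n a (size l)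

  ∈-partitionsOf⁺ : ∀ {l} → IsPartition l → l ∈ partitionsOf (size l)
  ∈-partitionsOf⁺ {l} p = parts-complete (size l) (size l) (size l) ℕ.≤-refl p refl (head≤size l)

  partitionsOf-decreasing : ∀ n → AllPairs _≻_ (partitionsOf n)
  partitionsOf-decreasing n = parts-decreasing n n n

  partitionsOf-Unique : ∀ n → Unique (partitionsOf n)
  partitionsOf-Unique n = AllPairs.map ≻⇒≢ (partitionsOf-decreasing n)

  ∈-partitionsUpTo⁻ : ∀ {d l} → l ∈ partitionsUpTo d → IsPartition l × size l ≤ d
  ∈-partitionsUpTo⁻ {d} {l} p with m , q , r ← ∈-concat⁻′ (map partitionsOf (upTo (suc d))) p
    with n , n∈ , refl ← ∈-map⁻ partitionsOf r with s , refl ← ∈-partitionsOf⁻ {n} q = s , ℕ.≤-pred (∈-upTo⁻ n∈)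

  ∈-partitionsUpTo⁺ : ∀ {d l} → IsPartition l → size l ≤ d → l ∈ partitionsUpTo d
  ∈-partitionsUpTo⁺ p s = ∈-concat⁺′ (∈-partitionsOf⁺ p) (∈-map⁺ partitionsOf (∈-upTo⁺ (s≤s s)))

  partitionsUpTo-Unique : ∀ d → Unique (partitionsUpTo d)
  partitionsUpTo-Unique d = Unique.concat⁺
    (All.map⁺ (All.universal partitionsOf-Unique (upTo (suc d))))
    (AllPairs.map⁺ (AllPairs.map disjoint (Unique.upTo⁺ (suc d))))
    where
    disjoint : ∀ {m n} → m ≢ n → ∀ {l} → ¬ (l ∈ partitionsOf m × l ∈ partitionsOf n)
    disjoint m≢n (p , q) = m≢n (≡.trans (≡.sym (proj₂ (∈-partitionsOf⁻ p))) (proj₂ (∈-partitionsOf⁻ q)))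

  ∈-filterᵇ⁻ : ∀ {A : Set} (p : A → Bool) xs {x} → x ∈ filterᵇ p xs → x ∈ xs × T (p x)
  ∈-filterᵇ⁻ p (y ∷ xs) x∈ with p y in eq
  ∈-filterᵇ⁻ p (y ∷ xs) (here refl) | true = here refl , subst T (≡.sym eq) tt
  ∈-filterᵇ⁻ p (y ∷ xs) (there x∈)  | true with q , r ← ∈-filterᵇ⁻ p xs x∈ = there q , r
  ∈-filterᵇ⁻ p (y ∷ xs) x∈          | false with q , r ← ∈-filterᵇ⁻ p xs x∈ = there q , r

  ∈-filterᵇ⁺ : ∀ {A : Set} (p : A → Bool) xs {x} → x ∈ xs → T (p x) → x ∈ filterᵇ p xs
  ∈-filterᵇ⁺ p (y ∷ xs) (here refl) px with p y
  ... | true = here refl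
  ∈-filterᵇ⁺ p (y ∷ xs) (there x∈) px with p y
  ... | true  = there (∈-filterᵇ⁺ p xs x∈ px)
  ... | false = ∈-filterᵇ⁺ p xs x∈ px

  filterᵇ-Unique : ∀ {A : Set} (p : A → Bool) {xs} → Unique xs → Unique (filterᵇ p xs)
  filterᵇ-Unique p [] = []
  filterᵇ-Unique p {x ∷ xs} (x∉ ∷ u) with p x
  ... | true  = All.tabulate (λ y∈ → All.lookup x∉ (proj₁ (∈-filterᵇ⁻ p xs y∈))) ∷ filterᵇ-Unique p u
  ... | false = filterᵇ-Unique p u

  ∈-sub⁻ : ∀ {λ′ μ} → μ ∈ subpartitions λ′ → IsPartition μ × T (contained μ λ′)
  ∈-sub⁻ {λ′} p with q , c ← ∈-filterᵇ⁻ (λ μ → contained μ λ′) (partitionsUpTo (size λ′)) p =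
    proj₁ (∈-partitionsUpTo⁻ {size λ′} q) , c

  ∈-sub⁺ : ∀ {λ′ μ} → IsPartition μ → T (contained μ λ′) → μ ∈ subpartitions λ′
  ∈-sub⁺ {λ′} {μ} p c =
    ∈-filterᵇ⁺ (λ μ → contained μ λ′) (partitionsUpTo (size λ′)) (∈-partitionsUpTo⁺ p (contained⇒size μ λ′ c)) c

  sub-Unique : ∀ λ′ → Unique (subpartitions λ′)
  sub-Unique λ′ = filterᵇ-Unique (λ μ → contained μ λ′) (partitionsUpTo-Unique (size λ′))

  self∈sub : ∀ {λ′} → IsPartition λ′ → λ′ ∈ subpartitions λ′
  self∈sub p = ∈-sub⁺ p (contained-refl p)

  -- Exchanging two successive subshapes

  -- Coefficients of generating functions in x and y; X and Y multiply by x and y.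
  Poly : Set
  Poly = ℕ → ℕ → ℕ

  X Y : Poly → Poly
  X f zero    b = 0
  X f (suc a) b = f a b
  Y f a zero    = 0
  Y f a (suc b) = f a b

  Xif Yif : Bool → Poly → Poly
  Xif x f = if x then X f else f
  Yif x f = if x then Y f else f

  Symmetric : Poly → Set
  Symmetric f = ∀ a b → f a b ≡ f b a

  X-cong : ∀ {f g} → (∀ a b → f a b ≡ g a b) → ∀ a b → X f a b ≡ X g a b
  X-cong p zero    b = refl
  X-cong p (suc a) b = p a b

  Y-cong : ∀ {f g} → (∀ a b → f a b ≡ g a b) → ∀ a b → Y f a b ≡ Y g a b
  Y-cong p a zero    = refl
  Y-cong p a (suc b) = p a b

  X-+ : ∀ f g a b → X (λ a b → f a b + g a b) a b ≡ X f a b + X g a b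
  X-+ f g zero    b = refl
  X-+ f g (suc a) b = refl

  XY-+ : ∀ f g a b → X (Y (λ a b → f a b + g a b)) a b ≡ X (Y f) a b + X (Y g) a b
  XY-+ f g zero    b       = refl
  XY-+ f g (suc a) zero    = refl
  XY-+ f g (suc a) (suc b) = refl

  XYX : ∀ f a b → X (Y (X f)) a b ≡ X (X (Y f)) a b
  XYX f zero          b       = refl
  XYX f (suc zero)    zero    = refl
  XYX f (suc (suc a)) zero    = refl
  XYX f (suc zero)    (suc b) = refl
  XYX f (suc (suc a)) (suc b) = refl

  XY-symmetric : ∀ {f} → Symmetric f → Symmetric (X (Y f))
  XY-symmetric p zero    zero    = refl
  XY-symmetric p zero    (suc b) = refl
  XY-symmetric p (suc a) zero    = refl
  XY-symmetric p (suc a) (suc b) = p a b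

  X+Y-symmetric : ∀ {f} → Symmetric f → Symmetric (λ a b → X f a b + Y f a b)
  X+Y-symmetric p zero    zero    = refl
  X+Y-symmetric p zero    (suc b) = ≡.trans (p 0 b) (≡.sym (ℕ.+-identityʳ _))
  X+Y-symmetric p (suc a) zero    = ≡.trans (ℕ.+-identityʳ _) (p a 0)
  X+Y-symmetric {f} p (suc a) (suc b) =
    ≡.trans (cong₂ _+_ (p a (suc b)) (p (suc a) b)) (ℕ.+-comm (f (suc b) a) (f b (suc a)))

  +-symmetric : ∀ {f g} → Symmetric f → Symmetric g → Symmetric (λ a b → f a b + g a b)
  +-symmetric p q a b = cong₂ _+_ (p a b) (q a b)

  symmetric-resp : ∀ {f g} → (∀ a b → f a b ≡ g a b) → Symmetric g → Symmetric f
  symmetric-resp e p a b = ≡.trans (e a b) (≡.trans (p a b) (≡.sym (e b a)))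

  -- Stands in for subtraction: coefficients are natural numbers, and the exchange identities carry
  -- a symmetric correction term on the left.
  symmetric-cancel : ∀ {f} g {h} → Symmetric g → (∀ a b → f a b + g a b ≡ h a b) → Symmetric h → Symmetric f
  symmetric-cancel {f} g {h} p e q a b = ℕ.+-cancelʳ-≡ (g a b) _ _
    (≡.trans (e a b) (≡.trans (q a b) (≡.trans (≡.sym (e b a)) (cong (f b a +_) (p b a)))))

  -- One column of height range [m , l]; a column filled up to height h contributes x if its
  -- upper part is nonempty (h < l) and y if its lower part is nonempty (m < h).
  module Column (m l : ℕ) (S : ℕ → Poly) where
    term : ℕ → Poly
    term h a b = ind ((m ≤ᵇ h) ∧ (h ≤ᵇ l)) * Xif (h <ᵇ l) (Yif (m <ᵇ h) (S h)) a b

    column : ℕ → Poly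
    column u a b = ∑ (upTo (suc u)) (λ h → term h a b)

    column-suc : ∀ u a b → column (suc u) a b ≡ column u a b + term (suc u) a b
    column-suc u a b = ∑-upTo-suc (suc u) (λ h → term h a b)

    term-below : ∀ {h} → h < m → ∀ a b → term h a b ≡ 0
    term-below {h} p a b = ind-*-zero (λ t → ℕ.<⇒≱ p (ℕ.≤ᵇ⇒≤ m h (proj₁ (∧-elim t))))

    term-above : ∀ {h} → l < h → ∀ a b → term h a b ≡ 0
    term-above {h} p a b = ind-*-zero (λ t → ℕ.<⇒≱ p (ℕ.≤ᵇ⇒≤ h l (proj₂ (∧-elim {m ≤ᵇ h} t))))

    term-in : ∀ {h} → m ≤ h → h ≤ l → ∀ a b → term h a b ≡ Xif (h <ᵇ l) (Yif (m <ᵇ h) (S h)) a b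
    term-in p q a b = ind-*-one (∧-intro (ℕ.≤⇒≤ᵇ p) (ℕ.≤⇒≤ᵇ q))

    column-below : ∀ u → u < m → ∀ a b → column u a b ≡ 0
    column-below u p a b =
      ∑-zero (upTo (suc u)) (λ h h∈ → term-below (ℕ.≤-<-trans (ℕ.≤-pred (∈-upTo⁻ h∈)) p) a b)

    column-stable : ∀ u → l ≤ u → ∀ a b → column u a b ≡ column l a b
    column-stable u l≤u a b with ℕ.m≤n⇒m<n∨m≡n l≤u
    ... | inj₂ refl = refl
    column-stable (suc u) _ a b | inj₁ (s≤s l≤u) = begin
      column (suc u) a b              ≡⟨ column-suc u a b ⟩
      column u a b + term (suc u) a b ≡⟨ cong₂ _+_ (column-stable u l≤u a b) (term-above (s≤s l≤u) a b) ⟩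
      column l a b + 0                ≡⟨ ℕ.+-identityʳ _ ⟩
      column l a b                    ∎
      where open ≡-Reasoning

    column-bottom : ∀ a b → column m a b ≡ term m a b
    column-bottom a b = go m refl
      where
      go : ∀ u → u ≡ m → column u a b ≡ term u a b
      go zero    eq = ℕ.+-identityʳ _
      go (suc u) eq = ≡.trans (column-suc u a b)
        (cong (_+ term (suc u) a b) (column-below u (ℕ.≤-reflexive eq) a b))

  <ᵇ-true : ∀ {m n} → m < n → (m <ᵇ n) ≡ true
  <ᵇ-true {m} {n} p = T-ext (λ _ → tt) (λ _ → ℕ.<⇒<ᵇ p)

  <ᵇ-false : ∀ {m n} → n ≤ m → (m <ᵇ n) ≡ false
  <ᵇ-false {m} {n} p = T-ext (λ t → ℕ.<⇒≱ (ℕ.<ᵇ⇒< m n t) p) λ ()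

  open Column

  term-middle : ∀ {m l S h} → m < h → h < l → ∀ a b → term m l S h a b ≡ X (Y (S h)) a b
  term-middle {m} {l} {S} {h} p q a b = ≡.trans (term-in m l S (ℕ.<⇒≤ p) (ℕ.<⇒≤ q) a b)
    (cong₂ (λ s t → Xif s (Yif t (S h)) a b) (<ᵇ-true q) (<ᵇ-true p))

  term-bottom : ∀ {m l S} → m < l → ∀ a b → term m l S m a b ≡ X (S m) a b
  term-bottom {m} {l} {S} p a b = ≡.trans (term-in m l S ℕ.≤-refl (ℕ.<⇒≤ p) a b)
    (cong₂ (λ s t → Xif s (Yif t (S m)) a b) (<ᵇ-true p) (<ᵇ-false (ℕ.≤-refl {m})))

  term-top : ∀ {m l S} → m < l → ∀ a b → term m l S l a b ≡ Y (S l) a b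
  term-top {m} {l} {S} p a b = ≡.trans (term-in m l S (ℕ.<⇒≤ p) ℕ.≤-refl a b)
    (cong₂ (λ s t → Xif s (Yif t (S l)) a b) (<ᵇ-false (ℕ.≤-refl {l})) (<ᵇ-true p))

  column-point : ∀ l S a b → column l l S l a b ≡ S l a b
  column-point l S a b = ≡.trans (column-bottom l l S a b) (≡.trans (term-in l l S ℕ.≤-refl ℕ.≤-refl a b)
    (cong₂ (λ s t → Xif s (Yif t (S l)) a b) (<ᵇ-false (ℕ.≤-refl {l})) (<ᵇ-false (ℕ.≤-refl {l}))))

  column-above-bottom : ∀ {m l S} → suc m < l → ∀ a b →
    column m l S (suc m) a b ≡ X (S m) a b + X (Y (S (suc m))) a b
  column-above-bottom {m} {l} {S} p a b = ≡.trans (column-suc m l S m a b)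
    (cong₂ _+_ (≡.trans (column-bottom m l S a b) (term-bottom {m} {l} {S} (ℕ.<-trans (ℕ.n<1+n m) p) a b))
               (term-middle {m} {l} {S} (ℕ.n<1+n m) p a b))

  column-two : ∀ m S a b → column m (suc m) S (suc m) a b ≡ X (S m) a b + Y (S (suc m)) a b
  column-two m S a b = ≡.trans (column-suc m (suc m) S m a b)
    (cong₂ _+_ (≡.trans (column-bottom m (suc m) S a b) (term-bottom {m} {suc m} {S} (ℕ.n<1+n m) a b))
               (term-top {m} {suc m} {S} (ℕ.n<1+n m) a b))

  -- The heights from `m` to `u` are those from `m` to `k` and those from `k` to `u`, with `k`
  -- counted twice. Seen from the floor `k`, the height `k` has an empty lower part and weight
  -- `X (S k)`, which is the surplus.
  column-split : ∀ {m k l} S u → m < k → k < l → k ≤ u → ∀ a b →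
    column m l S u a b + X (S k) a b ≡ column k l S u a b + column m l S k a b
  column-split {m} {k} {l} S u m<k k<l k≤u a b with ℕ.m≤n⇒m<n∨m≡n k≤u
  ... | inj₂ refl = ≡.trans (ℕ.+-comm (column m l S k a b) _)
    (cong (_+ column m l S k a b) (≡.sym (≡.trans (column-bottom k l S a b) (term-bottom {k} {l} {S} k<l a b))))
  column-split {m} {k} {l} S (suc u) m<k k<l _ a b | inj₁ (s≤s k≤u) = begin
    column m l S (suc u) a b + x   ≡⟨ cong (_+ x) (column-suc m l S u a b) ⟩
    column m l S u a b + t m + x   ≡⟨ cong (λ z → column m l S u a b + z + x) t≡ ⟩
    column m l S u a b + t k + x   ≡⟨ swapʳ (column m l S u a b) (t k) x ⟩
    column m l S u a b + x + t k   ≡⟨ cong (_+ t k) (column-split S u m<k k<l k≤u a b) ⟩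
    column k l S u a b + column m l S k a b + t k   ≡⟨ swapʳ (column k l S u a b) (column m l S k a b) (t k) ⟩
    column k l S u a b + t k + column m l S k a b   ≡⟨ cong (_+ column m l S k a b) (column-suc k l S u a b) ⟨
    column k l S (suc u) a b + column m l S k a b   ∎
    where
    open ≡-Reasoning
    x = X (S k) a b
    t : ℕ → ℕ
    t m = term m l S (suc u) a b
    swapʳ : ∀ x y z → x + y + z ≡ x + z + y
    swapʳ x y z = ≡.trans (ℕ.+-assoc x y z) (≡.trans (cong (x +_) (ℕ.+-comm y z)) (≡.sym (ℕ.+-assoc x z y)))
    -- Above height `k` the lower part is nonempty for either floor, so the term does not see which
    -- of the two it is.
    t≡ : t m ≡ t k
    t≡ = cong₂ (λ p q → ind (p ∧ (suc u ≤ᵇ l)) * Xif (suc u <ᵇ l) (Yif q (S (suc u))) a b)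
      (T-ext (λ _ → ℕ.≤⇒≤ᵇ (ℕ.m≤n⇒m≤1+n k≤u)) (λ _ → ℕ.≤⇒≤ᵇ (ℕ.≤-trans (ℕ.<⇒≤ m<k) (ℕ.m≤n⇒m≤1+n k≤u))))
      (T-ext (λ _ → ℕ.<⇒<ᵇ (s≤s k≤u)) (λ _ → ℕ.<⇒<ᵇ (ℕ.<-trans m<k (s≤s k≤u))))

  -- The split at `suc m` leaves only the two lowest heights to be written out, so that the floors
  -- `m` and `suc m` can be compared.
  column-step : ∀ {m l} S → suc m < l → ∀ a b →
    column m l S l a b + X (S (suc m)) a b ≡ column (suc m) l S l a b + (X (S m) a b + X (Y (S (suc m))) a b)
  column-step {m} {l} S p a b = ≡.trans (column-split S l (ℕ.n<1+n m) p (ℕ.<⇒≤ p) a b)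
    (cong (column (suc m) l S l a b +_) (column-above-bottom {m} {l} {S} p a b))

  down-induction : ∀ {l} (P : ℕ → Set) → (∀ m → m < l → (suc m < l → P (suc m)) → P m) → ∀ m → m < l → P m
  down-induction {l} P step m m<l = go (l ∸ m) m m<l ℕ.≤-refl
    where
    go : ∀ k m → m < l → l ∸ m ≤ k → P m
    go zero    m p q = ⊥-elim (ℕ.<⇒≱ (ℕ.m<n⇒0<n∸m p) q)
    go (suc k) m p q = step m p (λ p′ → go k (suc m) p′
      (ℕ.≤-pred (ℕ.≤-trans (ℕ.∸-monoʳ-< (ℕ.n<1+n m) p) q)))

  -- If the later columns contribute `Z` at every height, a column with `m < l` multiplies `Z` by
  -- `x + y + (l - m - 1)xy`: the bottom gives `x`, the top `y`, and each height between them `xy`.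
  -- Lowering the floor by one adds one more `xy`.
  column-constant : ∀ {m l S Z} → m ≤ l → Symmetric Z → (∀ h → m ≤ h → ∀ a b → S h a b ≡ Z a b) →
                    Symmetric (column m l S l)
  column-constant {m} {l} {S} {Z} m≤l Zsym eq with ℕ.m≤n⇒m<n∨m≡n m≤l
  ... | inj₂ refl = symmetric-resp (λ a b → ≡.trans (column-point m S a b) (eq m ℕ.≤-refl a b)) Zsym
  ... | inj₁ m<l  = down-induction (λ m → (∀ h → m ≤ h → ∀ a b → S h a b ≡ Z a b) → Symmetric (column m l S l)) step m m<l eq
    where
    step : ∀ m → m < l → (suc m < l → (∀ h → suc m ≤ h → ∀ a b → S h a b ≡ Z a b) → Symmetric (column (suc m) l S l)) →
           (∀ h → m ≤ h → ∀ a b → S h a b ≡ Z a b) → Symmetric (column m l S l)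
    step m m<l ih eq with ℕ.m≤n⇒m<n∨m≡n m<l
    ... | inj₂ refl = symmetric-resp
      (λ a b → ≡.trans (column-two m S a b)
        (cong₂ _+_ (X-cong (eq m ℕ.≤-refl) a b) (Y-cong (eq (suc m) (ℕ.n≤1+n m)) a b)))
      (X+Y-symmetric Zsym)
    ... | inj₁ sm<l = symmetric-resp
      (λ a b → ℕ.+-cancelʳ-≡ (X (S (suc m)) a b) _ _ (begin
        column m l S l a b + X (S (suc m)) a b
          ≡⟨ column-step S sm<l a b ⟩
        column (suc m) l S l a b + (X (S m) a b + X (Y (S (suc m))) a b)
          ≡⟨ cong (column (suc m) l S l a b +_) (cong₂ _+_
               (X-cong (λ a b → ≡.trans (eq m ℕ.≤-refl a b) (≡.sym (eq (suc m) (ℕ.n≤1+n m) a b))) a b)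
               (X-cong (Y-cong (eq (suc m) (ℕ.n≤1+n m))) a b)) ⟩
        column (suc m) l S l a b + (X (S (suc m)) a b + X (Y Z) a b)
          ≡⟨ cong (column (suc m) l S l a b +_) (ℕ.+-comm (X (S (suc m)) a b) _) ⟩
        column (suc m) l S l a b + (X (Y Z) a b + X (S (suc m)) a b)
          ≡⟨ ℕ.+-assoc (column (suc m) l S l a b) _ _ ⟨
        column (suc m) l S l a b + X (Y Z) a b + X (S (suc m)) a b ∎))
      (+-symmetric (ih sm<l (λ h p → eq h (ℕ.<⇒≤ p))) (XY-symmetric Zsym))
      where open ≡-Reasoning

  -- The total weight of the weakly decreasing sequences h₁ ≥ h₂ ≥ … with mⱼ ≤ hⱼ ≤ lⱼ and h₁ ≤ u.
  columns : List (ℕ × ℕ) → ℕ → Poly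
  columns []             u a b = ind ((a ≡ᵇ 0) ∧ (b ≡ᵇ 0))
  columns ((m , l) ∷ cs) u     = column m l (columns cs) u

  -- The pairs are the column heights of two nested shapes, so floors and ceilings both decrease
  -- weakly.
  data Chain : List (ℕ × ℕ) → Set where
    []   : Chain []
    [_]  : ∀ {m l} → m ≤ l → Chain ((m , l) ∷ [])
    cons : ∀ {m l m′ l′ cs} → m ≤ l → m′ ≤ m → l′ ≤ l → Chain ((m′ , l′) ∷ cs) → Chain ((m , l) ∷ (m′ , l′) ∷ cs)

  -- Raising the leading floor preserves the chain; this makes the symmetry of a shorter chain
  -- available at every floor `k` in its range.
  widen : ∀ {m l cs} → ∀ k → m ≤ k → k ≤ l → Chain ((m , l) ∷ cs) → Chain ((k , l) ∷ cs)
  widen k p q [ _ ]          = [ q ]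
  widen k p q (cons _ r s c) = cons q (ℕ.≤-trans r p) s c

  -- Splitting the second column at `suc m` gives `S₁ (suc m) + V (suc m) = V m₁ + x S (suc
  -- m)`. Multiplied by `xy`, the last term is `x` times the weight of the one extra height that the
  -- cap `suc m` admits over the cap `m`, so it turns `x S₁ m` into `x S₁ (suc m)`. If `suc m = l₁`,
  -- that extra height is the top of the column and weighs `y` in place of `xy`.
  exchange-step : ∀ m₁ {m l₁} S → m₁ ≤ m → m < l₁ → ∀ a b →
    let S₁ = column m₁ l₁ S; V = λ k → column k l₁ S l₁ in
    X (S₁ m) a b + (X (Y (S₁ (suc m))) a b + X (Y (V (suc m))) a b) ≡ X (Y (V m₁)) a b + X (S₁ (suc m)) a b
  exchange-step m₁ {m} {l₁} S p q a b with ℕ.m≤n⇒m<n∨m≡n q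
  ... | inj₁ sm<l₁ = begin
    X (S₁ m) a b + (X (Y (S₁ (suc m))) a b + X (Y (V (suc m))) a b)
      ≡⟨ cong (X (S₁ m) a b +_) (XY-+ (S₁ (suc m)) (V (suc m)) a b) ⟨
    X (S₁ m) a b + X (Y (λ a b → S₁ (suc m) a b + V (suc m) a b)) a b
      ≡⟨ cong (X (S₁ m) a b +_) (X-cong (Y-cong (λ a b → ≡.trans (ℕ.+-comm (S₁ (suc m) a b) _)
           (≡.sym (column-split S l₁ (s≤s p) sm<l₁ (ℕ.<⇒≤ sm<l₁) a b)))) a b) ⟩
    X (S₁ m) a b + X (Y (λ a b → V m₁ a b + X (S (suc m)) a b)) a b
      ≡⟨ cong (X (S₁ m) a b +_) (XY-+ (V m₁) (X (S (suc m))) a b) ⟩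
    X (S₁ m) a b + (X (Y (V m₁)) a b + X (Y (X (S (suc m)))) a b)
      ≡⟨ cong (λ z → X (S₁ m) a b + (X (Y (V m₁)) a b + z)) (XYX (S (suc m)) a b) ⟩
    X (S₁ m) a b + (X (Y (V m₁)) a b + X (X (Y (S (suc m)))) a b)
      ≡⟨ solve 3 (λ x y z → x :+ (y :+ z) := y :+ (x :+ z)) refl (X (S₁ m) a b) (X (Y (V m₁)) a b) (X (X (Y (S (suc m)))) a b) ⟩
    X (Y (V m₁)) a b + (X (S₁ m) a b + X (X (Y (S (suc m)))) a b)
      ≡⟨ cong (X (Y (V m₁)) a b +_) (X-+ (S₁ m) (X (Y (S (suc m)))) a b) ⟨
    X (Y (V m₁)) a b + X (λ a b → S₁ m a b + X (Y (S (suc m))) a b) a b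
      ≡⟨ cong (X (Y (V m₁)) a b +_) (X-cong (λ a b → ≡.trans (column-suc m₁ l₁ S m a b)
           (cong (S₁ m a b +_) (term-middle {m₁} {l₁} {S} (s≤s p) sm<l₁ a b))) a b) ⟨
    X (Y (V m₁)) a b + X (S₁ (suc m)) a b ∎
    where
    open ≡-Reasoning
    open +-*-Solver
    S₁ V : ℕ → Poly
    S₁  = column m₁ l₁ S
    V k = column k l₁ S l₁
  ... | inj₂ refl = begin
    X (S₁ m) a b + (X (Y (V m₁)) a b + X (Y (V (suc m))) a b)
      ≡⟨ cong (λ z → X (S₁ m) a b + (X (Y (V m₁)) a b + z)) (X-cong (Y-cong (column-point (suc m) S)) a b) ⟩
    X (S₁ m) a b + (X (Y (V m₁)) a b + X (Y (S (suc m))) a b)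
      ≡⟨ solve 3 (λ x y z → x :+ (y :+ z) := y :+ (x :+ z)) refl (X (S₁ m) a b) (X (Y (V m₁)) a b) (X (Y (S (suc m))) a b) ⟩
    X (Y (V m₁)) a b + (X (S₁ m) a b + X (Y (S (suc m))) a b)
      ≡⟨ cong (X (Y (V m₁)) a b +_) (X-+ (S₁ m) (Y (S (suc m))) a b) ⟨
    X (Y (V m₁)) a b + X (λ a b → S₁ m a b + Y (S (suc m)) a b) a b
      ≡⟨ cong (X (Y (V m₁)) a b +_) (X-cong (λ a b → ≡.trans (column-suc m₁ (suc m) S m a b)
           (cong (S₁ m a b +_) (term-top {m₁} {suc m} {S} (s≤s p) a b))) a b) ⟨
    X (Y (V m₁)) a b + X (S₁ (suc m)) a b ∎
    where
    open ≡-Reasoning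
    open +-*-Solver
    S₁ V : ℕ → Poly
    S₁  = column m₁ (suc m) S
    V k = column k (suc m) S (suc m)

  -- Lowering the first floor from `suc m` to `m` adds `xy (V m₁ - V (suc m))`. Both `V` are weights
  -- with one column less, hence symmetric by the induction on the number of columns.
  exchange : ∀ m₁ {m l₁ l} S → m₁ ≤ m → m < l₁ → suc m < l → ∀ a b →
    let S₁ = column m₁ l₁ S; V = λ k → column k l₁ S l₁ in
    column m l S₁ l a b + X (Y (V (suc m))) a b ≡ column (suc m) l S₁ l a b + X (Y (V m₁)) a b
  exchange m₁ {m} {l₁} {l} S p q r a b = ℕ.+-cancelʳ-≡ (X (S₁ (suc m)) a b) _ _ (begin
    z + X (Y (V (suc m))) a b + X (S₁ (suc m)) a b
      ≡⟨ solve 3 (λ x y z → x :+ y :+ z := x :+ z :+ y) refl z (X (Y (V (suc m))) a b) (X (S₁ (suc m)) a b) ⟩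
    z + X (S₁ (suc m)) a b + X (Y (V (suc m))) a b
      ≡⟨ cong (_+ X (Y (V (suc m))) a b) (column-step S₁ r a b) ⟩
    z′ + (X (S₁ m) a b + X (Y (S₁ (suc m))) a b) + X (Y (V (suc m))) a b
      ≡⟨ solve 4 (λ w x y z → w :+ (x :+ y) :+ z := w :+ (x :+ (y :+ z))) refl z′ (X (S₁ m) a b) (X (Y (S₁ (suc m))) a b) (X (Y (V (suc m))) a b) ⟩
    z′ + (X (S₁ m) a b + (X (Y (S₁ (suc m))) a b + X (Y (V (suc m))) a b))
      ≡⟨ cong (z′ +_) (exchange-step m₁ S p q a b) ⟩
    z′ + (X (Y (V m₁)) a b + X (S₁ (suc m)) a b)
      ≡⟨ ℕ.+-assoc z′ _ _ ⟨
    z′ + X (Y (V m₁)) a b + X (S₁ (suc m)) a b ∎)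
    where
    open ≡-Reasoning
    open +-*-Solver
    S₁ V : ℕ → Poly
    S₁  = column m₁ l₁ S
    V k = column k l₁ S l₁
    z z′ : ℕ
    z  = column m l S₁ l a b
    z′ = column (suc m) l S₁ l a b

  -- The bottom of the downward induction, where the first two columns share the ceiling `suc m`.
  -- The cap `m` only withholds from the second column its top height, worth `y S (suc m)`.
  exchange-last : ∀ m₁ {m} S → m₁ ≤ m → ∀ a b →
    let S₁ = column m₁ (suc m) S in
    column m (suc m) S₁ (suc m) a b + X (Y (S (suc m))) a b ≡ X (S₁ (suc m)) a b + Y (S₁ (suc m)) a b
  exchange-last m₁ {m} S p a b = begin
    column m (suc m) S₁ (suc m) a b + X (Y (S (suc m))) a b
      ≡⟨ cong (_+ X (Y (S (suc m))) a b) (column-two m S₁ a b) ⟩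
    X (S₁ m) a b + Y (S₁ (suc m)) a b + X (Y (S (suc m))) a b
      ≡⟨ solve 3 (λ x y z → x :+ y :+ z := x :+ z :+ y) refl (X (S₁ m) a b) (Y (S₁ (suc m)) a b) (X (Y (S (suc m))) a b) ⟩
    X (S₁ m) a b + X (Y (S (suc m))) a b + Y (S₁ (suc m)) a b
      ≡⟨ cong (_+ Y (S₁ (suc m)) a b) (X-+ (S₁ m) (Y (S (suc m))) a b) ⟨
    X (λ a b → S₁ m a b + Y (S (suc m)) a b) a b + Y (S₁ (suc m)) a b
      ≡⟨ cong (_+ Y (S₁ (suc m)) a b) (X-cong (λ a b → ≡.trans (column-suc m₁ (suc m) S m a b)
           (cong (S₁ m a b +_) (term-top {m₁} {suc m} {S} (s≤s p) a b))) a b) ⟨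
    X (S₁ (suc m)) a b + Y (S₁ (suc m)) a b ∎
    where
    open ≡-Reasoning
    open +-*-Solver
    S₁ : ℕ → Poly
    S₁ = column m₁ (suc m) S

  -- Two leading columns (m, l), (m₁, l₁): the exchange identities compare the weights for m and m + 1,
  -- so symmetry follows by downward induction on m.
  columns-symmetric : ∀ {m l cs} → Chain ((m , l) ∷ cs) → Symmetric (columns ((m , l) ∷ cs) l)
  columns-symmetric [ m≤l ] = column-constant m≤l one-symmetric (λ _ _ _ _ → refl)
    where
    one-symmetric : Symmetric (λ a b → ind ((a ≡ᵇ 0) ∧ (b ≡ᵇ 0)))
    one-symmetric zero    zero    = refl
    one-symmetric zero    (suc b) = refl
    one-symmetric (suc a) zero    = refl
    one-symmetric (suc a) (suc b) = refl
  columns-symmetric {m} {l} (cons {m′ = m₁} {l₁} {cs} m≤l m₁≤m l₁≤l ch) with ℕ.m≤n⇒m<n∨m≡n m≤l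
  -- The only height of the first column is `l ≥ l₁`, which does not restrict the second one.
  ... | inj₂ refl = column-constant {S = columns ((m₁ , l₁) ∷ cs)} m≤l (columns-symmetric ch)
    (λ h m≤h → column-stable m₁ l₁ (columns cs) h (ℕ.≤-trans l₁≤l m≤h))
  ... | inj₁ m<l  = down-induction (λ m → m₁ ≤ m → Symmetric (column m l S₁ l)) step m m<l m₁≤m
    where
    S S₁ V : ℕ → Poly
    S   = columns cs
    S₁  = column m₁ l₁ S
    V k = column k l₁ S l₁
    V-symmetric : ∀ k → m₁ ≤ k → k ≤ l₁ → Symmetric (V k)
    -- The floor changes but a column is dropped, so the recursion descends on the list of columns.
    V-symmetric k p q = columns-symmetric (widen k p q ch)
    step : ∀ m → m < l → (suc m < l → m₁ ≤ suc m → Symmetric (column (suc m) l S₁ l)) →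
           m₁ ≤ m → Symmetric (column m l S₁ l)
    step m m<l ih p with m <? l₁
    -- Every height of the first column is at least `m ≥ l₁`, so again the second column is not
    -- restricted.
    ... | no m≮l₁ = column-constant {S = S₁} (ℕ.<⇒≤ m<l) (columns-symmetric ch)
      (λ h m≤h → column-stable m₁ l₁ S h (ℕ.≤-trans (ℕ.≮⇒≥ m≮l₁) m≤h))
    ... | yes m<l₁ with ℕ.m≤n⇒m<n∨m≡n m<l
    ...   | inj₁ sm<l = symmetric-cancel (X (Y (V (suc m))))
      (XY-symmetric (V-symmetric (suc m) (ℕ.m≤n⇒m≤1+n p) m<l₁))
      (exchange m₁ S p m<l₁ sm<l)
      (+-symmetric (ih sm<l (ℕ.m≤n⇒m≤1+n p)) (XY-symmetric (columns-symmetric ch)))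
    -- Here `m < l₁ ≤ l = suc m` forces `l₁ = l`. A column with floor and ceiling `l₁` has one
    -- height only, so `V l₁` is `S l₁` and the correction term is symmetric.
    ...   | inj₂ refl with refl ← ℕ.≤-antisym l₁≤l m<l₁ = symmetric-cancel (X (Y (S l₁)))
      (XY-symmetric (symmetric-resp (λ a b → ≡.sym (column-point l₁ S a b)) (V-symmetric l₁ (ℕ.m≤n⇒m≤1+n p) ℕ.≤-refl)))
      (exchange-last m₁ S p)
      (X+Y-symmetric (columns-symmetric ch))

  -- Shapes between two given shapes as sequences of column heights.

  ∑-upTo-shift : ∀ n (f : ℕ → ℕ) → ∑ (upTo (suc n)) f ≡ f 0 + ∑ (upTo n) (f ∘ suc)
  ∑-upTo-shift n f = cong (f 0 +_) (≡.trans (cong (λ xs → ∑ xs f) (≡.sym (List.map-upTo suc n))) (∑-map suc (upTo n) f))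

  ∑-applyUpTo : ∀ (h : ℕ → ℕ) n (f : ℕ → ℕ) → ∑ (applyUpTo h n) f ≡ ∑ (upTo n) (f ∘ h)
  ∑-applyUpTo h n f = ≡.trans (cong (λ xs → ∑ xs f) (≡.sym (List.map-upTo h n))) (∑-map h (upTo n) f)

  ∑-upTo-extend : ∀ {k n} (f : ℕ → ℕ) → k ≤ n → (∀ j → k ≤ j → f j ≡ 0) → ∑ (upTo n) f ≡ ∑ (upTo k) f
  ∑-upTo-extend {k} {n} f k≤n z with ℕ.m≤n⇒m<n∨m≡n k≤n
  ... | inj₂ refl = refl
  ∑-upTo-extend {k} {suc n} f _ z | inj₁ (s≤s k≤n) = ≡.trans (∑-upTo-suc n f)
    (≡.trans (cong₂ _+_ (∑-upTo-extend f k≤n z) (z n k≤n)) (ℕ.+-identityʳ _))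

  open Column

  inRange : ℕ × ℕ → ℕ → Bool
  inRange (m , l) h = (m ≤ᵇ h) ∧ (h ≤ᵇ l)

  heights : List (ℕ × ℕ) → ℕ → List (List ℕ)
  heights []             u = [] ∷ []
  heights ((m , l) ∷ cs) u =
    concatMap (λ h → map (h ∷_) (heights cs h)) (filterᵇ (inRange (m , l)) (upTo (suc u)))

  upper lower : List (ℕ × ℕ) → List ℕ → ℕ
  upper ((m , l) ∷ cs) (h ∷ hs) = ind (h <ᵇ l) + upper cs hs
  upper _              _        = 0
  lower ((m , l) ∷ cs) (h ∷ hs) = ind (m <ᵇ h) + lower cs hs
  lower _              _        = 0

  data Heights : List (ℕ × ℕ) → ℕ → List ℕ → Set where
    []   : ∀ {u} → Heights [] u []
    cons : ∀ {m l cs u h hs} → m ≤ h → h ≤ l → h ≤ u → Heights cs h hs → Heights ((m , l) ∷ cs) u (h ∷ hs)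

  ∈-heights⁻ : ∀ cs {u hs} → hs ∈ heights cs u → Heights cs u hs
  ∈-heights⁻ []             (here refl) = []
  ∈-heights⁻ ((m , l) ∷ cs) {u} p
    with h , hs , h∈ , hs∈ , refl ← ∈-concatMap-cons⁻ (filterᵇ (inRange (m , l)) (upTo (suc u))) p
    with h∈′ , g ← ∈-filterᵇ⁻ (inRange (m , l)) (upTo (suc u)) h∈ =
    cons (ℕ.≤ᵇ⇒≤ m h (proj₁ (∧-elim g))) (ℕ.≤ᵇ⇒≤ h l (proj₂ (∧-elim {m ≤ᵇ h} g)))
         (ℕ.≤-pred (∈-upTo⁻ h∈′)) (∈-heights⁻ cs hs∈)

  ∈-heights⁺ : ∀ {cs u hs} → Heights cs u hs → hs ∈ heights cs u
  ∈-heights⁺ []             = here refl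
  ∈-heights⁺ (cons {m} {l} {cs} {u} p q r c) = ∈-concatMap-cons⁺ {heights cs}
    (∈-filterᵇ⁺ (inRange (m , l)) (upTo (suc u)) (∈-upTo⁺ (s≤s r)) (∧-intro (ℕ.≤⇒≤ᵇ p) (ℕ.≤⇒≤ᵇ q))) (∈-heights⁺ c)

  heights-Unique : ∀ cs u → Unique (heights cs u)
  heights-Unique []             u = [] ∷ []
  heights-Unique ((m , l) ∷ cs) u =
    concatMap-cons-Unique {f = heights cs} (filterᵇ-Unique (inRange (m , l)) (Unique.upTo⁺ (suc u))) (heights-Unique cs)

  monomial : ℕ → ℕ → Poly
  monomial m n a b = ind (m ≡ᵇ a) * ind (n ≡ᵇ b)

  Xif-∑ : ∀ x (xs : List (List ℕ)) (f g : List ℕ → ℕ) a b →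
    Xif x (λ a b → ∑ xs (λ h → monomial (f h) (g h) a b)) a b ≡ ∑ xs (λ h → monomial (ind x + f h) (g h) a b)
  Xif-∑ false xs f g a       b = refl
  Xif-∑ true  xs f g zero    b = ≡.sym (∑-zero xs (λ _ _ → refl))
  Xif-∑ true  xs f g (suc a) b = refl

  Yif-∑ : ∀ x (xs : List (List ℕ)) (f g : List ℕ → ℕ) a b →
    Yif x (λ a b → ∑ xs (λ h → monomial (f h) (g h) a b)) a b ≡ ∑ xs (λ h → monomial (f h) (ind x + g h) a b)
  Yif-∑ false xs f g a b       = refl
  Yif-∑ true  xs f g a zero    = ≡.sym (∑-zero xs (λ h _ → ℕ.*-zeroʳ (ind (f h ≡ᵇ a))))
  Yif-∑ true  xs f g a (suc b) = refl

  Xif-cong : ∀ x {f g} → (∀ a b → f a b ≡ g a b) → ∀ a b → Xif x f a b ≡ Xif x g a b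
  Xif-cong true  = X-cong
  Xif-cong false p = p

  Yif-cong : ∀ x {f g} → (∀ a b → f a b ≡ g a b) → ∀ a b → Yif x f a b ≡ Yif x g a b
  Yif-cong true  = Y-cong
  Yif-cong false p = p

  -- Unfolds the recursion over columns into one monomial per sequence of heights, the form that can
  -- be matched with a sum over shapes.
  columns-∑ : ∀ cs u a b → columns cs u a b ≡ ∑ (heights cs u) (λ hs → monomial (upper cs hs) (lower cs hs) a b)
  columns-∑ []             u zero    zero    = refl
  columns-∑ []             u zero    (suc b) = refl
  columns-∑ []             u (suc a) b       = refl
  columns-∑ ((m , l) ∷ cs) u a b = begin
    ∑ (upTo (suc u)) (λ h → ind (range h) * Xif (h <ᵇ l) (Yif (m <ᵇ h) (columns cs h)) a b)
      ≡⟨ ∑-filterᵇ range (upTo (suc u)) (λ h → Xif (h <ᵇ l) (Yif (m <ᵇ h) (columns cs h)) a b) ⟨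
    ∑ hs₀ (λ h → Xif (h <ᵇ l) (Yif (m <ᵇ h) (columns cs h)) a b)
      ≡⟨ ∑-cong hs₀ (λ h _ → inner h) ⟩
    ∑ hs₀ (λ h → ∑ (map (h ∷_) (heights cs h)) F)
      ≡⟨ ∑-concatMap (λ h → map (h ∷_) (heights cs h)) hs₀ F ⟨
    ∑ (heights ((m , l) ∷ cs) u) F ∎
    where
    open ≡-Reasoning
    range : ℕ → Bool
    range = inRange (m , l)
    hs₀ = filterᵇ range (upTo (suc u))
    F : List ℕ → ℕ
    F hs = monomial (upper ((m , l) ∷ cs) hs) (lower ((m , l) ∷ cs) hs) a b
    inner : ∀ h → Xif (h <ᵇ l) (Yif (m <ᵇ h) (columns cs h)) a b ≡ ∑ (map (h ∷_) (heights cs h)) F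
    inner h = begin
      Xif (h <ᵇ l) (Yif (m <ᵇ h) (columns cs h)) a b
        ≡⟨ Xif-cong (h <ᵇ l) (λ a b → ≡.trans (Yif-cong (m <ᵇ h) (columns-∑ cs h) a b)
             (Yif-∑ (m <ᵇ h) (heights cs h) (upper cs) (lower cs) a b)) a b ⟩
      Xif (h <ᵇ l) (λ a b → ∑ (heights cs h) (λ hs → monomial (upper cs hs) (ind (m <ᵇ h) + lower cs hs) a b)) a b
        ≡⟨ Xif-∑ (h <ᵇ l) (heights cs h) (upper cs) (λ hs → ind (m <ᵇ h) + lower cs hs) a b ⟩
      ∑ (heights cs h) (F ∘ (h ∷_))
        ≡⟨ ∑-map (h ∷_) (heights cs h) F ⟨
      ∑ (map (h ∷_) (heights cs h)) F ∎

  heights-applyUpTo⁺ : ∀ {m l f : ℕ → ℕ} n {u} → (∀ j → m j ≤ f j) → (∀ j → f j ≤ l j) → (∀ j → f (suc j) ≤ f j) → f 0 ≤ u →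
    Heights (applyUpTo (λ j → m j , l j) n) u (applyUpTo f n)
  heights-applyUpTo⁺ zero    p q r s = []
  heights-applyUpTo⁺ (suc n) p q r s = cons (p 0) (q 0) s (heights-applyUpTo⁺ n (p ∘ suc) (q ∘ suc) (r ∘ suc) (r 0))

  heights-applyUpTo⁻ : ∀ {m l : ℕ → ℕ} n {u hs} → Heights (applyUpTo (λ j → m j , l j) n) u hs →
    length hs ≡ n × (∀ j → j < n → m j ≤ row hs j × row hs j ≤ l j)
  heights-applyUpTo⁻ zero    [] = refl , λ _ ()
  heights-applyUpTo⁻ {m} {l} (suc n) (cons {hs = hs} p q _ c) with e , b ← heights-applyUpTo⁻ n c = cong suc e , bounds
    where
    bounds : ∀ j → j < suc n → m j ≤ row (_ ∷ hs) j × row (_ ∷ hs) j ≤ l j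
    bounds zero    _       = p , q
    bounds (suc j) (s≤s r) = b j r

  heights-head : ∀ {cs u hs} → Heights cs u hs → headOr0 hs ≤ u
  heights-head []             = z≤n
  heights-head (cons _ _ p _) = p

  heights-decreasing : ∀ {cs u hs} → Heights cs u hs → Decreasing hs
  heights-decreasing []             = []
  heights-decreasing (cons _ _ _ c) = cons (heights-head c) (heights-decreasing c)

  upper-applyUpTo : ∀ (m l f : ℕ → ℕ) n →
    upper (applyUpTo (λ j → m j , l j) n) (applyUpTo f n) ≡ ∑ (upTo n) (λ j → ind (f j <ᵇ l j))
  upper-applyUpTo m l f zero    = refl
  upper-applyUpTo m l f (suc n) = ≡.trans (cong (ind (f 0 <ᵇ l 0) +_) (upper-applyUpTo (m ∘ suc) (l ∘ suc) (f ∘ suc) n))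
    (≡.sym (∑-upTo-shift n (λ j → ind (f j <ᵇ l j))))

  lower-applyUpTo : ∀ (m l f : ℕ → ℕ) n →
    lower (applyUpTo (λ j → m j , l j) n) (applyUpTo f n) ≡ ∑ (upTo n) (λ j → ind (m j <ᵇ f j))
  lower-applyUpTo m l f zero    = refl
  lower-applyUpTo m l f (suc n) = ≡.trans (cong (ind (m 0 <ᵇ f 0) +_) (lower-applyUpTo (m ∘ suc) (l ∘ suc) (f ∘ suc) n))
    (≡.sym (∑-upTo-shift n (λ j → ind (m j <ᵇ f j))))

  chain-applyUpTo : ∀ {m l : ℕ → ℕ} n → (∀ j → m j ≤ l j) → (∀ j → m (suc j) ≤ m j) → (∀ j → l (suc j) ≤ l j) →
                    Chain (applyUpTo (λ j → m j , l j) n)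
  chain-applyUpTo zero          p q r = []
  chain-applyUpTo (suc zero)    p q r = [ p 0 ]
  chain-applyUpTo (suc (suc n)) p q r = cons (p 0) (q 0) (r 0) (chain-applyUpTo (suc n) (p ∘ suc) (q ∘ suc) (r ∘ suc))

  row-applyUpTo : ∀ (f : ℕ → ℕ) n {j} → j < n → row (applyUpTo f n) j ≡ f j
  row-applyUpTo f (suc n) {zero}  _       = refl
  row-applyUpTo f (suc n) {suc j} (s≤s p) = row-applyUpTo (f ∘ suc) n p

  list-ext : ∀ {xs ys} → length xs ≡ length ys → (∀ j → j < length xs → row xs j ≡ row ys j) → xs ≡ ys
  list-ext {[]}     {[]}     e p = refl
  list-ext {x ∷ xs} {y ∷ ys} e p = cong₂ _∷_ (p 0 (s≤s z≤n)) (list-ext (ℕ.suc-injective e) (λ j j< → p (suc j) (s≤s j<)))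

  conjugate : ℕ → List ℕ → List ℕ
  conjugate u hs = fromRows u (col hs)

  conjugate-partition : ∀ u hs → IsPartition (conjugate u hs)
  conjugate-partition u hs = fromRows-partition u (col-suc hs)

  row-conjugate : ∀ {u hs} → Decreasing hs → headOr0 hs ≤ u → ∀ r → row (conjugate u hs) r ≡ col hs r
  row-conjugate {u} {hs} d h = row-fromRows u (col-suc hs) (col-zero d h)

  ≡-ext : ∀ {m n} → (∀ i → i < m → i < n) → (∀ i → i < n → i < m) → m ≡ n
  ≡-ext f g = ℕ.≤-antisym (≤-ext f) (≤-ext g)

  col-conjugate : ∀ {u hs} → Decreasing hs → headOr0 hs ≤ u → ∀ j → col (conjugate u hs) j ≡ row hs j
  col-conjugate {u} {hs} d h j = ≡-ext
    (λ r r< → <col⇒<row d (subst (j <_) (row-conjugate d h r) (<col⇒<row p r<)))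
    (λ r r< → <row⇒<col p (subst (j <_) (≡.sym (row-conjugate d h r)) (<row⇒<col d r<)))
    where p = decreasing (conjugate-partition u hs)

  -- The generating function of the shapes `ν` with `μ ⊂ ν ⊂ λ′`, where `x` marks the columns of the
  -- outer layer `λ′/ν` and `y` those of the inner layer `ν/μ`.
  between : List ℕ → List ℕ → Poly
  between λ′ μ a b = ∑ (subpartitions λ′) (λ ν → ind (contained μ ν) * monomial (skewCols λ′ ν) (skewCols ν μ) a b)

  module _ {λ′ μ} (λ-part : IsPartition λ′) (μ-part : IsPartition μ) (μ⊆λ : T (contained μ λ′)) where
    private
      n u : ℕ
      n = headOr0 λ′
      u = length λ′
      cs : List (ℕ × ℕ)
      cs = applyUpTo (λ j → col μ j , col λ′ j) n

    -- A shape `ν` corresponds to its column heights over the columns of `λ′`; `conjugate` recovers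
    -- the rows.
    between-columns : ∀ a b → between λ′ μ a b ≡ columns cs u a b
    between-columns a b = ≡.trans
      (∑-bij (contained μ) (λ _ → true) (λ ν → applyUpTo (col ν) n) (conjugate u)
        (sub-Unique λ′) (heights-Unique cs u) (λ _ → ind-*-zero) (λ _ t → ⊥-elim (t tt)) to from)
      (≡.sym (columns-∑ cs u a b))
      where
      to : ∀ ν → ν ∈ subpartitions λ′ → T (contained μ ν) →
           applyUpTo (col ν) n ∈ heights cs u × T true × conjugate u (applyUpTo (col ν) n) ≡ ν ×
           ind (contained μ ν) * monomial (skewCols λ′ ν) (skewCols ν μ) a b
             ≡ monomial (upper cs (applyUpTo (col ν) n)) (lower cs (applyUpTo (col ν) n)) a b
      to ν ν∈ μ⊆ν with ν-part , ν⊆λ ← ∈-sub⁻ {λ′} ν∈ = ∈-heights⁺ hts , tt , back , ≡.trans (ind-*-one μ⊆ν)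
        (cong₂ (λ p q → monomial p q a b)
          (≡.sym (upper-applyUpTo (col μ) (col λ′) (col ν) n))
          (≡.sym (≡.trans (lower-applyUpTo (col μ) (col λ′) (col ν) n)
            -- `skewCols ν μ` stops at the width of `ν`, `lower` at that of `λ′`; in the columns
            -- between, `ν` is empty.
            (∑-upTo-extend _ (contained⇒head ν λ′ ν⊆λ) (λ j j≥ →
              ≡.trans (cong (λ z → ind (col μ j <ᵇ z)) (col-zero (decreasing ν-part) j≥)) (ind-<-zero {col μ j} z≤n))))))
        where
        hts : Heights cs u (applyUpTo (col ν) n)
        hts = heights-applyUpTo⁺ n (contained⇒col μ-part ν-part μ⊆ν) (contained⇒col ν-part λ-part ν⊆λ) (col-suc ν)
                (ℕ.≤-trans (contained⇒col ν-part λ-part ν⊆λ 0) (col≤length λ′ 0))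
        back : conjugate u (applyUpTo (col ν) n) ≡ ν
        back = row-ext (conjugate-partition u (applyUpTo (col ν) n)) ν-part (λ r → begin
          row (conjugate u (applyUpTo (col ν) n)) r ≡⟨ row-conjugate {u} (heights-decreasing hts) (heights-head hts) r ⟩
          col (applyUpTo (col ν) n) r               ≡⟨ ∑-applyUpTo (col ν) n _ ⟩
          ∑ (upTo n) (λ j → ind (r <ᵇ col ν j))     ≡⟨ ∑-cong (upTo n) (λ j _ → ind-cong
              (λ t → ℕ.<⇒<ᵇ (<col⇒<row (decreasing ν-part) (ℕ.<ᵇ⇒< r (col ν j) t)))
              (λ t → ℕ.<⇒<ᵇ (<row⇒<col (decreasing ν-part) (ℕ.<ᵇ⇒< j (row ν r) t)))) ⟩
          ∑ (upTo n) (λ j → ind (j <ᵇ row ν r))     ≡⟨ ∑-ind-< n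
              (ℕ.≤-trans (row≤head (decreasing ν-part) r) (contained⇒head ν λ′ ν⊆λ)) ⟩
          row ν r ∎)
          where open ≡-Reasoning

      from : ∀ hs → hs ∈ heights cs u → T true →
             conjugate u hs ∈ subpartitions λ′ × T (contained μ (conjugate u hs)) × applyUpTo (col (conjugate u hs)) n ≡ hs
      from hs hs∈ _ with hts ← ∈-heights⁻ cs hs∈ with len , bounds ← heights-applyUpTo⁻ n hts =
        ∈-sub⁺ ν-part (col⇒contained ν-part λ-part (λ j → subst (_≤ col λ′ j) (≡.sym (eq j)) (below j)))
        , col⇒contained μ-part ν-part (λ j → subst (col μ j ≤_) (≡.sym (eq j)) (above j))
        , list-ext (≡.trans (List.length-applyUpTo _ n) (≡.sym len))
            (λ j j< → ≡.trans (row-applyUpTo _ n (subst (j <_) (List.length-applyUpTo _ n) j<)) (eq j))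
        where
        ν-part = conjugate-partition u hs
        eq : ∀ j → col (conjugate u hs) j ≡ row hs j
        eq = col-conjugate (heights-decreasing hts) (heights-head hts)
        below : ∀ j → row hs j ≤ col λ′ j
        below j with j <? n
        ... | yes j<n = proj₂ (bounds j j<n)
        ... | no j≮n  = ℕ.≤-trans (ℕ.≤-reflexive (row-length hs (ℕ.≤-trans (ℕ.≤-reflexive len) (ℕ.≮⇒≥ j≮n)))) z≤n
        above : ∀ j → col μ j ≤ row hs j
        above j with j <? n
        ... | yes j<n = proj₁ (bounds j j<n)
        ... | no j≮n  = ℕ.≤-trans (ℕ.≤-reflexive (col-zero (decreasing μ-part)
          (ℕ.≤-trans (contained⇒head μ λ′ μ⊆λ) (ℕ.≮⇒≥ j≮n)))) z≤n

    columns-cs-symmetric : Symmetric (columns cs u)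
    columns-cs-symmetric = go n (chain-applyUpTo n (contained⇒col μ-part λ-part μ⊆λ) (col-suc μ) (col-suc λ′))
      where
      go : ∀ n → Chain (applyUpTo (λ j → col μ j , col λ′ j) n) → Symmetric (columns (applyUpTo (λ j → col μ j , col λ′ j) n) u)
      go zero    _  zero    zero    = refl
      go zero    _  zero    (suc b) = refl
      go zero    _  (suc a) zero    = refl
      go zero    _  (suc a) (suc b) = refl
      -- The cap is the number of rows here and the first ceiling in `columns-symmetric`; caps from
      -- the ceiling upwards all give the same sum.
      go (suc n) ch = symmetric-resp (column-stable (col μ 0) (col λ′ 0) _ u (col≤length λ′ 0)) (columns-symmetric ch)

  between-symmetric : ∀ {λ′ μ} → IsPartition λ′ → IsPartition μ → Symmetric (between λ′ μ)
  between-symmetric {λ′} {μ} p q a b with T? (contained μ λ′)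
  ... | yes c = symmetric-resp (between-columns p q c) (columns-cs-symmetric p q c) a b
  ... | no ¬c = ≡.trans (vanish a b) (≡.sym (vanish b a))
    where
    vanish : ∀ a b → between λ′ μ a b ≡ 0
    vanish a b = ∑-zero (subpartitions λ′) (λ ν ν∈ → ind-*-zero (λ d →
      ¬c (contained-trans q d (proj₂ (∈-sub⁻ {λ′} ν∈)))))

  -- The number of reverse plane partitions of shape λ whose i-th largest entry occupies αᵢ columns.
  chains : List ℕ → List ℕ → ℕ
  chains []      λ′ = ind (λ′ == [])
  chains (k ∷ α) λ′ = ∑ (subpartitions λ′) (λ μ → ind (skewCols λ′ μ ≡ᵇ k) * chains α μ)

  ∑-sub-⊆ : ∀ {λ′ ν} (f : List ℕ → ℕ) → T (contained ν λ′) →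
            ∑ (subpartitions ν) f ≡ ∑ (subpartitions λ′) (λ μ → ind (contained μ ν) * f μ)
  ∑-sub-⊆ {λ′} {ν} f c = ∑-⊆ (λ μ → contained μ ν) (sub-Unique ν) (sub-Unique λ′)
    (λ μ μ∈ → let p , d = ∈-sub⁻ {ν} μ∈ in d , ∈-sub⁺ p (contained-trans p d c) , refl)
    (λ μ μ∈ d → ∈-sub⁺ (proj₁ (∈-sub⁻ {λ′} μ∈)) d)

  -- Fixing the shape `μ` below the two outermost layers separates `j` and `k` from the remaining
  -- weight.
  chains-two : ∀ j k α λ′ →
    chains (j ∷ k ∷ α) λ′ ≡ ∑ (subpartitions λ′) (λ μ → between λ′ μ j k * chains α μ)
  chains-two j k α λ′ = begin
    ∑ subs (λ ν → ind (skewCols λ′ ν ≡ᵇ j) * chains (k ∷ α) ν)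
      ≡⟨ ∑-cong subs (λ ν ν∈ → cong (ind (skewCols λ′ ν ≡ᵇ j) *_)
           (∑-sub-⊆ {λ′} {ν} (λ μ → ind (skewCols ν μ ≡ᵇ k) * chains α μ) (proj₂ (∈-sub⁻ {λ′} ν∈)))) ⟩
    ∑ subs (λ ν → ind (skewCols λ′ ν ≡ᵇ j) * ∑ subs (λ μ → ind (contained μ ν) * (ind (skewCols ν μ ≡ᵇ k) * chains α μ)))
      ≡⟨ ∑-cong subs (λ ν _ → ∑-*ˡ subs (ind (skewCols λ′ ν ≡ᵇ j)) _) ⟨
    ∑ subs (λ ν → ∑ subs (λ μ → ind (skewCols λ′ ν ≡ᵇ j) * (ind (contained μ ν) * (ind (skewCols ν μ ≡ᵇ k) * chains α μ))))
      ≡⟨ ∑-swap subs subs _ ⟩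
    ∑ subs (λ μ → ∑ subs (λ ν → ind (skewCols λ′ ν ≡ᵇ j) * (ind (contained μ ν) * (ind (skewCols ν μ ≡ᵇ k) * chains α μ))))
      ≡⟨ ∑-cong subs (λ μ _ → ∑-cong subs (λ ν _ →
           solve 4 (λ a b c d → a :* (b :* (c :* d)) := b :* (a :* c) :* d) refl
             (ind (skewCols λ′ ν ≡ᵇ j)) (ind (contained μ ν)) (ind (skewCols ν μ ≡ᵇ k)) (chains α μ))) ⟩
    ∑ subs (λ μ → ∑ subs (λ ν → ind (contained μ ν) * monomial (skewCols λ′ ν) (skewCols ν μ) j k * chains α μ))
      ≡⟨ ∑-cong subs (λ μ _ → ∑-*ʳ subs (λ ν → ind (contained μ ν) * monomial (skewCols λ′ ν) (skewCols ν μ) j k) (chains α μ)) ⟩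
    ∑ subs (λ μ → between λ′ μ j k * chains α μ) ∎
    where
    open ≡-Reasoning
    open +-*-Solver
    subs = subpartitions λ′

  -- Adjacent exchanges generate all permutations, and each exchange concerns just the two layers
  -- counted by `between`.
  chains-↭ : ∀ {α β λ′} → IsPartition λ′ → α ↭ β → chains α λ′ ≡ chains β λ′
  chains-↭ p refl = refl
  chains-↭ {λ′ = λ′} p (prep {xs} {ys} k r) = ∑-cong (subpartitions λ′) (λ μ μ∈ →
    cong (ind (skewCols λ′ μ ≡ᵇ k) *_) (chains-↭ (proj₁ (∈-sub⁻ {λ′} μ∈)) r))
  chains-↭ {λ′ = λ′} p (swap {xs} {ys} j k r) = begin
    chains (j ∷ k ∷ xs) λ′ ≡⟨ chains-two j k xs λ′ ⟩
    ∑ (subpartitions λ′) (λ μ → between λ′ μ j k * chains xs μ)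
      ≡⟨ ∑-cong (subpartitions λ′) (λ μ μ∈ → let q = proj₁ (∈-sub⁻ {λ′} μ∈) in
           cong₂ _*_ (between-symmetric p q j k) (chains-↭ q r)) ⟩
    ∑ (subpartitions λ′) (λ μ → between λ′ μ k j * chains ys μ) ≡⟨ chains-two k j ys λ′ ⟨
    chains (k ∷ j ∷ ys) λ′ ∎
    where open ≡-Reasoning
  chains-↭ p (trans r s) = ≡.trans (chains-↭ p r) (chains-↭ p s)

  -- Fillings

  allᵇ⁻ : ∀ {A : Set} (p : A → Bool) {xs} → T (allᵇ p xs) → ∀ {x} → x ∈ xs → T (p x)
  allᵇ⁻ p {y ∷ xs} t (here refl) = proj₁ (∧-elim t)
  allᵇ⁻ p {y ∷ xs} t (there q)   = allᵇ⁻ p (proj₂ (∧-elim {p y} t)) q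

  allᵇ⁺ : ∀ {A : Set} (p : A → Bool) xs → (∀ x → x ∈ xs → T (p x)) → T (allᵇ p xs)
  allᵇ⁺ p []       f = tt
  allᵇ⁺ p (y ∷ xs) f = ∧-intro (f y (here refl)) (allᵇ⁺ p xs (λ x q → f x (there q)))

  anyᵇ⁻ : ∀ {A : Set} (p : A → Bool) xs → T (anyᵇ p xs) → ∃ λ x → x ∈ xs × T (p x)
  anyᵇ⁻ p (y ∷ xs) t with p y in eq
  ... | true  = y , here refl , subst T (≡.sym eq) tt
  ... | false with x , q , r ← anyᵇ⁻ p xs t = x , there q , r

  anyᵇ⁺ : ∀ {A : Set} (p : A → Bool) {xs x} → x ∈ xs → T (p x) → T (anyᵇ p xs)
  anyᵇ⁺ p {y ∷ xs} (here refl) px with p y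
  ... | true = tt
  anyᵇ⁺ p {y ∷ xs} (there q)   px with p y
  ... | true  = tt
  ... | false = anyᵇ⁺ p q px

  ∈-boxesFrom⁻ : ∀ s l {r c} → (r , c) ∈ boxesFrom s l → ∃ λ r′ → r ≡ s + r′ × c < row l r′
  ∈-boxesFrom⁻ s (a ∷ l) p with ∈-++⁻ (map (s ,_) (upTo a)) p
  ... | inj₁ q with c , c∈ , refl ← ∈-map⁻ (s ,_) q = 0 , ≡.sym (ℕ.+-identityʳ s) , ∈-upTo⁻ c∈
  ... | inj₂ q with r′ , refl , c< ← ∈-boxesFrom⁻ (suc s) l q = suc r′ , ≡.sym (ℕ.+-suc s r′) , c<

  ∈-boxesFrom⁺ : ∀ s l r {c} → c < row l r → (s + r , c) ∈ boxesFrom s l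
  ∈-boxesFrom⁺ s (a ∷ l) zero    {c} p =
    ∈-++⁺ˡ (subst (λ z → (z , c) ∈ map (s ,_) (upTo a)) (≡.sym (ℕ.+-identityʳ s)) (∈-map⁺ (s ,_) (∈-upTo⁺ p)))
  ∈-boxesFrom⁺ s (a ∷ l) (suc r) {c} p =
    ∈-++⁺ʳ (map (s ,_) (upTo a)) (subst (λ z → (z , c) ∈ boxesFrom (suc s) l) (≡.sym (ℕ.+-suc s r)) (∈-boxesFrom⁺ (suc s) l r p))

  ∈-boxes⁻ : ∀ λ′ {r c} → (r , c) ∈ boxes λ′ → c < row λ′ r
  ∈-boxes⁻ λ′ p with r , refl , q ← ∈-boxesFrom⁻ 0 λ′ p = q

  ∈-boxes⁺ : ∀ λ′ {r c} → c < row λ′ r → (r , c) ∈ boxes λ′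
  ∈-boxes⁺ λ′ {r} p = ∈-boxesFrom⁺ 0 λ′ r p

  boxesFrom-Unique : ∀ s l → Unique (boxesFrom s l)
  boxesFrom-Unique s []      = []
  boxesFrom-Unique s (a ∷ l) = Unique.++⁺ (Unique.map⁺ (cong proj₂) (Unique.upTo⁺ a)) (boxesFrom-Unique (suc s) l)
    λ { (p , q) → disjoint p q }
    where
    disjoint : ∀ {b} → b ∈ map (s ,_) (upTo a) → ¬ (b ∈ boxesFrom (suc s) l)
    disjoint p q with c , _ , refl ← ∈-map⁻ (s ,_) p with r , eq , _ ← ∈-boxesFrom⁻ (suc s) l q =
      ℕ.<-irrefl eq (s≤s (ℕ.m≤m+n s r))

  length-boxesFrom : ∀ s l → length (boxesFrom s l) ≡ size l
  length-boxesFrom s []      = refl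
  length-boxesFrom s (a ∷ l) = ≡.trans (List.length-++ (map (s ,_) (upTo a)))
    (cong₂ _+_ (≡.trans (List.length-map (s ,_) (upTo a)) (List.length-upTo a)) (length-boxesFrom (suc s) l))

  ValueList : ℕ → ℕ → List ℕ → Set
  ValueList m n vs = length vs ≡ n × (∀ v → v ∈ vs → 1 ≤ v × v ≤ m)

  ∈-valueLists⁻ : ∀ {m} n {vs} → vs ∈ valueLists m n → ValueList m n vs
  ∈-valueLists⁻ {m} zero (here refl) = refl , λ _ ()
  ∈-valueLists⁻ {m} (suc n) p
    with v , vs , v∈ , vs∈ , refl ← ∈-concatMap-cons⁻ {λ _ → valueLists m n} (map suc (upTo m)) p
    with i , i∈ , refl ← ∈-map⁻ suc v∈ with e , b ← ∈-valueLists⁻ n vs∈ =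
    cong suc e , λ { _ (here refl) → s≤s z≤n , ∈-upTo⁻ i∈ ; w (there q) → b w q }

  ∈-valueLists⁺ : ∀ {m} n {vs} → ValueList m n vs → vs ∈ valueLists m n
  ∈-valueLists⁺ zero    {[]}     (e , b) = here refl
  ∈-valueLists⁺ {m} (suc n) {zero ∷ vs} (e , b) with () ← proj₁ (b zero (here refl))
  ∈-valueLists⁺ {m} (suc n) {suc v ∷ vs} (e , b) = ∈-concatMap-cons⁺ {λ _ → valueLists m n}
    (∈-map⁺ suc (∈-upTo⁺ (proj₂ (b (suc v) (here refl)))))
    (∈-valueLists⁺ n (ℕ.suc-injective e , λ w q → b w (there q)))

  valueLists-Unique : ∀ m n → Unique (valueLists m n)
  valueLists-Unique m zero    = [] ∷ []
  valueLists-Unique m (suc n) =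
    concatMap-cons-Unique {f = λ _ → valueLists m n} (Unique.map⁺ ℕ.suc-injective (Unique.upTo⁺ m)) (λ _ → valueLists-Unique m n)

  -- Fillings are defined as lists of values. `reading`, `fill` and `entry` translate between these
  -- and functions of row and column, for which restriction to a smaller shape needs no bookkeeping
  -- of positions.
  reading : List ℕ → (ℕ → ℕ → ℕ) → List ℕ
  reading λ′ f = map (uncurry f) (boxes λ′)

  fill : List ℕ → (ℕ → ℕ → ℕ) → Filling
  fill λ′ f = map (λ b → b , uncurry f b) (boxes λ′)

  zip-map : ∀ {A B : Set} (f : A → B) xs → zip xs (map f xs) ≡ map (λ x → x , f x) xs
  zip-map f []       = refl
  zip-map f (x ∷ xs) = cong ((x , f x) ∷_) (zip-map f xs)

  if-true : ∀ {a} {A : Set a} {x} {y z : A} → T x → (if x then y else z) ≡ y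
  if-true {x = true} _ = refl

  if-false : ∀ {a} {A : Set a} {x} {y z : A} → ¬ T x → (if x then y else z) ≡ z
  if-false {x = true}  p = ⊥-elim (p tt)
  if-false {x = false} p = refl

  sameBox⁻ : ∀ r c r′ c′ → T ((r ≡ᵇ r′) ∧ (c ≡ᵇ c′)) → (r , c) ≡ (r′ , c′)
  sameBox⁻ r c r′ c′ t = cong₂ _,_ (ℕ.≡ᵇ⇒≡ r r′ (proj₁ (∧-elim t))) (ℕ.≡ᵇ⇒≡ c c′ (proj₂ (∧-elim {r ≡ᵇ r′} t)))

  sameBox⁺ : ∀ r c → T ((r ≡ᵇ r) ∧ (c ≡ᵇ c))
  sameBox⁺ r c = ∧-intro (ℕ.≡⇒≡ᵇ r r refl) (ℕ.≡⇒≡ᵇ c c refl)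

  valAt-∈ : ∀ f bs {r c} → (r , c) ∈ bs → valAt (map (λ b → b , uncurry f b) bs) r c ≡ just (f r c)
  valAt-∈ f ((r′ , c′) ∷ bs) {r} {c} p with T? ((r ≡ᵇ r′) ∧ (c ≡ᵇ c′))
  valAt-∈ f ((r′ , c′) ∷ bs) {r} {c} p | yes t with refl ← sameBox⁻ r c r′ c′ t = if-true t
  valAt-∈ f ((r′ , c′) ∷ bs) {r} {c} (here refl) | no ¬t = ⊥-elim (¬t (sameBox⁺ r c))
  valAt-∈ f ((r′ , c′) ∷ bs) {r} {c} (there p)   | no ¬t = ≡.trans (if-false ¬t) (valAt-∈ f bs p)

  valAt-∉ : ∀ f bs {r c} → ¬ ((r , c) ∈ bs) → valAt (map (λ b → b , uncurry f b) bs) r c ≡ nothing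
  valAt-∉ f []               p = refl
  valAt-∉ f ((r′ , c′) ∷ bs) {r} {c} p =
    ≡.trans (if-false (λ t → p (here (sameBox⁻ r c r′ c′ t)))) (valAt-∉ f bs (p ∘ there))

  -- The default 0 is a filler for positions outside the shape.
  entry : List ℕ → List ℕ → ℕ → ℕ → ℕ
  entry λ′ vs r c = fromMaybe 0 (valAt (zip (boxes λ′) vs) r c)

  lookup-zip : ∀ {bs} vs → Unique bs → length vs ≡ length bs →
               map (λ b → fromMaybe 0 (valAt (zip bs vs) (proj₁ b) (proj₂ b))) bs ≡ vs
  lookup-zip []       []       e = refl
  lookup-zip {(r , c) ∷ bs} (v ∷ vs) (b∉ ∷ u) e =
    cong₂ _∷_ head (≡.trans (List.map-cong-local (All.tabulate tail)) (lookup-zip vs u (ℕ.suc-injective e)))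
    where
    head : fromMaybe 0 (valAt (zip ((r , c) ∷ bs) (v ∷ vs)) r c) ≡ v
    head = cong (fromMaybe 0) (if-true (sameBox⁺ r c))
    tail : ∀ {b} → b ∈ bs → fromMaybe 0 (valAt (zip ((r , c) ∷ bs) (v ∷ vs)) (proj₁ b) (proj₂ b))
                          ≡ fromMaybe 0 (valAt (zip bs vs) (proj₁ b) (proj₂ b))
    tail {r′ , c′} b∈ = cong (fromMaybe 0)
      (if-false (λ t → All.lookup b∉ b∈ (≡.sym (sameBox⁻ r′ c′ r c t))))

  reading-entry : ∀ {λ′ vs} → length vs ≡ size λ′ → reading λ′ (entry λ′ vs) ≡ vs
  reading-entry {λ′} {vs} e = lookup-zip vs (boxesFrom-Unique 0 λ′) (≡.trans e (≡.sym (length-boxesFrom 0 λ′)))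

  zip-reading : ∀ λ′ f → zip (boxes λ′) (reading λ′ f) ≡ fill λ′ f
  zip-reading λ′ f = zip-map (uncurry f) (boxes λ′)

  zip-entry : ∀ {λ′ vs} → length vs ≡ size λ′ → zip (boxes λ′) vs ≡ fill λ′ (entry λ′ vs)
  zip-entry {λ′} {vs} e = ≡.trans (cong (zip (boxes λ′)) (≡.sym (reading-entry {λ′} e))) (zip-reading λ′ (entry λ′ vs))

  entry-reading : ∀ {λ′} f {r c} → c < row λ′ r → entry λ′ (reading λ′ f) r c ≡ f r c
  entry-reading {λ′} f {r} {c} p = cong (fromMaybe 0)
    (≡.trans (cong (λ F → valAt F r c) (zip-reading λ′ f)) (valAt-∈ f (boxes λ′) (∈-boxes⁺ λ′ p)))

  reading-cong : ∀ {λ′ f g} → (∀ r c → c < row λ′ r → f r c ≡ g r c) → reading λ′ f ≡ reading λ′ g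
  reading-cong {λ′} p = List.map-cong-local (All.tabulate {xs = boxes λ′} (λ { {r , c} b∈ → p r c (∈-boxes⁻ λ′ b∈) }))

  length-reading : ∀ λ′ f → length (reading λ′ f) ≡ size λ′
  length-reading λ′ f = ≡.trans (List.length-map (uncurry f) (boxes λ′)) (length-boxesFrom 0 λ′)

  entry-bounds : ∀ {m λ′ vs} → ValueList m (size λ′) vs → ∀ {r c} → c < row λ′ r →
                 1 ≤ entry λ′ vs r c × entry λ′ vs r c ≤ m
  entry-bounds {m} {λ′} {vs} (e , b) {r} {c} p = b (entry λ′ vs r c) (subst (entry λ′ vs r c ∈_) (reading-entry {λ′} e) (∈-map⁺ (uncurry (entry λ′ vs)) (∈-boxes⁺ λ′ p)))

  reading-ValueList : ∀ {m λ′ f} → (∀ r c → c < row λ′ r → 1 ≤ f r c × f r c ≤ m) → ValueList m (size λ′) (reading λ′ f)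
  reading-ValueList {m} {λ′} {f} p = length-reading λ′ f , bounds
    where
    bounds : ∀ v → v ∈ reading λ′ f → 1 ≤ v × v ≤ m
    bounds v v∈ with (r , c) , b∈ , refl ← ∈-map⁻ (uncurry f) v∈ = p r c (∈-boxes⁻ λ′ b∈)

  RelCols : Bool → ℕ → ℕ → Set
  RelCols true  m n = m < n
  RelCols false m n = m ≤ n

  Monotone : Bool → List ℕ → (ℕ → ℕ → ℕ) → Set
  Monotone s λ′ f = ∀ r c → c < row λ′ r →
    (suc c < row λ′ r → f r c ≤ f r (suc c)) × (c < row λ′ (suc r) → RelCols s (f r c) (f (suc r) c))

  okAt⁻ : ∀ {λ′ f r c} p → T (okAt p (valAt (fill λ′ f) r c)) → c < row λ′ r → T (p (f r c))
  okAt⁻ {λ′} {f} p t c< = subst (T ∘ okAt p) (valAt-∈ f (boxes λ′) (∈-boxes⁺ λ′ c<)) t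

  okAt⁺ : ∀ {λ′ f r c} p → (c < row λ′ r → T (p (f r c))) → T (okAt p (valAt (fill λ′ f) r c))
  okAt⁺ {λ′} {f} {r} {c} p h with c <? row λ′ r
  ... | yes c< = subst (T ∘ okAt p) (≡.sym (valAt-∈ f (boxes λ′) (∈-boxes⁺ λ′ c<))) (h c<)
  ... | no c≮  = subst (T ∘ okAt p) (≡.sym (valAt-∉ f (boxes λ′) (c≮ ∘ ∈-boxes⁻ λ′))) tt

  RelCols⁻ : ∀ s m n → T (if s then m <ᵇ n else m ≤ᵇ n) → RelCols s m n
  RelCols⁻ true  m n = ℕ.<ᵇ⇒< m n
  RelCols⁻ false m n = ℕ.≤ᵇ⇒≤ m n

  RelCols⁺ : ∀ s {m n} → RelCols s m n → T (if s then m <ᵇ n else m ≤ᵇ n)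
  RelCols⁺ true  = ℕ.<⇒<ᵇ
  RelCols⁺ false = ℕ.≤⇒≤ᵇ

  monotone⁻ : ∀ s λ′ {f} → T (monotone s (fill λ′ f)) → Monotone s λ′ f
  monotone⁻ s λ′ {f} t r c c<
    with t₁ , t₂ ← ∧-elim {okAt (λ w → f r c ≤ᵇ w) (valAt (fill λ′ f) r (suc c))}
                     (allᵇ⁻ _ t (∈-map⁺ (λ b → b , uncurry f b) (∈-boxes⁺ λ′ c<))) =
    (λ p → ℕ.≤ᵇ⇒≤ (f r c) _ (okAt⁻ {λ′} (λ w → f r c ≤ᵇ w) t₁ p)) ,
    (λ p → RelCols⁻ s (f r c) (f (suc r) c) (okAt⁻ {λ′} (λ w → if s then f r c <ᵇ w else f r c ≤ᵇ w) t₂ p))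

  monotone⁺ : ∀ s λ′ {f} → Monotone s λ′ f → T (monotone s (fill λ′ f))
  monotone⁺ s λ′ {f} m = allᵇ⁺ _ (fill λ′ f) check
    where
    check : ∀ x → x ∈ fill λ′ f → _
    check x x∈ with (r , c) , b∈ , refl ← ∈-map⁻ (λ b → b , uncurry f b) x∈ = ∧-intro
      (okAt⁺ {λ′} {f} {r} {suc c} (λ w → f r c ≤ᵇ w) (λ p → ℕ.≤⇒≤ᵇ (proj₁ (m r c (∈-boxes⁻ λ′ b∈)) p)))
      (okAt⁺ {λ′} {f} {suc r} {c} (λ w → if s then f r c <ᵇ w else f r c ≤ᵇ w)
        (λ p → RelCols⁺ s (proj₂ (m r c (∈-boxes⁻ λ′ b∈)) p)))

  -- The test inside `colCount`, with projections in place of its pattern-matching function so that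
  -- it can be named.
  hasEntry : Filling → ℕ → ℕ → Bool
  hasEntry F i c = anyᵇ (λ x → (c ≡ᵇ proj₂ (proj₁ x)) ∧ (proj₂ x ≡ᵇ i)) F

  hasEntry⁻ : ∀ {λ′ f i c} → T (hasEntry (fill λ′ f) i c) → ∃ λ r → c < row λ′ r × f r c ≡ i
  hasEntry⁻ {λ′} {f} {i} {c} t
    with x , x∈ , u ← anyᵇ⁻ _ (fill λ′ f) t
    with (r , c′) , b∈ , refl ← ∈-map⁻ (λ b → b , uncurry f b) x∈
    with refl ← ℕ.≡ᵇ⇒≡ c c′ (proj₁ (∧-elim u)) =
    r , ∈-boxes⁻ λ′ b∈ , ℕ.≡ᵇ⇒≡ (f r c) i (proj₂ (∧-elim {c ≡ᵇ c} u))

  hasEntry⁺ : ∀ {λ′ f i r c} → c < row λ′ r → f r c ≡ i → T (hasEntry (fill λ′ f) i c)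
  hasEntry⁺ {λ′} {f} {i} {r} {c} p e = anyᵇ⁺ _ (∈-map⁺ (λ b → b , uncurry f b) (∈-boxes⁺ λ′ p))
    (∧-intro (ℕ.≡⇒≡ᵇ c c refl) (ℕ.≡⇒≡ᵇ (f r c) i e))

  anyᵇ-cong : ∀ {A : Set} {p q : A → Bool} xs → (∀ x → p x ≡ q x) → anyᵇ p xs ≡ anyᵇ q xs
  anyᵇ-cong []       e = refl
  anyᵇ-cong (x ∷ xs) e = cong₂ _∨_ (e x) (anyᵇ-cong xs e)

  colCount-∑ : ∀ λ′ F i → colCount λ′ F i ≡ ∑ (upTo (headOr0 λ′)) (λ c → ind (hasEntry F i c))
  colCount-∑ λ′ F i = ≡.trans (count-∑ _ (upTo (headOr0 λ′)))
    (∑-cong (upTo (headOr0 λ′)) (λ c _ → cong ind (anyᵇ-cong F (λ { ((_ , _) , _) → refl }))))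

  -- Removing the largest entry of a reverse plane partition

  -- A downward closed set of numbers below `n` is an initial segment, so its cardinality is where
  -- it ends.
  ∑-ind-prefix : ∀ n (p : ℕ → Bool) → (∀ c → suc c < n → T (p (suc c)) → T (p c)) →
                 ∀ c → (c < ∑ (upTo n) (ind ∘ p) → c < n × T (p c)) × (c < n × T (p c) → c < ∑ (upTo n) (ind ∘ p))
  ∑-ind-prefix zero    p d c = (λ ()) , λ { (() , _) }
  ∑-ind-prefix (suc n) p d c with T? (p 0)
  ∑-ind-prefix (suc n) p d zero    | yes p0 =
    (λ _ → s≤s z≤n , p0) , λ _ → subst (0 <_) (cong (_+ ∑ (applyUpTo suc n) (ind ∘ p)) (≡.sym (ind-true p0))) (s≤s z≤n)
  ∑-ind-prefix (suc n) p d (suc c) | yes p0 =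
    (λ lt → let q , r = proj₁ rec (ℕ.≤-pred (subst (suc c <_) eq lt)) in s≤s q , r) ,
    (λ { (s≤s q , r) → subst (suc c <_) (≡.sym eq) (s≤s (proj₂ rec (q , r))) })
    where
    rec = ∑-ind-prefix n (p ∘ suc) (λ c q → d (suc c) (s≤s q)) c
    eq : ∑ (upTo (suc n)) (ind ∘ p) ≡ suc (∑ (upTo n) (ind ∘ p ∘ suc))
    eq = ≡.trans (∑-upTo-shift n (ind ∘ p)) (cong (_+ ∑ (upTo n) (ind ∘ p ∘ suc)) (ind-true p0))
  ∑-ind-prefix (suc n) p d c | no ¬p0 =
    (λ lt → ⊥-elim (ℕ.<⇒≱ lt (ℕ.≤-trans (ℕ.≤-reflexive zero-sum) z≤n))) , (λ { (c<n , pc) → ⊥-elim (¬p0 (down c c<n pc)) })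
    where
    down : ∀ c → c < suc n → T (p c) → T (p 0)
    down zero    _  t = t
    down (suc c) lt t = down c (ℕ.<-trans (ℕ.n<1+n c) lt) (d c lt t)
    zero-sum : ∑ (upTo (suc n)) (ind ∘ p) ≡ 0
    zero-sum = ∑-zero (upTo (suc n)) (λ c c∈ → ind-false (¬p0 ∘ down c (∈-upTo⁻ c∈)))

  -- In a row that increases weakly the entries at most `k` come first, so their number is a row
  -- length.
  subshape : List ℕ → ℕ → (ℕ → ℕ → ℕ) → List ℕ
  subshape λ′ k f = fromRows (length λ′) (λ r → ∑ (upTo (row λ′ r)) (λ c → ind (f r c ≤ᵇ k)))

  module _ {λ′} (λ-part : IsPartition λ′) (k : ℕ) {f} (mono : Monotone false λ′ f) where
    private
      ρ : ℕ → ℕ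
      ρ r = ∑ (upTo (row λ′ r)) (λ c → ind (f r c ≤ᵇ k))

      ρ-prefix : ∀ r c → (c < ρ r → c < row λ′ r × T (f r c ≤ᵇ k)) × (c < row λ′ r × T (f r c ≤ᵇ k) → c < ρ r)
      ρ-prefix r = ∑-ind-prefix (row λ′ r) (λ c → f r c ≤ᵇ k) (λ c lt t → ℕ.≤⇒≤ᵇ
        (ℕ.≤-trans (proj₁ (mono r c (ℕ.<-trans (ℕ.n<1+n c) lt)) lt) (ℕ.≤ᵇ⇒≤ (f r (suc c)) k t)))

      ρ-antitone : ∀ r → ρ (suc r) ≤ ρ r
      ρ-antitone r = ≤-ext (λ c lt → let p , t = proj₁ (ρ-prefix (suc r) c) lt
                                         q = ℕ.≤-trans p (row-suc λ-part r) in
        proj₂ (ρ-prefix r c) (q , ℕ.≤⇒≤ᵇ (ℕ.≤-trans (proj₂ (mono r c q) p) (ℕ.≤ᵇ⇒≤ (f (suc r) c) k t))))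

      row-subshape : ∀ r → row (subshape λ′ k f) r ≡ ρ r
      row-subshape = row-fromRows (length λ′) ρ-antitone
        (cong (λ n → ∑ (upTo n) (λ c → ind (f (length λ′) c ≤ᵇ k))) (row-length λ′ ℕ.≤-refl))

    subshape-partition : IsPartition (subshape λ′ k f)
    subshape-partition = fromRows-partition (length λ′) ρ-antitone

    <-subshape⁻ : ∀ {r c} → c < row (subshape λ′ k f) r → c < row λ′ r × f r c ≤ k
    <-subshape⁻ {r} {c} p with q , t ← proj₁ (ρ-prefix r c) (subst (c <_) (row-subshape r) p) = q , ℕ.≤ᵇ⇒≤ (f r c) k t

    <-subshape⁺ : ∀ {r c} → c < row λ′ r → f r c ≤ k → c < row (subshape λ′ k f) r
    <-subshape⁺ {r} {c} p q = subst (c <_) (≡.sym (row-subshape r)) (proj₂ (ρ-prefix r c) (p , ℕ.≤⇒≤ᵇ q))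

    subshape∈sub : subshape λ′ k f ∈ subpartitions λ′
    subshape∈sub = ∈-sub⁺ {λ′} subshape-partition
      (row⇒contained {λ′ = λ′} subshape-partition (λ r → ≤-ext (λ c → proj₁ ∘ <-subshape⁻)))

  colCounts : List ℕ → Filling → ℕ → List ℕ
  colCounts λ′ F l = map (colCount λ′ F) (map suc (upTo l))

  -- The situation common to both directions of the bijection in `Peel`: `f` continues `f′` by the
  -- constant `suc l`. For restriction, `f′` is `f` itself.
  record Extends (λ′ μ : List ℕ) (l : ℕ) (f f′ : ℕ → ℕ → ℕ) : Set where
    field
      λ-part  : IsPartition λ′
      μ-part  : IsPartition μ
      μ⊆λ     : T (contained μ λ′)
      inside  : ∀ {r c} → c < row μ r → f r c ≡ f′ r c
      small   : ∀ {r c} → c < row μ r → f′ r c ≤ l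
      outside : ∀ {r c} → c < row λ′ r → row μ r ≤ c → f r c ≡ suc l

    within : ∀ {r c} → c < row μ r → c < row λ′ r
    within {r} p = ℕ.≤-trans p (contained⇒row μ λ′ μ⊆λ r)

    restrict-monotone : Monotone false λ′ f → Monotone false μ f′
    restrict-monotone m r c p =
      (λ q → subst (_≤ f′ r (suc c)) (inside p) (subst (f r c ≤_) (inside q) (proj₁ (m r c (within p)) (within q)))) ,
      (λ q → subst (_≤ f′ (suc r) c) (inside p) (subst (f r c ≤_) (inside q) (proj₂ (m r c (within p)) (within q))))

    bounded-by : ∀ {r c} → c < row λ′ r → f r c ≤ suc l
    bounded-by {r} {c} p with c <? row μ r
    ... | yes q = ℕ.m≤n⇒m≤1+n (subst (_≤ l) (≡.sym (inside q)) (small q))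
    ... | no ¬q = ℕ.≤-reflexive (outside p (ℕ.≮⇒≥ ¬q))

    extend-monotone : Monotone false μ f′ → Monotone false λ′ f
    extend-monotone m r c p = (λ q → step p q (λ s → ℕ.<-trans (ℕ.n<1+n c) s) (λ s t → proj₁ (m r c s) t)) ,
                              (λ q → step p q (λ s → ℕ.≤-trans s (row-suc μ-part r)) (λ s t → proj₂ (m r c s) t))
      where
      -- If the right or lower neighbour lies in `μ`, so does the box itself; if it does not, its
      -- value is the maximal one.
      step : ∀ {r′ c′} → c < row λ′ r → c′ < row λ′ r′ → (c′ < row μ r′ → c < row μ r) →
             (c < row μ r → c′ < row μ r′ → f′ r c ≤ f′ r′ c′) → f r c ≤ f r′ c′
      step {r′} {c′} p q d h with c′ <? row μ r′
      ... | yes s = subst (_≤ f r′ c′) (≡.sym (inside (d s))) (subst (f′ r c ≤_) (≡.sym (inside s)) (h (d s) s))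
      ... | no ¬s = ℕ.≤-trans (bounded-by p) (ℕ.≤-reflexive (≡.sym (outside q (ℕ.≮⇒≥ ¬s))))

    colCount-small : ∀ {i} → i ≤ l → colCount λ′ (fill λ′ f) i ≡ colCount μ (fill μ f′) i
    colCount-small {i} i≤l = begin
      colCount λ′ (fill λ′ f) i
        ≡⟨ colCount-∑ λ′ (fill λ′ f) i ⟩
      ∑ (upTo (headOr0 λ′)) (λ c → ind (hasEntry (fill λ′ f) i c))
        ≡⟨ ∑-cong (upTo (headOr0 λ′)) (λ c _ → ind-cong (to c) (from c)) ⟩
      ∑ (upTo (headOr0 λ′)) (λ c → ind (hasEntry (fill μ f′) i c))
        ≡⟨ ∑-upTo-extend _ (contained⇒head μ λ′ μ⊆λ) (λ c c≥ → ind-false (λ t →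
             let r , c< , _ = hasEntry⁻ {μ} {f′} {i} {c} t in
             ℕ.<⇒≱ c< (ℕ.≤-trans (row≤head (decreasing μ-part) r) c≥))) ⟩
      ∑ (upTo (headOr0 μ)) (λ c → ind (hasEntry (fill μ f′) i c))
        ≡⟨ colCount-∑ μ (fill μ f′) i ⟨
      colCount μ (fill μ f′) i ∎
      where
      open ≡-Reasoning
      to : ∀ c → T (hasEntry (fill λ′ f) i c) → T (hasEntry (fill μ f′) i c)
      to c t with r , c< , e ← hasEntry⁻ {λ′} {f} {i} {c} t with c <? row μ r
      ... | yes q = hasEntry⁺ {μ} {f′} q (≡.trans (≡.sym (inside q)) e)
      ... | no ¬q = ⊥-elim (ℕ.<⇒≱ (ℕ.n<1+n l) (subst (_≤ l) (≡.trans (≡.sym e) (outside c< (ℕ.≮⇒≥ ¬q))) i≤l))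
      from : ∀ c → T (hasEntry (fill μ f′) i c) → T (hasEntry (fill λ′ f) i c)
      from c t with r , c< , e ← hasEntry⁻ {μ} {f′} {i} {c} t = hasEntry⁺ {λ′} {f} (within c<) (≡.trans (inside c<) e)

    colCount-last : colCount λ′ (fill λ′ f) (suc l) ≡ skewCols λ′ μ
    colCount-last = ≡.trans (colCount-∑ λ′ (fill λ′ f) (suc l))
      (∑-cong (upTo (headOr0 λ′)) (λ c _ → ind-cong (to c) (from c)))
      where
      to : ∀ c → T (hasEntry (fill λ′ f) (suc l) c) → T (col μ c <ᵇ col λ′ c)
      to c t with r , c< , e ← hasEntry⁻ {λ′} {f} {suc l} {c} t = ℕ.<⇒<ᵇ (ℕ.≤-<-trans
        (ℕ.≮⇒≥ (λ r< → ℕ.<⇒≱ (ℕ.n<1+n l) (subst (_≤ l) (≡.trans (≡.sym (inside (<col⇒<row (decreasing μ-part) r<))) e)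
          (small (<col⇒<row (decreasing μ-part) r<)))))
        (<row⇒<col (decreasing λ-part) c<))
      from : ∀ c → T (col μ c <ᵇ col λ′ c) → T (hasEntry (fill λ′ f) (suc l) c)
      -- The topmost box of column `c` outside `μ` is in row `col μ c`.
      from c t = hasEntry⁺ {λ′} {f} {r = col μ c} c< (outside c< (ℕ.≮⇒≥ (λ q →
          ℕ.<-irrefl refl (<row⇒<col (decreasing μ-part) q))))
        where c< = <col⇒<row (decreasing λ-part) (ℕ.<ᵇ⇒< (col μ c) (col λ′ c) t)

    colCounts-extend : colCounts λ′ (fill λ′ f) (suc l) ≡ colCounts μ (fill μ f′) l ∷ʳ skewCols λ′ μ
    colCounts-extend = begin
      map (colCount λ′ (fill λ′ f)) (map suc (upTo (suc l)))
        ≡⟨ List.map-∘ (upTo (suc l)) ⟨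
      map (colCount λ′ (fill λ′ f) ∘ suc) (upTo (suc l))
        ≡⟨ cong (map (colCount λ′ (fill λ′ f) ∘ suc)) (List.upTo-∷ʳ l) ⟨
      map (colCount λ′ (fill λ′ f) ∘ suc) (upTo l ∷ʳ l)
        ≡⟨ List.map-++ (colCount λ′ (fill λ′ f) ∘ suc) (upTo l) (l ∷ []) ⟩
      map (colCount λ′ (fill λ′ f) ∘ suc) (upTo l) ∷ʳ colCount λ′ (fill λ′ f) (suc l)
        ≡⟨ cong₂ _∷ʳ_ (List.map-cong-local (All.tabulate (λ i∈ → colCount-small (∈-upTo⁻ i∈)))) colCount-last ⟩
      map (colCount μ (fill μ f′) ∘ suc) (upTo l) ∷ʳ skewCols λ′ μ
        ≡⟨ cong (_∷ʳ skewCols λ′ μ) (List.map-∘ (upTo l)) ⟩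
      colCounts μ (fill μ f′) l ∷ʳ skewCols λ′ μ ∎
      where open ≡-Reasoning

  isRPP : List ℕ → List ℕ → List ℕ → Bool
  isRPP λ′ ν vs = monotone false (zip (boxes λ′) vs) ∧ (colCounts λ′ (zip (boxes λ′) vs) (length ν) == ν)

  isRPP⁻ : ∀ {λ′ ν vs f} → zip (boxes λ′) vs ≡ fill λ′ f → T (isRPP λ′ ν vs) →
           Monotone false λ′ f × colCounts λ′ (fill λ′ f) (length ν) ≡ ν
  isRPP⁻ {λ′} {ν} {vs} {f} e t =
    let t₁ , t₂ = ∧-elim {monotone false (fill λ′ f)}
                    (subst (λ F → T (monotone false F ∧ (colCounts λ′ F (length ν) == ν))) e t) in
    monotone⁻ false λ′ t₁ , ==⇒≡ _ ν t₂

  isRPP⁺ : ∀ {λ′ ν vs f} → zip (boxes λ′) vs ≡ fill λ′ f →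
           Monotone false λ′ f → colCounts λ′ (fill λ′ f) (length ν) ≡ ν → T (isRPP λ′ ν vs)
  isRPP⁺ {λ′} {ν} {vs} {f} e m c = subst (λ F → T (monotone false F ∧ (colCounts λ′ F (length ν) == ν))) (≡.sym e)
    (∧-intro (monotone⁺ false λ′ m) (≡⇒== c))

  rppCount-∑ : ∀ λ′ ν → rppCount λ′ ν ≡ ∑ (valueLists (length ν) (size λ′)) (ind ∘ isRPP λ′ ν)
  rppCount-∑ λ′ ν = ≡.trans (count-∑ _ (fillingsOf λ′ (length ν))) (∑-map (zip (boxes λ′)) (valueLists (length ν) (size λ′)) _)

  -- The shape `μ` that remains is fixed in advance, so that restricting to `μ` and extending by the
  -- largest entry are inverse maps; the sum over `μ` is taken afterwards.
  module Peel {λ′ μ} (λ-part : IsPartition λ′) (μ∈ : μ ∈ subpartitions λ′) (α : List ℕ) (k : ℕ) where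
    private
      μ-part : IsPartition μ
      μ-part = proj₁ (∈-sub⁻ {λ′} μ∈)
      μ⊆λ : T (contained μ λ′)
      μ⊆λ = proj₂ (∈-sub⁻ {λ′} μ∈)
      l : ℕ
      l = length α
      len : length (α ∷ʳ k) ≡ suc l
      len = ≡.trans (List.length-++ α) (ℕ.+-comm l 1)

    restrict extend : List ℕ → List ℕ
    restrict vs = reading μ (entry λ′ vs)
    extended : List ℕ → ℕ → ℕ → ℕ
    extended vs r c = if c <ᵇ row μ r then entry μ vs r c else suc l
    extend vs = reading λ′ (extended vs)

    p q : List ℕ → Bool
    p vs = isRPP λ′ (α ∷ʳ k) vs ∧ (subshape λ′ l (entry λ′ vs) == μ)
    q vs = (skewCols λ′ μ ≡ᵇ k) ∧ isRPP μ α vs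

    extends-restrict : ∀ {vs} → ValueList (suc l) (size λ′) vs → Monotone false λ′ (entry λ′ vs) →
                       subshape λ′ l (entry λ′ vs) ≡ μ → Extends λ′ μ l (entry λ′ vs) (entry λ′ vs)
    extends-restrict {vs} vl mono sh = record
      { λ-part = λ-part; μ-part = μ-part; μ⊆λ = μ⊆λ
      ; inside = λ _ → refl
      ; small = λ {r} {c} c< → proj₂ (<-subshape⁻ λ-part l mono (subst (λ ν → c < row ν r) (≡.sym sh) c<))
      -- By the choice of `subshape`, an entry outside `μ` exceeds `l`, and no entry exceeds
      -- `suc l`.
      ; outside = λ {r} {c} c< c≥ → ℕ.≤-antisym (proj₂ (entry-bounds {suc l} {λ′} vl c<))
          (ℕ.≰⇒> (λ le → ℕ.<⇒≱ (subst (λ ν → c < row ν r) sh (<-subshape⁺ λ-part l mono c< le)) c≥)) }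

    extends-extend : ∀ {vs} → ValueList l (size μ) vs → Extends λ′ μ l (extended vs) (entry μ vs)
    extends-extend {vs} vl = record
      { λ-part = λ-part; μ-part = μ-part; μ⊆λ = μ⊆λ
      ; inside = λ c< → if-true (ℕ.<⇒<ᵇ c<)
      ; small = λ c< → proj₂ (entry-bounds {l} {μ} vl c<)
      ; outside = λ {r} {c} _ c≥ → if-false (λ t → ℕ.<⇒≱ (ℕ.<ᵇ⇒< c (row μ r) t) c≥) }

    to : ∀ vs → vs ∈ valueLists (suc l) (size λ′) → T (p vs) →
         restrict vs ∈ valueLists l (size μ) × T (q (restrict vs)) × extend (restrict vs) ≡ vs × ind (p vs) ≡ ind (q (restrict vs))
    to vs vs∈ pvs = restrict∈ , qr , back , ≡.trans (ind-true pvs) (≡.sym (ind-true qr))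
      where
      f = entry λ′ vs
      vl = ∈-valueLists⁻ (size λ′) vs∈
      sh : subshape λ′ l f ≡ μ
      sh = ==⇒≡ _ μ (proj₂ (∧-elim {isRPP λ′ (α ∷ʳ k) vs} pvs))
      rpp : Monotone false λ′ f × colCounts λ′ (fill λ′ f) (length (α ∷ʳ k)) ≡ α ∷ʳ k
      rpp = isRPP⁻ {λ′} {α ∷ʳ k} (zip-entry {λ′} (proj₁ vl)) (proj₁ (∧-elim pvs))
      module E = Extends (extends-restrict vl (proj₁ rpp) sh)
      restrict∈ : restrict vs ∈ valueLists l (size μ)
      restrict∈ = ∈-valueLists⁺ (size μ) (reading-ValueList {l} {μ} (λ r c c< →
        proj₁ (entry-bounds {suc l} {λ′} vl (E.within c<)) , E.small c<))
      counts : colCounts μ (fill μ f) l ∷ʳ skewCols λ′ μ ≡ α ∷ʳ k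
      counts = ≡.trans (≡.sym E.colCounts-extend)
        (subst (λ n → colCounts λ′ (fill λ′ f) n ≡ α ∷ʳ k) len (proj₂ rpp))
      qr : T (q (restrict vs))
      qr = ∧-intro (ℕ.≡⇒≡ᵇ (skewCols λ′ μ) k (List.∷ʳ-injectiveʳ (colCounts μ (fill μ f) l) α counts))
        (isRPP⁺ {μ} {α} (zip-reading μ f) (E.restrict-monotone (proj₁ rpp))
          (List.∷ʳ-injectiveˡ (colCounts μ (fill μ f) l) α counts))
      back : extend (restrict vs) ≡ vs
      back = ≡.trans (reading-cong {λ′} agree) (reading-entry {λ′} (proj₁ vl))
        where
        agree : ∀ r c → c < row λ′ r → extended (restrict vs) r c ≡ f r c
        agree r c c< with c <? row μ r
        ... | yes d = ≡.trans (if-true (ℕ.<⇒<ᵇ d)) (entry-reading {μ} f d)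
        ... | no ¬d = ≡.trans (if-false (¬d ∘ ℕ.<ᵇ⇒< c (row μ r))) (≡.sym (E.outside c< (ℕ.≮⇒≥ ¬d)))

    from : ∀ vs → vs ∈ valueLists l (size μ) → T (q vs) →
           extend vs ∈ valueLists (suc l) (size λ′) × T (p (extend vs)) × restrict (extend vs) ≡ vs
    from vs vs∈ qvs = extend∈ , ∧-intro rpp-extend (≡⇒== sh) , back
      where
      f′ = entry μ vs
      f = extended vs
      vl = ∈-valueLists⁻ (size μ) vs∈
      module E = Extends (extends-extend vl)
      rpp : Monotone false μ f′ × colCounts μ (fill μ f′) l ≡ α
      rpp = isRPP⁻ {μ} {α} (zip-entry {μ} (proj₁ vl)) (proj₂ (∧-elim {skewCols λ′ μ ≡ᵇ k} qvs))
      pos : ∀ r c → c < row λ′ r → 1 ≤ f r c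
      pos r c c< with c <? row μ r
      ... | yes d = subst (1 ≤_) (≡.sym (E.inside d)) (proj₁ (entry-bounds {l} {μ} vl d))
      ... | no ¬d = subst (1 ≤_) (≡.sym (E.outside c< (ℕ.≮⇒≥ ¬d))) (s≤s z≤n)
      extend∈ : extend vs ∈ valueLists (suc l) (size λ′)
      extend∈ = ∈-valueLists⁺ (size λ′) (reading-ValueList {suc l} {λ′} (λ r c c< → pos r c c< , E.bounded-by c<))
      mono : Monotone false λ′ f
      mono = E.extend-monotone (proj₁ rpp)
      rpp-extend : T (isRPP λ′ (α ∷ʳ k) (extend vs))
      rpp-extend = isRPP⁺ {λ′} {α ∷ʳ k} (zip-reading λ′ f) mono
        (subst (λ n → colCounts λ′ (fill λ′ f) n ≡ α ∷ʳ k) (≡.sym len)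
          (≡.trans E.colCounts-extend (cong₂ _∷ʳ_ (proj₂ rpp)
            (ℕ.≡ᵇ⇒≡ (skewCols λ′ μ) k (proj₁ (∧-elim qvs))))))
      mono′ : Monotone false λ′ (entry λ′ (extend vs))
      mono′ r c c< =
        (λ d → subst₂ _≤_ (≡.sym (entry-reading {λ′} f c<)) (≡.sym (entry-reading {λ′} f d)) (proj₁ (mono r c c<) d)) ,
        (λ d → subst₂ _≤_ (≡.sym (entry-reading {λ′} f c<)) (≡.sym (entry-reading {λ′} f d)) (proj₂ (mono r c c<) d))
        where open ≡ using (subst₂)
      sh : subshape λ′ l (entry λ′ (extend vs)) ≡ μ
      sh = row-ext (subshape-partition λ-part l mono′) μ-part (λ r → ≡-ext
        (λ c c< → let c<λ , le = <-subshape⁻ λ-part l mono′ c< in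
          ℕ.≰⇒> (λ d → ℕ.<⇒≱ (ℕ.n<1+n l) (subst (_≤ l) (≡.trans (entry-reading {λ′} f c<λ) (E.outside c<λ d)) le)))
        (λ c c< → <-subshape⁺ λ-part l mono′ (E.within c<)
          (subst (_≤ l) (≡.sym (≡.trans (entry-reading {λ′} f (E.within c<)) (E.inside c<))) (E.small c<))))
      back : restrict (extend vs) ≡ vs
      back = ≡.trans (reading-cong {μ} (λ r c c< → ≡.trans (entry-reading {λ′} f (E.within c<)) (E.inside c<)))
        (reading-entry {μ} (proj₁ vl))

    peel : ∑ (valueLists (suc l) (size λ′)) (ind ∘ p) ≡ ind (skewCols λ′ μ ≡ᵇ k) * rppCount μ α
    peel = begin
      ∑ (valueLists (suc l) (size λ′)) (ind ∘ p)
        ≡⟨ ∑-bij p q restrict extend (valueLists-Unique (suc l) (size λ′)) (valueLists-Unique l (size μ))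
             (λ _ → ind-false) (λ _ → ind-false) to from ⟩
      ∑ (valueLists l (size μ)) (ind ∘ q)
        ≡⟨ ∑-cong (valueLists l (size μ)) (λ vs _ → ind-∧ (skewCols λ′ μ ≡ᵇ k) (isRPP μ α vs)) ⟩
      ∑ (valueLists l (size μ)) (λ vs → ind (skewCols λ′ μ ≡ᵇ k) * ind (isRPP μ α vs))
        ≡⟨ ∑-*ˡ (valueLists l (size μ)) (ind (skewCols λ′ μ ≡ᵇ k)) (ind ∘ isRPP μ α) ⟩
      ind (skewCols λ′ μ ≡ᵇ k) * ∑ (valueLists l (size μ)) (ind ∘ isRPP μ α)
        ≡⟨ cong (ind (skewCols λ′ μ ≡ᵇ k) *_) (rppCount-∑ μ α) ⟨
      ind (skewCols λ′ μ ≡ᵇ k) * rppCount μ α ∎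
      where open ≡-Reasoning

  rppCount-∷ʳ : ∀ {λ′} → IsPartition λ′ → ∀ α k →
    rppCount λ′ (α ∷ʳ k) ≡ ∑ (subpartitions λ′) (λ μ → ind (skewCols λ′ μ ≡ᵇ k) * rppCount μ α)
  rppCount-∷ʳ {λ′} λ-part α k = begin
    rppCount λ′ (α ∷ʳ k)
      ≡⟨ rppCount-∑ λ′ (α ∷ʳ k) ⟩
    ∑ (valueLists (length (α ∷ʳ k)) (size λ′)) (ind ∘ isRPP λ′ (α ∷ʳ k))
      ≡⟨ cong (λ n → ∑ (valueLists n (size λ′)) (ind ∘ isRPP λ′ (α ∷ʳ k))) (≡.trans (List.length-++ α) (ℕ.+-comm (length α) 1)) ⟩
    ∑ vls (ind ∘ isRPP λ′ (α ∷ʳ k))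
      ≡⟨ ∑-cong vls expand ⟩
    ∑ vls (λ vs → ∑ (subpartitions λ′) (λ μ → ind (isRPP λ′ (α ∷ʳ k) vs ∧ (shape vs == μ))))
      ≡⟨ ∑-swap vls (subpartitions λ′) (λ vs μ → ind (isRPP λ′ (α ∷ʳ k) vs ∧ (shape vs == μ))) ⟩
    ∑ (subpartitions λ′) (λ μ → ∑ vls (λ vs → ind (isRPP λ′ (α ∷ʳ k) vs ∧ (shape vs == μ))))
      ≡⟨ ∑-cong (subpartitions λ′) (λ μ μ∈ → Peel.peel λ-part μ∈ α k) ⟩
    ∑ (subpartitions λ′) (λ μ → ind (skewCols λ′ μ ≡ᵇ k) * rppCount μ α) ∎
    where
    open ≡-Reasoning
    vls = valueLists (suc (length α)) (size λ′)
    shape : List ℕ → List ℕ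
    shape vs = subshape λ′ (length α) (entry λ′ vs)
    -- Each reverse plane partition leaves exactly one shape, so it is counted once in the sum over
    -- `μ`.
    expand : ∀ vs → vs ∈ vls → ind (isRPP λ′ (α ∷ʳ k) vs) ≡
             ∑ (subpartitions λ′) (λ μ → ind (isRPP λ′ (α ∷ʳ k) vs ∧ (shape vs == μ)))
    expand vs vs∈ with T? (isRPP λ′ (α ∷ʳ k) vs)
    ... | no ¬t = ≡.trans (ind-false ¬t) (≡.sym (∑-zero (subpartitions λ′) (λ μ _ → ind-false (¬t ∘ proj₁ ∘ ∧-elim))))
    ... | yes t = ≡.trans (ind-true t) (≡.sym (≡.trans
      (∑-single (sub-Unique λ′)
        (subshape∈sub λ-part (length α) (proj₁ (isRPP⁻ {λ′} {α ∷ʳ k} (zip-entry {λ′} (proj₁ (∈-valueLists⁻ (size λ′) vs∈))) t)))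
        (λ μ _ μ≢ → ind-false (λ u → μ≢ (≡.sym (==⇒≡ (shape vs) μ (proj₂ (∧-elim {isRPP λ′ (α ∷ʳ k) vs} u)))))))
      (ind-true (∧-intro t (==-refl (shape vs))))))

  rppCount-[] : ∀ {λ′} → IsPartition λ′ → rppCount λ′ [] ≡ ind (λ′ == [])
  rppCount-[] {[]}         p = refl
  rppCount-[] {zero ∷ λ′}  p with () ← head-pos p
  rppCount-[] {suc a ∷ λ′} p = refl

  -- The largest entry has the last exponent of a weight but comes first in `chains`. The reversal
  -- is undone by symmetry in `rppCount-chains`.
  rppCount-reverse : ∀ {λ′} → IsPartition λ′ → ∀ α → rppCount λ′ (reverse α) ≡ chains α λ′
  rppCount-reverse p []      = rppCount-[] p
  rppCount-reverse {λ′} p (k ∷ α) = begin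
    rppCount λ′ (reverse (k ∷ α))  ≡⟨ cong (rppCount λ′) (List.unfold-reverse k α) ⟩
    rppCount λ′ (reverse α ∷ʳ k)   ≡⟨ rppCount-∷ʳ p (reverse α) k ⟩
    ∑ (subpartitions λ′) (λ μ → ind (skewCols λ′ μ ≡ᵇ k) * rppCount μ (reverse α))
      ≡⟨ ∑-cong (subpartitions λ′) (λ μ μ∈ → cong (ind (skewCols λ′ μ ≡ᵇ k) *_) (rppCount-reverse (proj₁ (∈-sub⁻ {λ′} μ∈)) α)) ⟩
    chains (k ∷ α) λ′ ∎
    where open ≡-Reasoning

  rppCount-chains : ∀ {λ′} → IsPartition λ′ → ∀ α → rppCount λ′ α ≡ chains α λ′
  rppCount-chains {λ′} p α = begin
    rppCount λ′ α                     ≡⟨ cong (rppCount λ′) (List.reverse-involutive α) ⟨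
    rppCount λ′ (reverse (reverse α)) ≡⟨ rppCount-reverse p (reverse α) ⟩
    chains (reverse α) λ′             ≡⟨ chains-↭ p (↭-reverse α) ⟩
    chains α λ′                       ∎
    where open ≡-Reasoning

  -- Kostka numbers

  ∑-ind≤ : ∀ n (p : ℕ → Bool) → ∑ (upTo n) (ind ∘ p) ≤ n
  ∑-ind≤ zero    p = z≤n
  ∑-ind≤ (suc n) p = ℕ.≤-trans (ℕ.≤-reflexive (∑-upTo-shift n (ind ∘ p))) (ℕ.+-mono-≤ (ind≤1 (p 0)) (∑-ind≤ n (p ∘ suc)))

  ∑-const-1 : ∀ n → ∑ (upTo n) (λ _ → 1) ≡ n
  ∑-const-1 zero    = refl
  ∑-const-1 (suc n) = ≡.trans (∑-upTo-shift n (λ _ → 1)) (cong suc (∑-const-1 n))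

  -- A layer has at least as many boxes as columns, so a shape with too few boxes cannot use up the
  -- weight.
  chains-vanish : ∀ α {λ′} → IsPartition λ′ → size λ′ < size α → chains α λ′ ≡ 0
  chains-vanish (k ∷ α) {λ′} p lt = ∑-zero (subpartitions λ′) (λ μ μ∈ → step μ (∈-sub⁻ {λ′} μ∈))
    where
    step : ∀ μ → IsPartition μ × T (contained μ λ′) → ind (skewCols λ′ μ ≡ᵇ k) * chains α μ ≡ 0
    step μ (q , c) with skewCols λ′ μ ℕ.≟ k
    ... | no ≢k = ind-*-zero (λ t → ≢k (ℕ.≡ᵇ⇒≡ _ k t))
    ... | yes refl = ≡.trans (cong (ind (skewCols λ′ μ ≡ᵇ skewCols λ′ μ) *_) (chains-vanish α q
      (ℕ.+-cancelˡ-< (skewCols λ′ μ) _ _ (ℕ.≤-<-trans (skewCols+size≤ q p c) lt)))) (ℕ.*-zeroʳ (ind (skewCols λ′ μ ≡ᵇ skewCols λ′ μ)))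

  chains-head-< : ∀ {b} α λ′ → headOr0 λ′ < b → chains (b ∷ α) λ′ ≡ 0
  chains-head-< {b} α λ′ lt = ∑-zero (subpartitions λ′) (λ μ _ → ind-*-zero (λ t →
    ℕ.<⇒≱ lt (subst (_≤ headOr0 λ′) (ℕ.≡ᵇ⇒≡ (skewCols λ′ μ) b t) (∑-ind≤ (headOr0 λ′) _))))

  col-cons : ∀ {a j} l → j < a → col (a ∷ l) j ≡ suc (col l j)
  col-cons {a} {j} l p = cong (_+ col l j) (ind-<-one p)

  -- Only the removal of the bottom box of every column of a ∷ ν contributes.
  chains-head-≡ : ∀ {a} α {ν} → IsPartition (a ∷ ν) → size α ≡ size ν → chains (a ∷ α) (a ∷ ν) ≡ chains α ν
  chains-head-≡ {a} α {ν} p e = ≡.trans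
    (∑-single (sub-Unique (a ∷ ν)) ν∈ others)
    (ind-*-one (ℕ.≡⇒≡ᵇ (skewCols (a ∷ ν) ν) a full))
    where
    q = tail-partition p
    ν∈ : ν ∈ subpartitions (a ∷ ν)
    ν∈ = ∈-sub⁺ {a ∷ ν} q (row⇒contained {λ′ = a ∷ ν} q (row-suc p))
    full : skewCols (a ∷ ν) ν ≡ a
    full = ≡.trans (∑-cong (upTo a) (λ j j∈ → ind-true (ℕ.<⇒<ᵇ
      (ℕ.≤-reflexive (≡.sym (col-cons ν (∈-upTo⁻ j∈))))))) (∑-const-1 a)
    others : ∀ μ → μ ∈ subpartitions (a ∷ ν) → μ ≢ ν → ind (skewCols (a ∷ ν) μ ≡ᵇ a) * chains α μ ≡ 0
    others μ μ∈ μ≢ν with skewCols (a ∷ ν) μ ℕ.≟ a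
    ... | no ≢a = ind-*-zero (≢a ∘ ℕ.≡ᵇ⇒≡ _ a)
    ... | yes ≡a = ≡.trans (cong (ind (skewCols (a ∷ ν) μ ≡ᵇ a) *_) (chains-vanish α r smaller)) (ℕ.*-zeroʳ (ind (skewCols (a ∷ ν) μ ≡ᵇ a)))
      where
      r = proj₁ (∈-sub⁻ {a ∷ ν} μ∈)
      -- There are `a` indicators and their sum is `a`, so every column loses a box and `μ` lies
      -- inside `ν`. Being different from `ν`, it has too few boxes for `α`.
      all-one : ∀ j → j < a → ind (col μ j <ᵇ col (a ∷ ν) j) ≡ 1
      all-one j j< = ∑-≡⇒≡ (upTo a) {g = λ _ → 1} (λ j _ → ind≤1 _)
        (ℕ.≤-reflexive (≡.trans (∑-const-1 a) (≡.sym ≡a))) j (∈-upTo⁺ j<)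
      col≤ : ∀ j → col μ j ≤ col ν j
      col≤ j with j <? a
      ... | no j≮ = ℕ.≤-trans (contained⇒col r p (proj₂ (∈-sub⁻ {a ∷ ν} μ∈)) j)
        (ℕ.≤-trans (ℕ.≤-reflexive (col-zero (decreasing p) (ℕ.≮⇒≥ j≮))) z≤n)
      ... | yes j< with col μ j <? col (a ∷ ν) j
      ...   | yes lt = ℕ.≤-pred (subst (col μ j <_) (col-cons ν j<) lt)
      ...   | no ≮ with () ← ≡.trans (≡.sym (ind-<-zero (ℕ.≮⇒≥ ≮))) (all-one j j<)
      μ⊆ν : T (contained μ ν)
      μ⊆ν = col⇒contained r q col≤
      smaller : size μ < size α
      smaller = ℕ.≤∧≢⇒< (ℕ.≤-trans (contained⇒size μ ν μ⊆ν) (ℕ.≤-reflexive (≡.sym e)))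
        (λ s → μ≢ν (contained-size-≡ μ q μ⊆ν (ℕ.≤-reflexive (≡.trans (≡.sym e) (≡.sym s)))))

  -- Equal first parts are stripped off together; at the first difference the weight asks for more
  -- columns than the shape has. This is the triangularity of the Kostka matrix.
  chains-triangular : ∀ {λ′ ν} → IsPartition λ′ → IsPartition ν → size λ′ ≡ size ν → λ′ ≻ ν → chains λ′ ν ≡ 0
  chains-triangular p q e (here {a} {b} {l} {m} b<a) = chains-head-< l (b ∷ m) b<a
  chains-triangular p q e (there {a} {l} {m} r) = ≡.trans (chains-head-≡ l q e′)
    (chains-triangular (tail-partition p) (tail-partition q) e′ r)
    where e′ = ℕ.+-cancelˡ-≡ a (size l) (size m) e

  chains-diagonal : ∀ {λ′} → IsPartition λ′ → chains λ′ λ′ ≡ 1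
  chains-diagonal {[]}    p = refl
  chains-diagonal {a ∷ l} p = ≡.trans (chains-head-≡ l p refl) (chains-diagonal (tail-partition p))

  -- Semistandard tableaux as reverse plane partitions of top degree.

  multiplicity : List ℕ → (ℕ → ℕ → ℕ) → ℕ → ℕ → ℕ
  multiplicity λ′ f i c = ∑ (upTo (col λ′ c)) (λ r → ind (f r c ≡ᵇ i))

  -- Boxes are listed by rows, but repetitions are to be counted within columns. The row offset `s`
  -- is general for the sake of the induction.
  boxes-∑ : ∀ {λ′} → IsPartition λ′ → ∀ s h (φ : ℕ × ℕ → ℕ) → headOr0 λ′ ≤ h →
    ∑ (boxesFrom s λ′) φ ≡ ∑ (upTo h) (λ c → ∑ (upTo (col λ′ c)) (λ r → φ (s + r , c)))
  boxes-∑ {[]}    p s h φ le = ≡.sym (∑-zero (upTo h) (λ _ _ → refl))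
  boxes-∑ {a ∷ l} p s h φ le = begin
    ∑ (map (s ,_) (upTo a) ++ boxesFrom (suc s) l) φ
      ≡⟨ ∑-++ (map (s ,_) (upTo a)) (boxesFrom (suc s) l) φ ⟩
    ∑ (map (s ,_) (upTo a)) φ + ∑ (boxesFrom (suc s) l) φ
      ≡⟨ cong₂ _+_ (≡.trans (∑-map (s ,_) (upTo a) φ) first) (boxes-∑ (tail-partition p) (suc s) h φ (ℕ.≤-trans (tail-head p) le)) ⟩
    ∑ (upTo h) (λ c → ind (c <ᵇ a) * φ (s , c)) + ∑ (upTo h) (λ c → ∑ (upTo (col l c)) (λ r → φ (suc s + r , c)))
      ≡⟨ ∑-+ (upTo h) _ _ ⟨
    ∑ (upTo h) (λ c → ind (c <ᵇ a) * φ (s , c) + ∑ (upTo (col l c)) (λ r → φ (suc s + r , c)))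
      ≡⟨ ∑-cong (upTo h) (λ c _ → inner c) ⟩
    ∑ (upTo h) (λ c → ∑ (upTo (col (a ∷ l) c)) (λ r → φ (s + r , c))) ∎
    where
    open ≡-Reasoning
    first : ∑ (upTo a) (λ c → φ (s , c)) ≡ ∑ (upTo h) (λ c → ind (c <ᵇ a) * φ (s , c))
    first = ≡.sym (≡.trans (∑-upTo-extend _ le (λ c c≥ → ind-*-zero (λ t → ℕ.<⇒≱ (ℕ.<ᵇ⇒< c a t) c≥)))
      (∑-cong (upTo a) (λ c c∈ → ind-*-one (ℕ.<⇒<ᵇ (∈-upTo⁻ c∈)))))
    inner : ∀ c → ind (c <ᵇ a) * φ (s , c) + ∑ (upTo (col l c)) (λ r → φ (suc s + r , c))
                ≡ ∑ (upTo (col (a ∷ l) c)) (λ r → φ (s + r , c))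
    inner c with c <? a
    ... | yes c<a = begin
      ind (c <ᵇ a) * φ (s , c) + ∑ (upTo (col l c)) (λ r → φ (suc s + r , c))
        ≡⟨ cong₂ _+_ (≡.trans (ind-*-one (ℕ.<⇒<ᵇ c<a)) (cong (λ z → φ (z , c)) (≡.sym (ℕ.+-identityʳ s))))
             (∑-cong (upTo (col l c)) (λ r _ → cong (λ z → φ (z , c)) (≡.sym (ℕ.+-suc s r)))) ⟩
      φ (s + 0 , c) + ∑ (upTo (col l c)) (λ r → φ (s + suc r , c))
        ≡⟨ ∑-upTo-shift (col l c) (λ r → φ (s + r , c)) ⟨
      ∑ (upTo (suc (col l c))) (λ r → φ (s + r , c))
        ≡⟨ cong (λ n → ∑ (upTo n) (λ r → φ (s + r , c))) (col-cons l c<a) ⟨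
      ∑ (upTo (col (a ∷ l) c)) (λ r → φ (s + r , c)) ∎
    ... | no c≮a = ≡.trans
      (cong₂ _+_ (ind-*-zero (c≮a ∘ ℕ.<ᵇ⇒< c a)) (cong (λ n → ∑ (upTo n) (λ r → φ (suc s + r , c))) l-zero))
      (cong (λ n → ∑ (upTo n) (λ r → φ (s + r , c))) (≡.sym (col-zero (decreasing p) (ℕ.≮⇒≥ c≮a))))
      where
      l-zero : col l c ≡ 0
      l-zero = col-zero (decreasing (tail-partition p)) (ℕ.≤-trans (tail-head p) (ℕ.≮⇒≥ c≮a))

  module _ {λ′} (λ-part : IsPartition λ′) (f : ℕ → ℕ → ℕ) where
    private
      F = fill λ′ f
      h = headOr0 λ′

    entryCount-∑ : ∀ i → entryCount F i ≡ ∑ (upTo h) (multiplicity λ′ f i)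
    entryCount-∑ i = begin
      entryCount F i                                  ≡⟨ count-∑ _ F ⟩
      ∑ F _                                           ≡⟨ ∑-map (λ b → b , uncurry f b) (boxes λ′) _ ⟩
      ∑ (boxes λ′) (λ b → ind (uncurry f b ≡ᵇ i))     ≡⟨ boxes-∑ λ-part 0 h (λ b → ind (uncurry f b ≡ᵇ i)) ℕ.≤-refl ⟩
      ∑ (upTo h) (multiplicity λ′ f i)                ∎
      where open ≡-Reasoning

    hasEntry≤multiplicity : ∀ i c → ind (hasEntry F i c) ≤ multiplicity λ′ f i c
    hasEntry≤multiplicity i c with T? (hasEntry F i c)
    ... | no ¬t = ℕ.≤-trans (ℕ.≤-reflexive (ind-false ¬t)) z≤n
    ... | yes t with r , c< , e ← hasEntry⁻ {λ′} {f} {i} {c} t = ℕ.≤-trans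
      (ℕ.≤-reflexive (≡.trans (ind-true t) (≡.sym (ind-true (ℕ.≡⇒≡ᵇ (f r c) i e)))))
      (∈-∑-≤ (λ r → ind (f r c ≡ᵇ i)) (∈-upTo⁺ (<row⇒<col (decreasing λ-part) c<)))

    colCount≤entryCount : ∀ i → colCount λ′ F i ≤ entryCount F i
    colCount≤entryCount i = begin
      colCount λ′ F i                               ≡⟨ colCount-∑ λ′ F i ⟩
      ∑ (upTo h) (λ c → ind (hasEntry F i c))       ≤⟨ ∑-mono (upTo h) (λ c _ → hasEntry≤multiplicity i c) ⟩
      ∑ (upTo h) (multiplicity λ′ f i)              ≡⟨ entryCount-∑ i ⟨
      entryCount F i                                ∎
      where open ℕ.≤-Reasoning

    strict-< : Monotone true λ′ f → ∀ {c} r r′ → r < r′ → c < row λ′ r′ → f r c < f r′ c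
    strict-< m {c} r (suc r′) (s≤s r≤r′) c< with ℕ.m≤n⇒m<n∨m≡n r≤r′
    ... | inj₂ refl = proj₂ (m r c (ℕ.≤-trans c< (row-suc λ-part r))) c<
    ... | inj₁ r<r′ = ℕ.<-trans (strict-< m r r′ r<r′ c<′) (proj₂ (m r′ c c<′) c<)
      where c<′ = ℕ.≤-trans c< (row-suc λ-part r′)

    strict⇒multiplicity : Monotone true λ′ f → ∀ i c → multiplicity λ′ f i c ≡ ind (hasEntry F i c)
    strict⇒multiplicity m i c with T? (hasEntry F i c)
    ... | no ¬t = ≡.trans (∑-zero (upTo (col λ′ c)) (λ r r∈ → ind-false (λ t →
        ¬t (hasEntry⁺ {λ′} {f} (<col⇒<row (decreasing λ-part) (∈-upTo⁻ r∈)) (ℕ.≡ᵇ⇒≡ (f r c) i t)))))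
      (≡.sym (ind-false ¬t))
    ... | yes t with r , c< , e ← hasEntry⁻ {λ′} {f} {i} {c} t = ≡.trans
      (∑-single (Unique.upTo⁺ (col λ′ c)) (∈-upTo⁺ (<row⇒<col (decreasing λ-part) c<)) (λ r′ r′∈ r′≢ → ind-false (λ t′ →
        distinct r′ (<col⇒<row (decreasing λ-part) (∈-upTo⁻ r′∈)) r′≢ (≡.trans (ℕ.≡ᵇ⇒≡ (f r′ c) i t′) (≡.sym e)))))
      (≡.trans (ind-true (ℕ.≡⇒≡ᵇ (f r c) i e)) (≡.sym (ind-true t)))
      where
      distinct : ∀ r′ → c < row λ′ r′ → r′ ≢ r → f r′ c ≢ f r c
      distinct r′ c<′ r′≢ eq with ℕ.<-cmp r′ r
      ... | tri< lt _ _ = ℕ.<-irrefl eq (strict-< m r′ r lt c<)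
      ... | tri≈ _ r≡ _ = r′≢ r≡
      ... | tri> _ _ gt = ℕ.<-irrefl (≡.sym eq) (strict-< m r r′ gt c<′)

    strict⇒colCount : Monotone true λ′ f → ∀ i → colCount λ′ F i ≡ entryCount F i
    strict⇒colCount m i = ≡.trans (colCount-∑ λ′ F i)
      (≡.trans (∑-cong (upTo h) (λ c _ → ≡.sym (strict⇒multiplicity m i c))) (≡.sym (entryCount-∑ i)))

    multiplicity-two : ∀ {r c} → c < row λ′ (suc r) → f r c ≡ f (suc r) c → 2 ≤ multiplicity λ′ f (f r c) c
    multiplicity-two {r} {c} c< e = begin
      1 + 1                                     ≡⟨ cong₂ _+_ (ind-true (ℕ.≡⇒≡ᵇ (f r c) (f r c) refl)) (ind-true (ℕ.≡⇒≡ᵇ (f (suc r) c) (f r c) (≡.sym e))) ⟨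
      g r + g (suc r)                           ≤⟨ ℕ.+-monoˡ-≤ (g (suc r)) (ℕ.m≤n+m (g r) _) ⟩
      ∑ (upTo r) g + g r + g (suc r)            ≡⟨ cong (_+ g (suc r)) (∑-upTo-suc r g) ⟨
      ∑ (upTo (suc r)) g + g (suc r)            ≡⟨ ∑-upTo-suc (suc r) g ⟨
      ∑ (upTo (suc (suc r))) g                  ≤⟨ grow (col λ′ c) (<row⇒<col (decreasing λ-part) c<) ⟩
      ∑ (upTo (col λ′ c)) g                     ∎
      where
      open ℕ.≤-Reasoning
      g : ℕ → ℕ
      g r′ = ind (f r′ c ≡ᵇ f r c)
      grow : ∀ n → suc r < n → ∑ (upTo (suc (suc r))) g ≤ ∑ (upTo n) g
      grow (suc n) (s≤s lt) with ℕ.m≤n⇒m<n∨m≡n lt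
      ... | inj₂ refl = ℕ.≤-refl
      ... | inj₁ lt′ = ℕ.≤-trans (grow n lt′) (ℕ.≤-trans (ℕ.m≤m+n _ (g n)) (ℕ.≤-reflexive (≡.sym (∑-upTo-suc n g))))

    multiplicity⇒strict : Monotone false λ′ f → (∀ r c → c < row λ′ r → multiplicity λ′ f (f r c) c ≤ 1) → Monotone true λ′ f
    multiplicity⇒strict m le r c p = proj₁ (m r c p) , λ q →
      ℕ.≤∧≢⇒< (proj₂ (m r c p) q) (λ e → ℕ.<⇒≱ (multiplicity-two q e) (le r c p))

    strict⇒weak : Monotone true λ′ f → Monotone false λ′ f
    strict⇒weak m r c p = proj₁ (m r c p) , (λ q → ℕ.<⇒≤ (proj₂ (m r c p) q))

    total-entries : ∀ m → (∀ r c → c < row λ′ r → 1 ≤ f r c × f r c ≤ m) →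
                    ∑ (upTo m) (λ i → entryCount F (suc i)) ≡ size λ′
    total-entries m b = begin
      ∑ (upTo m) (λ i → entryCount F (suc i))
        ≡⟨ ∑-cong (upTo m) (λ i _ → ≡.trans (count-∑ _ F) (∑-map (λ b → b , uncurry f b) (boxes λ′) _)) ⟩
      ∑ (upTo m) (λ i → ∑ (boxes λ′) (λ b → ind (uncurry f b ≡ᵇ suc i)))
        ≡⟨ ∑-swap (upTo m) (boxes λ′) (λ i b → ind (uncurry f b ≡ᵇ suc i)) ⟩
      ∑ (boxes λ′) (λ b → ∑ (upTo m) (λ i → ind (uncurry f b ≡ᵇ suc i)))
        ≡⟨ ∑-cong (boxes λ′) one ⟩
      ∑ (boxes λ′) (λ _ → 1)
        ≡⟨ boxes-∑ λ-part 0 h (λ _ → 1) ℕ.≤-refl ⟩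
      ∑ (upTo h) (λ c → ∑ (upTo (col λ′ c)) (λ _ → 1))
        ≡⟨ ∑-cong (upTo h) (λ c _ → ∑-const-1 (col λ′ c)) ⟩
      ∑ (upTo h) (col λ′)
        ≡⟨ size-col λ-part h ℕ.≤-refl ⟨
      size λ′ ∎
      where
      open ≡-Reasoning
      one : ∀ b → b ∈ boxes λ′ → ∑ (upTo m) (λ i → ind (uncurry f b ≡ᵇ suc i)) ≡ 1
      one (r , c) b∈ with f r c | b r c (∈-boxes⁻ λ′ b∈)
      ... | suc v | _ , v<m = ≡.trans (∑-single (Unique.upTo⁺ m) (∈-upTo⁺ v<m)
          (λ i _ i≢ → ind-false (λ t → i≢ (≡.sym (ℕ.≡ᵇ⇒≡ v i t)))))
        (ind-true (ℕ.≡⇒≡ᵇ v v refl))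

    -- `colCount` is at most `entryCount`, and the entry counts also add up to `size λ′`. So the two
    -- agree for each value, which means that no value repeats in a column.
    colCount⇒strict : ∀ m → (∀ r c → c < row λ′ r → 1 ≤ f r c × f r c ≤ m) → Monotone false λ′ f →
                      ∑ (upTo m) (λ i → colCount λ′ F (suc i)) ≡ size λ′ → Monotone true λ′ f
    colCount⇒strict m b mono e = multiplicity⇒strict mono bound
      where
      equal : ∀ i → i < m → colCount λ′ F (suc i) ≡ entryCount F (suc i)
      equal i i< = ∑-≡⇒≡ (upTo m) (λ i _ → colCount≤entryCount (suc i))
        (ℕ.≤-reflexive (≡.trans (total-entries m b) (≡.sym e))) i (∈-upTo⁺ i<)
      bound : ∀ r c → c < row λ′ r → multiplicity λ′ f (f r c) c ≤ 1
      bound r c c< with f r c | b r c c<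
      ... | suc v | _ , v<m = subst (_≤ 1)
        (∑-≡⇒≡ (upTo h) (λ c _ → hasEntry≤multiplicity (suc v) c)
          (ℕ.≤-reflexive (≡.trans (≡.sym (entryCount-∑ (suc v))) (≡.trans (≡.sym (equal v v<m)) (colCount-∑ λ′ F (suc v)))))
          c (∈-upTo⁺ (ℕ.≤-trans c< (row≤head (decreasing λ-part) r))))
        (ind≤1 (hasEntry F (suc v) c))

  entryCounts : Filling → ℕ → List ℕ
  entryCounts F l = map (entryCount F) (map suc (upTo l))

  isSSYT : List ℕ → List ℕ → List ℕ → Bool
  isSSYT λ′ ν vs = monotone true (zip (boxes λ′) vs) ∧ (entryCounts (zip (boxes λ′) vs) (length ν) == ν)

  -- With as many units of weight as boxes, no column of a reverse plane partition can repeat an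
  -- entry, and for strict columns the two ways of counting entries coincide.
  kostka-rppCount : ∀ {λ′} ν → IsPartition λ′ → size ν ≡ size λ′ → kostka λ′ ν ≡ rppCount λ′ ν
  kostka-rppCount {λ′} ν λ-part e = begin
    kostka λ′ ν                     ≡⟨ count-∑ _ (fillingsOf λ′ (length ν)) ⟩
    ∑ (fillingsOf λ′ (length ν)) _  ≡⟨ ∑-map (zip (boxes λ′)) vls _ ⟩
    ∑ vls (ind ∘ isSSYT λ′ ν)       ≡⟨ ∑-cong vls (λ vs vs∈ → same vs (∈-valueLists⁻ (size λ′) vs∈)) ⟩
    ∑ vls (ind ∘ isRPP λ′ ν)        ≡⟨ rppCount-∑ λ′ ν ⟨
    rppCount λ′ ν                   ∎
    where
    open ≡-Reasoning
    m = length ν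
    vls = valueLists m (size λ′)
    counts≡ : ∀ f → Monotone true λ′ f → colCounts λ′ (fill λ′ f) m ≡ entryCounts (fill λ′ f) m
    counts≡ f strict = List.map-cong (strict⇒colCount λ-part f strict) (map suc (upTo m))
    same : ∀ vs → ValueList m (size λ′) vs → ind (isSSYT λ′ ν vs) ≡ ind (isRPP λ′ ν vs)
    same vs vl = subst (λ F → ind (monotone true F ∧ (entryCounts F m == ν)) ≡ ind (monotone false F ∧ (colCounts λ′ F m == ν)))
      (≡.sym (zip-entry {λ′} (proj₁ vl))) (ind-cong to from)
      where
      f = entry λ′ vs
      F = fill λ′ f
      to : T (monotone true F ∧ (entryCounts F m == ν)) → T (monotone false F ∧ (colCounts λ′ F m == ν))
      to t = ∧-intro (monotone⁺ false λ′ (strict⇒weak λ-part f strict))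
        (≡⇒== (≡.trans (counts≡ f strict) (==⇒≡ _ ν (proj₂ (∧-elim {monotone true F} t)))))
        where strict = monotone⁻ true λ′ (proj₁ (∧-elim t))
      from : T (monotone false F ∧ (colCounts λ′ F m == ν)) → T (monotone true F ∧ (entryCounts F m == ν))
      from t = ∧-intro (monotone⁺ true λ′ strict) (≡⇒== (≡.trans (≡.sym (counts≡ f strict)) counts))
        where
        counts : colCounts λ′ F m ≡ ν
        counts = ==⇒≡ _ ν (proj₂ (∧-elim {monotone false F} t))
        strict : Monotone true λ′ f
        strict = colCount⇒strict λ-part f m (λ r c c< → entry-bounds {m} {λ′} vl c<) (monotone⁻ false λ′ (proj₁ (∧-elim t)))
          (begin
            ∑ (upTo m) (λ i → colCount λ′ F (suc i)) ≡⟨ ∑-map suc (upTo m) (colCount λ′ F) ⟨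
            foldr _+_ 0 (colCounts λ′ F m)           ≡⟨ cong size counts ⟩
            size ν                                   ≡⟨ e ⟩
            size λ′                                  ∎)

  -- Inserting a part; horizontal strips

  col-↭ : ∀ {xs ys} → xs ↭ ys → ∀ j → col xs j ≡ col ys j
  col-↭ refl         j = refl
  col-↭ (prep x p)   j = cong (ind (j <ᵇ x) +_) (col-↭ p j)
  col-↭ (swap {xs} {ys} x y p) j = begin
    u + (v + col xs j) ≡⟨ ℕ.+-assoc u v _ ⟨
    u + v + col xs j   ≡⟨ cong₂ _+_ (ℕ.+-comm u v) (col-↭ p j) ⟩
    v + u + col ys j   ≡⟨ ℕ.+-assoc v u _ ⟩
    v + (u + col ys j) ∎
    where
    open ≡-Reasoning
    u v : ℕ
    u = ind (j <ᵇ x)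
    v = ind (j <ᵇ y)
  col-↭ (trans p q)  j = ≡.trans (col-↭ p j) (col-↭ q j)

  -- Column heights do not depend on the order of the parts. This spares following `merge` through
  -- its comparisons.
  ↭⇒≡ : ∀ {λ′ μ} → IsPartition λ′ → IsPartition μ → λ′ ↭ μ → λ′ ≡ μ
  ↭⇒≡ p q r = col-ext p q (col-↭ r)

  if-elim : ∀ {A : Set} (P : A → Set) {y z} x → (T x → P y) → (¬ T x → P z) → P (if x then y else z)
  if-elim P true  p q = p tt
  if-elim P false p q = q id

  merge-↭ : ∀ μ ν → merge μ ν ↭ μ ++ ν
  merge-↭ []      ν       = ↭-refl
  merge-↭ (a ∷ μ) []      = ↭-reflexive (≡.sym (List.++-identityʳ (a ∷ μ)))
  merge-↭ (a ∷ μ) (b ∷ ν) = if-elim (_↭ a ∷ μ ++ b ∷ ν) (b ≤ᵇ a)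
    (λ _ → prep a (merge-↭ μ (b ∷ ν)))
    (λ _ → ↭-trans (prep b (merge-↭ (a ∷ μ) ν)) (↭-sym (shift b (a ∷ μ) ν)))

  merge-head : ∀ μ ν {n} → headOr0 μ ≤ n → headOr0 ν ≤ n → headOr0 (merge μ ν) ≤ n
  merge-head []      ν       p q = q
  merge-head (a ∷ μ) []      p q = p
  merge-head (a ∷ μ) (b ∷ ν) p q with b ≤ᵇ a
  ... | true  = p
  ... | false = q

  merge-partition : ∀ {μ ν} → IsPartition μ → IsPartition ν → IsPartition (merge μ ν)
  merge-partition {[]}    {ν}     p q = q
  merge-partition {a ∷ μ} {[]}    p q = p
  merge-partition {a ∷ μ} {b ∷ ν} p q = if-elim IsPartition (b ≤ᵇ a)
    (λ t → cons-partition (head-pos p)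
      (merge-head μ (b ∷ ν) (tail-head p) (ℕ.≤ᵇ⇒≤ b a t)) (merge-partition (tail-partition p) q))
    (λ ¬t → cons-partition (head-pos q)
      (merge-head (a ∷ μ) ν (ℕ.<⇒≤ (ℕ.≰⇒> (¬t ∘ ℕ.≤⇒≤ᵇ))) (tail-head q)) (merge-partition p (tail-partition q)))

  size-merge : ∀ μ ν → size (merge μ ν) ≡ size μ + size ν
  size-merge μ ν = ≡.trans (sum-↭ (merge-↭ μ ν)) (sum-++ μ ν)

  -- The case 0 is the exponent 0 of the new variable, which leaves no part behind.
  insert : ℕ → List ℕ → List ℕ
  insert zero    μ = μ
  insert (suc k) μ = merge (suc k ∷ []) μ

  insert-partition : ∀ k {μ} → IsPartition μ → IsPartition (insert k μ)
  insert-partition zero    p = p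
  insert-partition (suc k) p = merge-partition [ s≤s z≤n ] p

  size-insert : ∀ k μ → size (insert k μ) ≡ k + size μ
  size-insert zero    μ = refl
  size-insert (suc k) μ = ≡.trans (size-merge (suc k ∷ []) μ) (cong (_+ size μ) (ℕ.+-identityʳ (suc k)))

  -- In `f(1, x, y)` the variable set to 1 may be counted with `x`. `insert-mergeʳ` counts it with
  -- `y`, as required when `I` is applied after `E-1 ⊥`.
  insert-mergeˡ : ∀ k {μ ν} → IsPartition μ → IsPartition ν → insert k (merge μ ν) ≡ merge (insert k μ) ν
  insert-mergeˡ zero    p q = refl
  insert-mergeˡ (suc k) {μ} {ν} p q = ↭⇒≡
    (insert-partition (suc k) (merge-partition p q))
    (merge-partition (insert-partition (suc k) p) q)
    (↭-trans (merge-↭ (suc k ∷ []) (merge μ ν)) (↭-trans (prep (suc k) (merge-↭ μ ν))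
      (↭-sym (↭-trans (merge-↭ (insert (suc k) μ) ν) (++⁺ʳ ν (merge-↭ (suc k ∷ []) μ))))))

  insert-mergeʳ : ∀ k {μ ν} → IsPartition μ → IsPartition ν → insert k (merge μ ν) ≡ merge μ (insert k ν)
  insert-mergeʳ zero    p q = refl
  insert-mergeʳ (suc k) {μ} {ν} p q = ↭⇒≡
    (insert-partition (suc k) (merge-partition p q))
    (merge-partition p (insert-partition (suc k) q))
    (↭-trans (merge-↭ (suc k ∷ []) (merge μ ν)) (↭-trans (prep (suc k) (merge-↭ μ ν))
      (↭-sym (↭-trans (merge-↭ μ (insert (suc k) ν)) (↭-trans (++⁺ˡ μ (merge-↭ (suc k ∷ []) ν)) (shift (suc k) μ ν))))))

  ∑-zero⁻ : ∀ (xs : List ℕ) f → ∑ xs f ≡ 0 → ∀ x → x ∈ xs → f x ≡ 0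
  ∑-zero⁻ xs f e x x∈ = ℕ.n≤0⇒n≡0 (ℕ.≤-trans (∈-∑-≤ f x∈) (ℕ.≤-reflexive e))

  skewCols-self : ∀ λ′ → skewCols λ′ λ′ ≡ 0
  skewCols-self λ′ = ∑-zero (upTo (headOr0 λ′)) (λ j _ → ind-<-zero {col λ′ j} ℕ.≤-refl)

  skewCols-zero : ∀ {λ′ μ} → IsPartition λ′ → IsPartition μ → T (contained μ λ′) → skewCols λ′ μ ≡ 0 → μ ≡ λ′
  skewCols-zero {λ′} {μ} p q c e = contained-size-≡ μ p c (contained⇒size λ′ μ (col⇒contained p q col≤))
    where
    col≤ : ∀ j → col λ′ j ≤ col μ j
    col≤ j with j <? headOr0 λ′
    ... | no j≮ = ℕ.≤-trans (ℕ.≤-reflexive (col-zero (decreasing p) (ℕ.≮⇒≥ j≮))) z≤n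
    ... | yes j< with col μ j <? col λ′ j
    ...   | no ≮ = ℕ.≮⇒≥ ≮
    ...   | yes lt with () ← ≡.trans (≡.sym (ind-<-one lt)) (∑-zero⁻ (upTo (headOr0 λ′)) _ e j (∈-upTo⁺ j<))

  chains-zero : ∀ α {λ′} → IsPartition λ′ → chains (0 ∷ α) λ′ ≡ chains α λ′
  chains-zero α {λ′} p = ≡.trans
    (∑-single (sub-Unique λ′) (self∈sub p) (λ μ μ∈ μ≢ → ind-*-zero (λ t →
      let q , c = ∈-sub⁻ {λ′} μ∈ in μ≢ (skewCols-zero p q c (ℕ.≡ᵇ⇒≡ _ 0 t)))))
    (ind-*-one (ℕ.≡⇒≡ᵇ _ 0 (skewCols-self λ′)))

  -- `insert` leaves the part at its sorted place; symmetry brings it to the front, where it governs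
  -- the outermost layer.
  chains-insert : ∀ k α {λ′} → IsPartition λ′ → chains (insert k α) λ′ ≡ chains (k ∷ α) λ′
  chains-insert zero    α p = ≡.sym (chains-zero α p)
  chains-insert (suc k) α p = chains-↭ p (merge-↭ (suc k ∷ []) α)

  -- Single columns left by removing horizontal strips.

  onlyOnes : List ℕ → Bool
  onlyOnes = allᵇ (λ a → a ≡ᵇ 1)

  ones : ℕ → List ℕ
  ones k = replicate k 1

  onlyOnes⇒ones : ∀ {ν} → T (onlyOnes ν) → ν ≡ ones (length ν)
  onlyOnes⇒ones {[]}    t = refl
  onlyOnes⇒ones {a ∷ ν} t = cong₂ _∷_ (ℕ.≡ᵇ⇒≡ a 1 (proj₁ (∧-elim t))) (onlyOnes⇒ones (proj₂ (∧-elim {a ≡ᵇ 1} t)))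

  onlyOnes-ones : ∀ k → T (onlyOnes (ones k))
  onlyOnes-ones zero    = tt
  onlyOnes-ones (suc k) = onlyOnes-ones k

  size-ones : ∀ k → size (ones k) ≡ k
  size-ones zero    = refl
  size-ones (suc k) = cong suc (size-ones k)

  onlyOnes⇒length : ∀ {ν} → T (onlyOnes ν) → length ν ≡ size ν
  onlyOnes⇒length {ν} t = ≡.trans (≡.sym (size-ones (length ν))) (cong size (≡.sym (onlyOnes⇒ones {ν} t)))

  ones-partition : ∀ k → IsPartition (ones k)
  ones-partition zero          = []
  ones-partition (suc zero)    = [ ℕ.≤-refl ]
  ones-partition (suc (suc k)) = ℕ.≤-refl ∷ ones-partition (suc k)

  ¬onlyOnes⇒head : ∀ {ν} → IsPartition ν → ¬ T (onlyOnes ν) → 1 < headOr0 ν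
  ¬onlyOnes⇒head {[]}    p n = ⊥-elim (n tt)
  ¬onlyOnes⇒head {a ∷ ν} p n with ℕ.m≤n⇒m<n∨m≡n (head-pos p)
  ... | inj₁ lt = lt
  ... | inj₂ refl = ℕ.≤-trans (¬onlyOnes⇒head (tail-partition p) n) (tail-head p)

  onlyOnes-head : ∀ {ν} → T (onlyOnes ν) → headOr0 ν ≤ 1
  onlyOnes-head {[]}    t = z≤n
  onlyOnes-head {a ∷ ν} t = ℕ.≤-reflexive (ℕ.≡ᵇ⇒≡ a 1 (proj₁ (∧-elim t)))

  col-0 : ∀ {l} → IsPartition l → col l 0 ≡ length l
  col-0 {[]}    p = refl
  col-0 {a ∷ l} p = cong₂ _+_ (ind-<-one (head-pos p)) (col-0 (tail-partition p))

  length≤size : ∀ {l} → IsPartition l → length l ≤ size l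
  length≤size {[]}    p = z≤n
  length≤size {a ∷ l} p = ℕ.+-mono-≤ (head-pos p) (length≤size (tail-partition p))

  contained⇒length : ∀ μ λ′ → T (contained μ λ′) → length μ ≤ length λ′
  contained⇒length []      λ′       c = z≤n
  contained⇒length (a ∷ μ) (b ∷ λ′) c = s≤s (contained⇒length μ λ′ (proj₂ (∧-elim {a ≤ᵇ b} c)))

  ones⊆ : ∀ {λ′} k → IsPartition λ′ → k ≤ length λ′ → T (contained (ones k) λ′)
  ones⊆ zero p le = tt
  ones⊆ {a ∷ l} (suc k) p (s≤s le) = ∧-intro (ℕ.≤⇒≤ᵇ (head-pos p)) (ones⊆ k (tail-partition p) le)

  -- `1ᵏ` is empty beyond the first column, so the other `a` columns all count; the first one counts
  -- unless `1ᵏ` fills it.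
  skewCols-ones : ∀ {a l} k → IsPartition (suc a ∷ l) → skewCols (suc a ∷ l) (ones k) ≡ ind (k <ᵇ suc (length l)) + a
  skewCols-ones {a} {l} k p = ≡.trans (∑-upTo-shift a _) (cong₂ _+_
    (cong₂ (λ m n → ind (m <ᵇ n)) (≡.trans (col-0 (ones-partition k)) (List.length-replicate k)) (col-0 p))
    (≡.trans (∑-cong (upTo a) (λ j j∈ → ind-<-one (ℕ.≤-trans
        (s≤s (ℕ.≤-reflexive (col-zero (decreasing (ones-partition k)) (ℕ.≤-trans (onlyOnes-head {ones k} (onlyOnes-ones k)) (s≤s z≤n)))))
        (<row⇒<col (decreasing p) {0} (s≤s (∈-upTo⁻ j∈))))))
      (∑-const-1 a)))

  -- skewCols λ ν + size ν = size λ says that λ/ν is a horizontal strip.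
  isStrip : List ℕ → List ℕ → Bool
  isStrip λ′ ν = skewCols λ′ ν + size ν ≡ᵇ size λ′

  isStrip-ones⁻ : ∀ {a l} k → IsPartition (a ∷ l) → T (isStrip (a ∷ l) (ones k)) → ind (k <ᵇ suc (length l)) + k ≡ suc (size l)
  isStrip-ones⁻ {zero}  k p t with () ← head-pos p
  isStrip-ones⁻ {suc a} {l} k p t = ℕ.+-cancelʳ-≡ a _ _ (begin
    i + k + a               ≡⟨ solve 3 (λ x y z → x :+ y :+ z := x :+ z :+ y) refl i k a ⟩
    i + a + k               ≡⟨ cong₂ _+_ (skewCols-ones k p) (size-ones k) ⟨
    skewCols (suc a ∷ l) (ones k) + size (ones k) ≡⟨ ℕ.≡ᵇ⇒≡ (skewCols (suc a ∷ l) (ones k) + size (ones k)) (size (suc a ∷ l)) t ⟩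
    suc (a + size l)        ≡⟨ cong suc (ℕ.+-comm a (size l)) ⟩
    suc (size l) + a        ∎)
    where
    open ≡-Reasoning
    open +-*-Solver
    i = ind (k <ᵇ suc (length l))

  isStrip-ones⁺ : ∀ {a l} k → IsPartition (a ∷ l) → ind (k <ᵇ suc (length l)) + k ≡ suc (size l) → T (isStrip (a ∷ l) (ones k))
  isStrip-ones⁺ {zero}  k p e with () ← head-pos p
  isStrip-ones⁺ {suc a} {l} k p e = ℕ.≡⇒≡ᵇ (skewCols (suc a ∷ l) (ones k) + size (ones k)) (size (suc a ∷ l)) (begin
    skewCols (suc a ∷ l) (ones k) + size (ones k) ≡⟨ cong₂ _+_ (skewCols-ones k p) (size-ones k) ⟩
    i + a + k               ≡⟨ solve 3 (λ x y z → x :+ y :+ z := y :+ (x :+ z)) refl i a k ⟩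
    a + (i + k)             ≡⟨ cong (a +_) e ⟩
    a + suc (size l)        ≡⟨ ℕ.+-suc a (size l) ⟩
    suc a + size l          ∎)
    where
    open ≡-Reasoning
    open +-*-Solver
    i = ind (k <ᵇ suc (length l))

  -- As parts are positive, `size l ≡ length l` says that `l` consists of ones, so the shape is a
  -- hook. A horizontal strip takes at most one box from the first column, which leaves its full
  -- length or one less.
  strip-ones : ∀ {a l} k → IsPartition (a ∷ l) → k ≤ suc (length l) → T (isStrip (a ∷ l) (ones k)) →
               size l ≡ length l × (k ≡ suc (length l) ⊎ k ≡ length l)
  strip-ones {a} {l} k p le t with ℕ.m≤n⇒m<n∨m≡n le | isStrip-ones⁻ k p t
  ... | inj₂ refl | e = ≡.sym (ℕ.suc-injective (≡.trans (≡.sym (cong (_+ suc (length l)) (ind-<-zero {suc (length l)} ℕ.≤-refl))) e)) , inj₁ refl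
  ... | inj₁ k<   | e with refl ← ℕ.suc-injective (≡.trans (≡.sym (cong (_+ k) (ind-<-one k<))) e)
    with eq ← ℕ.≤-antisym (ℕ.≤-pred k<) (length≤size (tail-partition p)) = eq , inj₂ eq

  strip-ones-full : ∀ {a l} → IsPartition (a ∷ l) → size l ≡ length l → T (isStrip (a ∷ l) (ones (suc (length l))))
  strip-ones-full {a} {l} p e = isStrip-ones⁺ (suc (length l)) p
    (≡.trans (cong (_+ suc (length l)) (ind-<-zero {suc (length l)} ℕ.≤-refl)) (cong suc (≡.sym e)))

  strip-ones-short : ∀ {a l} → IsPartition (a ∷ l) → size l ≡ length l → T (isStrip (a ∷ l) (ones (length l)))
  strip-ones-short {a} {l} p e = isStrip-ones⁺ (length l) p
    (≡.trans (cong (_+ length l) (ind-<-one (ℕ.n<1+n (length l)))) (cong suc (≡.sym e)))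

  AllPairs-split : ∀ {A : Set} {R : A → A → Set} ys {x zs} → AllPairs R (ys ++ x ∷ zs) → All (R x) zs
  AllPairs-split []       (p ∷ _) = p
  AllPairs-split (y ∷ ys) (_ ∷ u) = AllPairs-split ys u

module Invertibility {c ℓ : Level} (R : CommutativeRing c ℓ) where
  open Combinatorics
  open import Level using () renaming (_⊔_ to _⊔ˡ_)
  open import Data.Bool using (Bool; true; false; T; if_then_else_)
  open import Data.Bool.Properties using (T?)
  open import Data.Empty using (⊥-elim)
  open import Data.List using (foldr; foldl; length; _++_)
  import Data.List.Properties as List
  open import Data.List.Membership.Propositional using (_∈_)
  open import Data.List.Membership.Propositional.Properties
  open import Data.List.Relation.Binary.Pointwise using (Pointwise; []; _∷_)
  import Data.List.Relation.Binary.Pointwise as Pointwise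
  open import Data.List.Relation.Unary.All using (All)
  import Data.List.Relation.Unary.All as All
  open import Data.List.Relation.Unary.AllPairs using (AllPairs; []; _∷_)
  open import Data.List.Relation.Unary.Any using (here; there)
  open import Data.List.Relation.Unary.Unique.Propositional using (Unique)
  import Data.List.Relation.Unary.Unique.Propositional.Properties as Unique
  open import Data.Nat as ℕ using (zero; _≤_; _<_; _≡ᵇ_; _≤ᵇ_; z≤n; s≤s; _≤?_)
  import Data.Nat.Properties as ℕ
  open import Data.Product using (_,_; proj₁; proj₂; ∃)
  open import Data.Sum using (inj₁; inj₂)
  open import Data.Unit using (tt)
  open import Function using (_∘_; id)
  open import Relation.Nullary using (¬_; yes; no)
  open import Relation.Binary.Definitions using (tri<; tri≈; tri>)
  open import Relation.Binary.PropositionalEquality as ≡ using (_≡_; _≢_)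

  open CommutativeRing R renaming (Carrier to K)
  open SymFun R
  open import Relation.Binary.Reasoning.Setoid setoid
  open import Algebra.Properties.Ring ring using (-1*x≈-x)
  open import Algebra.Properties.CommutativeSemigroup *-commutativeSemigroup
    using () renaming (x∙yz≈y∙xz to *-swapˡ)
  module Σ = Summation commutativeSemiring

  fromℕ-+ : ∀ m n → fromℕ (m ℕ.+ n) ≈ fromℕ m + fromℕ n
  fromℕ-+ zero    n = sym (+-identityˡ _)
  fromℕ-+ (suc m) n = trans (+-congˡ (fromℕ-+ m n)) (sym (+-assoc _ _ _))

  fromℕ-∑ : ∀ {A : Set} (xs : List A) f → fromℕ (∑ xs f) ≈ Σ.∑ xs (fromℕ ∘ f)
  fromℕ-∑ []       f = refl
  fromℕ-∑ (x ∷ xs) f = trans (fromℕ-+ (f x) (∑ xs f)) (+-congˡ (fromℕ-∑ xs f))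

  fromℕ-ind : ∀ x → fromℕ (ind x) ≈ Σ.ind x
  fromℕ-ind true  = +-identityʳ 1#
  fromℕ-ind false = refl

  fromℕ-ind-* : ∀ x n → fromℕ (ind x ℕ.* n) ≈ Σ.ind x * fromℕ n
  fromℕ-ind-* true  n = trans (reflexive (≡.cong fromℕ (ℕ.+-identityʳ n))) (sym (*-identityˡ _))
  fromℕ-ind-* false n = sym (zeroˡ _)

  x≈y+z⇒x-y≈z : ∀ {x y z} → x ≈ y + z → x - y ≈ z
  x≈y+z⇒x-y≈z {x} {y} {z} e = begin
    x - y           ≈⟨ +-congʳ e ⟩
    y + z - y       ≈⟨ +-congʳ (+-comm y z) ⟩
    z + y - y       ≈⟨ +-assoc z y (- y) ⟩
    z + (y - y)     ≈⟨ +-congˡ (-‿inverseʳ y) ⟩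
    z + 0#          ≈⟨ +-identityʳ z ⟩
    z               ∎

  x-y≈z⇒x≈y+z : ∀ {x y z} → x - y ≈ z → x ≈ y + z
  x-y≈z⇒x≈y+z {x} {y} {z} e = begin
    x               ≈⟨ +-identityʳ x ⟨
    x + 0#          ≈⟨ +-congˡ (-‿inverseˡ y) ⟨
    x + (- y + y)   ≈⟨ +-assoc x (- y) y ⟨
    x - y + y       ≈⟨ +-congʳ e ⟩
    z + y           ≈⟨ +-comm z y ⟩
    y + z           ∎

  -- Schur coefficients as solutions of a unitriangular system.

  kostkaK : List ℕ → List ℕ → K
  kostkaK ν λ′ = fromℕ (kostka ν λ′)

  kostka-chains : ∀ {ν} λ′ → IsPartition ν → size λ′ ≡ size ν → kostkaK ν λ′ ≈ fromℕ (chains λ′ ν)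
  kostka-chains λ′ p e = reflexive (≡.cong fromℕ (≡.trans (kostka-rppCount λ′ p e) (rppCount-chains p λ′)))

  kostka-triangular : ∀ {λ′ ν} → IsPartition λ′ → IsPartition ν → size λ′ ≡ size ν → λ′ ≻ ν → kostkaK ν λ′ ≈ 0#
  kostka-triangular {λ′} p q e r = trans (kostka-chains λ′ q e) (reflexive (≡.cong fromℕ (chains-triangular p q e r)))

  kostka-diagonal : ∀ {λ′} → IsPartition λ′ → kostkaK λ′ λ′ ≈ 1#
  kostka-diagonal {λ′} p = trans (kostka-chains λ′ p ≡.refl)
    (trans (reflexive (≡.cong fromℕ (chains-diagonal p))) (+-identityʳ 1#))

  -- The invariant of the fold in `schurList`: the pairs found so far follow the list of partitions
  -- and carry the values of `a`.
  Solves : (List ℕ → K) → List (List ℕ × K) → List (List ℕ) → Set (c ⊔ˡ ℓ)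
  Solves a = Pointwise (λ p ν → ∃ λ (_ : proj₁ p ≡ ν) → proj₂ p ≈ a ν)

  Solves-∑ : ∀ {a : List ℕ → K} {acc xs} λ′ → Solves a acc xs →
             Σ.∑ acc (λ p → proj₂ p * kostkaK (proj₁ p) λ′) ≈ Σ.∑ xs (λ ν → a ν * kostkaK ν λ′)
  Solves-∑ λ′ []                   = refl
  Solves-∑ λ′ ((≡.refl , e) ∷ s) = +-cong (*-congʳ e) (Solves-∑ λ′ s)

  Solves-lookup : ∀ {a : List ℕ → K} {acc xs λ′} → Solves a acc xs → λ′ ∈ xs → lookupK λ′ acc ≈ a λ′
  Solves-lookup {acc = (ν , v) ∷ acc} {λ′ = λ′} ((≡.refl , e) ∷ s) λ∈ with T? (ν == λ′)
  ... | yes t with ≡.refl ← ==⇒≡ ν λ′ t = trans (reflexive (if-true t)) e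
  Solves-lookup {acc = (ν , v) ∷ acc} {λ′ = λ′} ((≡.refl , e) ∷ s) (here ≡.refl) | no ¬t = ⊥-elim (¬t (==-refl ν))
  Solves-lookup {acc = (ν , v) ∷ acc} {λ′ = λ′} ((≡.refl , e) ∷ s) (there λ∈)    | no ¬t =
    trans (reflexive (if-false ¬t)) (Solves-lookup s λ∈)

  -- Stated for any `step` that appends the value of the recurrence, because the one in `schurList`
  -- is local. The last hypothesis says that `a` obeys the recurrence at every stage.
  Solves-foldl : ∀ {a F : List ℕ → K} (step : List (List ℕ × K) → List ℕ → List (List ℕ × K)) →
    (∀ acc λ′ → ∃ λ v → ∃ λ (_ : step acc λ′ ≡ acc ++ ((λ′ , v) ∷ [])) →
       v ≈ F λ′ - Σ.∑ acc (λ p → proj₂ p * kostkaK (proj₁ p) λ′)) →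
    ∀ xs {acc} pre → Solves a acc pre →
    (∀ ys λ′ zs → xs ≡ ys ++ λ′ ∷ zs → F λ′ - Σ.∑ (pre ++ ys) (λ ν → a ν * kostkaK ν λ′) ≈ a λ′) →
    Solves a (foldl step acc xs) (pre ++ xs)
  Solves-foldl {a} step spec []       pre s h = ≡.subst (Solves a _) (≡.sym (List.++-identityʳ pre)) s
  Solves-foldl {a} {F} step spec (x ∷ xs) {acc} pre s h with v , e , v≈ ← spec acc x =
    ≡.subst₂ (Solves a) (≡.cong (λ acc → foldl step acc xs) (≡.sym e)) (List.++-assoc pre (x ∷ []) xs)
      (Solves-foldl {a} {F} step spec xs (pre ++ (x ∷ [])) (Pointwise.++⁺ s ((≡.refl , value) ∷ [])) rest)
    where
    value : v ≈ a x
    value = begin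
      v ≈⟨ v≈ ⟩
      F x - Σ.∑ acc (λ p → proj₂ p * kostkaK (proj₁ p) x) ≈⟨ +-congˡ (-‿cong (Solves-∑ x s)) ⟩
      F x - Σ.∑ pre (λ ν → a ν * kostkaK ν x) ≡⟨ ≡.cong (λ ys → F x - Σ.∑ ys (λ ν → a ν * kostkaK ν x)) (List.++-identityʳ pre) ⟨
      F x - Σ.∑ (pre ++ []) (λ ν → a ν * kostkaK ν x) ≈⟨ h [] x xs ≡.refl ⟩
      a x ∎
    rest : ∀ ys λ′ zs → xs ≡ ys ++ λ′ ∷ zs → F λ′ - Σ.∑ ((pre ++ (x ∷ [])) ++ ys) (λ ν → a ν * kostkaK ν λ′) ≈ a λ′
    rest ys λ′ zs eq = trans
      (reflexive (≡.cong (λ ys → F λ′ - Σ.∑ ys (λ ν → a ν * kostkaK ν λ′)) (List.++-assoc pre (x ∷ []) ys)))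
      (h (x ∷ ys) λ′ zs (≡.cong (x ∷_) eq))

  -- In the equation at `λ′` the terms after `λ′` vanish by triangularity and the diagonal term is
  -- `a λ′`. So a solution of the system obeys the recurrence that defines `schurList`.
  schurCoeff-unique : ∀ n {F a : List ℕ → K} → (∀ λ′ → λ′ ∈ partitionsOf n → F λ′ ≈ Σ.∑ (partitionsOf n) (λ ν → a ν * kostkaK ν λ′)) →
                      ∀ {λ′} → λ′ ∈ partitionsOf n → schurCoeff F λ′ ≈ a λ′
  schurCoeff-unique n {F} {a} expand {λ′} λ∈ = trans
    (reflexive (≡.cong (λ m → lookupK λ′ (schurList F m)) (proj₂ (∈-partitionsOf⁻ {n} λ∈))))
    (Solves-lookup solution λ∈)
    where
    solved : ∀ ys λ′ zs → partitionsOf n ≡ ys ++ λ′ ∷ zs → F λ′ - Σ.∑ ys (λ ν → a ν * kostkaK ν λ′) ≈ a λ′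
    solved ys λ′ zs eq = x≈y+z⇒x-y≈z (begin
      F λ′ ≈⟨ expand λ′ (member (∈-++⁺ʳ ys (here ≡.refl))) ⟩
      Σ.∑ (partitionsOf n) t ≡⟨ ≡.cong (λ xs → Σ.∑ xs t) eq ⟩
      Σ.∑ (ys ++ λ′ ∷ zs) t ≈⟨ Σ.∑-++ ys (λ′ ∷ zs) t ⟩
      Σ.∑ ys t + (a λ′ * kostkaK λ′ λ′ + Σ.∑ zs t) ≈⟨ +-congˡ (+-cong
        (trans (*-congˡ (kostka-diagonal (proj₁ λp))) (*-identityʳ _))
        (Σ.∑-zero zs (λ ν ν∈ → let ν-part , νs = ∈-partitionsOf⁻ {n} (member (∈-++⁺ʳ ys (there ν∈))) in
          trans (*-congˡ (kostka-triangular (proj₁ λp) ν-part (≡.trans (proj₂ λp) (≡.sym νs)) (All.lookup below ν∈))) (zeroʳ _)))) ⟩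
      Σ.∑ ys t + (a λ′ + 0#) ≈⟨ +-congˡ (+-identityʳ _) ⟩
      Σ.∑ ys t + a λ′ ∎)
      where
      t : List ℕ → K
      t ν = a ν * kostkaK ν λ′
      member : ∀ {ν} → ν ∈ ys ++ λ′ ∷ zs → ν ∈ partitionsOf n
      member = ≡.subst (_ ∈_) (≡.sym eq)
      λp = ∈-partitionsOf⁻ {n} (member (∈-++⁺ʳ ys (here ≡.refl)))
      below : All (λ′ ≻_) zs
      below = AllPairs-split ys (≡.subst (AllPairs _≻_) eq (partitionsOf-decreasing n))

    solution : Solves a (schurList F n) (partitionsOf n)
    solution = Solves-foldl {a} {F} _
      (λ acc λ′ → _ , ≡.refl , +-congˡ (-‿cong (Σ.∑-cong acc (λ { (ν , v) _ → refl }))))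
      (partitionsOf n) [] [] solved

  -- Elimination from the largest partition `x`: the later Schur functions do not contain the
  -- monomial `x`, so its coefficient is `F x`, and subtracting that multiple leaves a smaller
  -- system.
  triangular-solution : ∀ n xs → (∀ ν → ν ∈ xs → IsPartition ν × size ν ≡ n) → AllPairs _≻_ xs → ∀ F →
    ∃ λ (a : List ℕ → K) → ∀ λ′ → λ′ ∈ xs → F λ′ ≈ Σ.∑ xs (λ ν → a ν * kostkaK ν λ′)
  triangular-solution n []       _ _       F = (λ _ → 0#) , λ _ ()
  triangular-solution n (x ∷ xs) p (x≻ ∷ u) F
    with a , solved ← triangular-solution n xs (λ ν ν∈ → p ν (there ν∈)) u (λ λ′ → F λ′ - F x * kostkaK x λ′) =
    b , λ { λ′ (here ≡.refl) → first ; λ′ (there λ∈) → later λ′ λ∈ }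
    where
    b : List ℕ → K
    b ν = if x == ν then F x else a ν
    b-head : b x ≈ F x
    b-head = reflexive (if-true (==-refl x))
    b-tail : ∀ ν → ν ∈ xs → b ν ≈ a ν
    b-tail ν ν∈ = reflexive (if-false (λ t → ≻⇒≢ (All.lookup x≻ ν∈) (==⇒≡ x ν t)))
    first : F x ≈ b x * kostkaK x x + Σ.∑ xs (λ ν → b ν * kostkaK ν x)
    first = sym (trans (+-cong
      (trans (*-cong b-head (kostka-diagonal (proj₁ (p x (here ≡.refl))))) (*-identityʳ _))
      (Σ.∑-zero xs (λ ν ν∈ → trans (*-congˡ (kostka-triangular (proj₁ (p x (here ≡.refl))) (proj₁ (p ν (there ν∈)))
        (≡.trans (proj₂ (p x (here ≡.refl))) (≡.sym (proj₂ (p ν (there ν∈))))) (All.lookup x≻ ν∈))) (zeroʳ _))))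
      (+-identityʳ _))
    later : ∀ λ′ → λ′ ∈ xs → F λ′ ≈ b x * kostkaK x λ′ + Σ.∑ xs (λ ν → b ν * kostkaK ν λ′)
    later λ′ λ∈ = trans (x-y≈z⇒x≈y+z (solved λ′ λ∈))
      (+-cong (*-congʳ (sym b-head)) (Σ.∑-cong xs (λ ν ν∈ → *-congʳ (sym (b-tail ν ν∈)))))

  schurCoeff-expand : ∀ n F λ′ → λ′ ∈ partitionsOf n → F λ′ ≈ Σ.∑ (partitionsOf n) (λ ν → schurCoeff F ν * kostkaK ν λ′)
  schurCoeff-expand n F λ′ λ∈
    with a , solved ← triangular-solution n (partitionsOf n) (λ ν ν∈ → ∈-partitionsOf⁻ {n} ν∈) (partitionsOf-decreasing n) F =
    trans (solved λ′ λ∈) (Σ.∑-cong (partitionsOf n) (λ ν ν∈ → *-congʳ (sym (schurCoeff-unique n solved ν∈))))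

  expand : ∀ F {λ′} → IsPartition λ′ → F λ′ ≈ Σ.∑ (partitionsOf (size λ′)) (λ ν → schurCoeff F ν * kostkaK ν λ′)
  expand F {λ′} p = schurCoeff-expand (size λ′) F λ′ (∈-partitionsOf⁺ p)

  -- Together with `expand` this replaces the procedure behind `schurCoeff`: linearity and all
  -- explicit expansions are obtained by exhibiting the coefficients.
  schurCoeff-char : ∀ {F : Λ̂} (a : List ℕ → K) {λ′} → IsPartition λ′ →
    (∀ μ → IsPartition μ → size μ ≡ size λ′ → F μ ≈ Σ.∑ (partitionsOf (size λ′)) (λ ν → a ν * kostkaK ν μ)) →
    schurCoeff F λ′ ≈ a λ′
  schurCoeff-char a {λ′} p h = schurCoeff-unique (size λ′)
    (λ μ μ∈ → let q , e = ∈-partitionsOf⁻ {size λ′} μ∈ in h μ q e) (∈-partitionsOf⁺ p)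

  expand-at : ∀ F {λ′ μ} → IsPartition μ → size μ ≡ size λ′ →
              F μ ≈ Σ.∑ (partitionsOf (size λ′)) (λ ν → schurCoeff F ν * kostkaK ν μ)
  expand-at F {λ′} {μ} q e = ≡.subst (λ n → F μ ≈ Σ.∑ (partitionsOf n) (λ ν → schurCoeff F ν * kostkaK ν μ)) e (expand F q)

  schurCoeff-cong : ∀ {F G : Λ̂} {λ′} → IsPartition λ′ → (∀ μ → IsPartition μ → size μ ≡ size λ′ → F μ ≈ G μ) →
                    schurCoeff F λ′ ≈ schurCoeff G λ′
  schurCoeff-cong {F} {G} {λ′} p h = schurCoeff-char (schurCoeff G) p
    (λ μ q e → trans (h μ q e) (expand-at G {λ′} q e))

  schurCoeff-zero : ∀ {F : Λ̂} {λ′} → IsPartition λ′ → (∀ μ → IsPartition μ → size μ ≡ size λ′ → F μ ≈ 0#) → schurCoeff F λ′ ≈ 0#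
  schurCoeff-zero {F} {λ′} p h = schurCoeff-char (λ _ → 0#) p
    (λ μ q e → trans (h μ q e) (sym (Σ.∑-zero (partitionsOf (size λ′)) (λ ν _ → zeroˡ _))))

  schurCoeff-+ : ∀ F G {λ′} → IsPartition λ′ → schurCoeff (λ μ → F μ + G μ) λ′ ≈ schurCoeff F λ′ + schurCoeff G λ′
  schurCoeff-+ F G {λ′} p = schurCoeff-char (λ ν → schurCoeff F ν + schurCoeff G ν) p (λ μ q e → begin
    F μ + G μ ≈⟨ +-cong (expand-at F {λ′} q e) (expand-at G {λ′} q e) ⟩
    _ + _     ≈⟨ Σ.∑-+ (partitionsOf (size λ′)) _ _ ⟨
    _         ≈⟨ Σ.∑-cong (partitionsOf (size λ′)) (λ ν _ → distribʳ (kostkaK ν μ) (schurCoeff F ν) (schurCoeff G ν)) ⟨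
    Σ.∑ (partitionsOf (size λ′)) (λ ν → (schurCoeff F ν + schurCoeff G ν) * kostkaK ν μ) ∎)

  schurCoeff-* : ∀ x F {λ′} → IsPartition λ′ → schurCoeff (λ μ → x * F μ) λ′ ≈ x * schurCoeff F λ′
  schurCoeff-* x F {λ′} p = schurCoeff-char (λ ν → x * schurCoeff F ν) p (λ μ q e → begin
    x * F μ ≈⟨ *-congˡ (expand-at F {λ′} q e) ⟩
    x * _   ≈⟨ Σ.∑-*ˡ (partitionsOf (size λ′)) x _ ⟨
    _       ≈⟨ Σ.∑-cong (partitionsOf (size λ′)) (λ ν _ → *-assoc x (schurCoeff F ν) (kostkaK ν μ)) ⟨
    Σ.∑ (partitionsOf (size λ′)) (λ ν → (x * schurCoeff F ν) * kostkaK ν μ) ∎)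

  schurCoeff-∑ : ∀ {A : Set} (xs : List A) (F : A → Λ̂) {λ′} → IsPartition λ′ →
                 schurCoeff (λ μ → Σ.∑ xs (λ x → F x μ)) λ′ ≈ Σ.∑ xs (λ x → schurCoeff (F x) λ′)
  schurCoeff-∑ []       F p = schurCoeff-zero p (λ _ _ _ → refl)
  schurCoeff-∑ (x ∷ xs) F p = trans (schurCoeff-+ (F x) (λ μ → Σ.∑ xs (λ x → F x μ)) p) (+-congˡ (schurCoeff-∑ xs F p))

  -- Bilinearity of the Hall inner product.

  module _ (d : ℕ) where
    private
      P = partitionsUpTo d
      part : ∀ {λ′} → λ′ ∈ P → IsPartition λ′
      part λ∈ = proj₁ (∈-partitionsUpTo⁻ {d} λ∈)
      small : ∀ {λ′} → λ′ ∈ P → size λ′ ≤ d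
      small λ∈ = proj₂ (∈-partitionsUpTo⁻ {d} λ∈)

    hall-congˡ : ∀ {F G f : Λ̂} → (∀ μ → IsPartition μ → size μ ≤ d → F μ ≈ G μ) → hall F d f ≈ hall G d f
    hall-congˡ h = Σ.∑-cong P (λ λ′ λ∈ → *-congʳ (schurCoeff-cong (part λ∈)
      (λ μ q e → h μ q (ℕ.≤-trans (ℕ.≤-reflexive e) (small λ∈)))))

    hall-congʳ : ∀ {F f g : Λ̂} → (∀ μ → IsPartition μ → size μ ≤ d → f μ ≈ g μ) → hall F d f ≈ hall F d g
    hall-congʳ h = Σ.∑-cong P (λ λ′ λ∈ → *-congˡ (schurCoeff-cong (part λ∈)
      (λ μ q e → h μ q (ℕ.≤-trans (ℕ.≤-reflexive e) (small λ∈)))))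

    hall-zeroʳ : ∀ {F f : Λ̂} → (∀ μ → IsPartition μ → size μ ≤ d → f μ ≈ 0#) → hall F d f ≈ 0#
    hall-zeroʳ h = Σ.∑-zero P (λ λ′ λ∈ → trans (*-congˡ (schurCoeff-zero (part λ∈)
      (λ μ q e → h μ q (ℕ.≤-trans (ℕ.≤-reflexive e) (small λ∈))))) (zeroʳ _))

    hall-+ˡ : ∀ F G f → hall (λ μ → F μ + G μ) d f ≈ hall F d f + hall G d f
    hall-+ˡ F G f = trans (Σ.∑-cong P (λ λ′ λ∈ → trans (*-congʳ (schurCoeff-+ F G (part λ∈))) (distribʳ _ _ _)))
                          (Σ.∑-+ P _ _)

    hall-*ˡ : ∀ x F f → hall (λ μ → x * F μ) d f ≈ x * hall F d f
    hall-*ˡ x F f = trans (Σ.∑-cong P (λ λ′ λ∈ → trans (*-congʳ (schurCoeff-* x F (part λ∈))) (*-assoc _ _ _)))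
                          (Σ.∑-*ˡ P x _)

    hall-*ʳ : ∀ x F f → hall F d (λ μ → x * f μ) ≈ x * hall F d f
    hall-*ʳ x F f = trans (Σ.∑-cong P (λ λ′ λ∈ → trans (*-congˡ (schurCoeff-* x f (part λ∈)))
        (trans (sym (*-assoc _ _ _)) (trans (*-congʳ (*-comm _ x)) (*-assoc _ _ _)))))
      (Σ.∑-*ˡ P x _)

    hall-∑ˡ : ∀ {A : Set} (xs : List A) (F : A → Λ̂) f → hall (λ μ → Σ.∑ xs (λ x → F x μ)) d f ≈ Σ.∑ xs (λ x → hall (F x) d f)
    hall-∑ˡ xs F f = trans (Σ.∑-cong P (λ λ′ λ∈ → trans (*-congʳ (schurCoeff-∑ xs F (part λ∈))) (sym (Σ.∑-*ʳ xs _ _))))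
                           (Σ.∑-swap P xs _)

    hall-∑ʳ : ∀ {A : Set} (xs : List A) F (f : A → Λ̂) → hall F d (λ μ → Σ.∑ xs (λ x → f x μ)) ≈ Σ.∑ xs (λ x → hall F d (f x))
    hall-∑ʳ xs F f = trans (Σ.∑-cong P (λ λ′ λ∈ → trans (*-congˡ (schurCoeff-∑ xs f (part λ∈))) (sym (Σ.∑-*ˡ xs _ _))))
                           (Σ.∑-swap P xs _)

  hall-extend : ∀ {d d′} {F f : Λ̂} → d ≤ d′ → Bounded d f → hall F d′ f ≈ hall F d f
  hall-extend {d} {d′} {F} {f} d≤d′ b = sym (trans
    (Σ.∑-⊆ (λ μ → size μ ≤ᵇ d) (partitionsUpTo-Unique d) (partitionsUpTo-Unique d′)
      (λ μ μ∈ → let p , s = ∈-partitionsUpTo⁻ {d} μ∈ in ℕ.≤⇒≤ᵇ s , ∈-partitionsUpTo⁺ p (ℕ.≤-trans s d≤d′) , refl)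
      (λ μ μ∈ t → ∈-partitionsUpTo⁺ (proj₁ (∈-partitionsUpTo⁻ {d′} μ∈)) (ℕ.≤ᵇ⇒≤ (size μ) d t)))
    (Σ.∑-cong (partitionsUpTo d′) drop))
    where
    drop : ∀ μ → μ ∈ partitionsUpTo d′ → Σ.ind (size μ ≤ᵇ d) * (schurCoeff F μ * schurCoeff f μ) ≈ schurCoeff F μ * schurCoeff f μ
    drop μ μ∈ with T? (size μ ≤ᵇ d)
    ... | yes t = Σ.ind-*-one t
    ... | no ¬t = trans (Σ.ind-*-zero ¬t) (sym (trans (*-congˡ (schurCoeff-zero (proj₁ (∈-partitionsUpTo⁻ {d′} μ∈))
      (λ ν q e → b ν q (≡.subst (d <_) (≡.sym e) (ℕ.≰⇒> (¬t ∘ ℕ.≤⇒≤ᵇ)))))) (zeroʳ _)))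

  -- Schur functions and the Schur expansion of `E-1`.

  isEmpty : List ℕ → K
  isEmpty μ = Σ.ind (μ == [])

  -- The top-degree part of `g_λ`. The indicator is there because `chains ν λ′` may also be nonzero
  -- for smaller `ν`; in equal size it is the Kostka number.
  schur : List ℕ → Λ̂
  schur λ′ ν = Σ.ind (size λ′ ≡ᵇ size ν) * fromℕ (chains ν λ′)

  schur-kostka : ∀ {λ′} ν → IsPartition λ′ → size λ′ ≡ size ν → schur λ′ ν ≈ kostkaK λ′ ν
  schur-kostka {λ′} ν p e = trans (Σ.ind-*-one (ℕ.≡⇒≡ᵇ (size λ′) (size ν) e)) (sym (kostka-chains ν p (≡.sym e)))

  schur-degree : ∀ {λ′ ν} → size λ′ ≢ size ν → schur λ′ ν ≈ 0#
  schur-degree {λ′} {ν} n = Σ.ind-*-zero (n ∘ ℕ.≡ᵇ⇒≡ (size λ′) (size ν))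

  schurCoeff-schur : ∀ {κ λ′} → IsPartition κ → IsPartition λ′ → schurCoeff (schur κ) λ′ ≈ Σ.ind (κ == λ′)
  schurCoeff-schur {κ} {λ′} p q with size κ ℕ.≟ size λ′
  ... | no n = trans (schurCoeff-zero q (λ μ _ e → schur-degree {κ} {μ} (λ f → n (≡.trans f e))))
                     (sym (Σ.ind-false (λ t → n (≡.cong size (==⇒≡ κ λ′ t)))))
  ... | yes e = schurCoeff-char (λ ν → Σ.ind (κ == ν)) q (λ μ r f → trans
    (schur-kostka μ p (≡.trans e (≡.sym f)))
    (sym (Σ.∑-δ (λ ν → kostkaK ν μ) (partitionsOf-Unique (size λ′))
      (≡.subst (λ n → κ ∈ partitionsOf n) e (∈-partitionsOf⁺ p)))))

  schur-expansion : ∀ {d f} → Bounded d f → ∀ {μ} → IsPartition μ →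
                    f μ ≈ Σ.∑ (partitionsUpTo d) (λ λ′ → schurCoeff f λ′ * schur λ′ μ)
  schur-expansion {d} {f} b {μ} p with size μ ≤? d
  ... | no n = trans (b μ p (ℕ.≰⇒> n)) (sym (Σ.∑-zero (partitionsUpTo d) (λ λ′ λ∈ → trans
      (*-congˡ (schur-degree {λ′} {μ} (λ e → n (≡.subst (_≤ d) e (proj₂ (∈-partitionsUpTo⁻ {d} λ∈)))))) (zeroʳ _))))
  ... | yes s = begin
    f μ ≈⟨ expand f p ⟩
    Σ.∑ (partitionsOf (size μ)) (λ λ′ → schurCoeff f λ′ * kostkaK λ′ μ)
      ≈⟨ Σ.∑-cong (partitionsOf (size μ)) (λ λ′ λ∈ → *-congˡ (sym
           (let q , e = ∈-partitionsOf⁻ {size μ} λ∈ in schur-kostka μ q e))) ⟩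
    Σ.∑ (partitionsOf (size μ)) t
      ≈⟨ Σ.∑-single {x = size μ} (Unique.upTo⁺ (suc d)) (∈-upTo⁺ (s≤s s)) (λ n _ n≢ → Σ.∑-zero (partitionsOf n) (λ λ′ λ∈ →
           trans (*-congˡ (schur-degree {λ′} {μ} (λ e → n≢ (≡.trans (≡.sym (proj₂ (∈-partitionsOf⁻ {n} λ∈))) e)))) (zeroʳ _))) ⟨
    Σ.∑ (upTo (suc d)) (λ n → Σ.∑ (partitionsOf n) t)
      ≈⟨ Σ.∑-concatMap partitionsOf (upTo (suc d)) t ⟨
    Σ.∑ (partitionsUpTo d) t ∎
    where
    t : List ℕ → K
    t λ′ = schurCoeff f λ′ * schur λ′ μ

  -- Both the monomial and the Schur coefficients of `E-1`, since `e_k` is the monomial function of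
  -- `1ᵏ` as well as its Schur function.
  columnSign : List ℕ → K
  columnSign λ′ = Σ.ind (allOnes λ′) * sign (size λ′)

  E-1-columnSign : ∀ λ′ → E-1 λ′ ≈ columnSign λ′
  E-1-columnSign λ′ with T? (allOnes λ′)
  ... | no ¬t = trans (Σ.∑-zero (upTo (suc (size λ′))) (λ i _ →
      trans (*-congˡ (Σ.ind-false (¬t ∘ proj₁ ∘ ∧-elim))) (zeroʳ _))) (sym (Σ.ind-*-zero ¬t))
  ... | yes t = trans
    (Σ.∑-single {x = size λ′} (Unique.upTo⁺ (suc (size λ′))) (∈-upTo⁺ (ℕ.n<1+n (size λ′)))
      (λ i _ i≢ → trans (*-congˡ (Σ.ind-false (λ u →
        i≢ (≡.sym (≡.trans (≡.sym (onlyOnes⇒length {λ′} t)) (ℕ.≡ᵇ⇒≡ (length λ′) i (proj₂ (∧-elim {allOnes λ′} u)))))))) (zeroʳ _)))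
    (trans (*-congˡ (Σ.ind-true (∧-intro t (ℕ.≡⇒≡ᵇ (length λ′) (size λ′) (onlyOnes⇒length {λ′} t)))))
      (trans (*-identityʳ _) (sym (Σ.ind-*-one t))))

  -- A layer of a one-column shape has at most one column, so no weight with a part above 1 occurs
  -- in the Schur function of `1ᵏ`.
  schurCoeff-E-1 : ∀ {λ′} → IsPartition λ′ → schurCoeff E-1 λ′ ≈ columnSign λ′
  schurCoeff-E-1 {λ′} p = schurCoeff-char columnSign p (λ μ q e → sym (trans
    (Σ.∑-single (partitionsOf-Unique (size λ′)) (≡.subst (λ n → μ ∈ partitionsOf n) e (∈-partitionsOf⁺ q))
      (λ ν ν∈ ν≢ → let r , f = ∈-partitionsOf⁻ {size λ′} ν∈ in off-diagonal q r (≡.trans e (≡.sym f)) ν≢))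
    (trans (*-congˡ (kostka-diagonal q)) (trans (*-identityʳ _) (sym (E-1-columnSign μ))))))
    where
    off-diagonal : ∀ {μ ν} → IsPartition μ → IsPartition ν → size μ ≡ size ν → ν ≢ μ → columnSign ν * kostkaK ν μ ≈ 0#
    off-diagonal {μ} {ν} q r e ν≢ with T? (allOnes ν)
    ... | no ¬t = trans (*-congʳ (Σ.ind-*-zero ¬t)) (zeroˡ _)
    ... | yes t with T? (allOnes μ)
    ...   | yes u = ⊥-elim (ν≢ (≡.trans (onlyOnes⇒ones {ν} t) (≡.trans
      (≡.cong ones (≡.trans (onlyOnes⇒length {ν} t) (≡.trans (≡.sym e) (≡.sym (onlyOnes⇒length {μ} u)))))
      (≡.sym (onlyOnes⇒ones {μ} u)))))
    ...   | no ¬u = trans (*-congˡ (trans (kostka-chains μ r e) (reflexive (≡.cong fromℕ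
      (vanish μ (ℕ.≤-<-trans (onlyOnes-head {ν} t) (¬onlyOnes⇒head q ¬u))))))) (zeroʳ _)
      where
      vanish : ∀ μ → headOr0 ν < headOr0 μ → chains μ ν ≡ 0
      vanish (b ∷ μ) lt = chains-head-< μ ν lt

  hall-E-1-schur : ∀ {d ν} → IsPartition ν → size ν ≤ d → hall E-1 d (schur ν) ≈ columnSign ν
  hall-E-1-schur {d} {ν} p s = begin
    Σ.∑ (partitionsUpTo d) (λ λ′ → schurCoeff E-1 λ′ * schurCoeff (schur ν) λ′)
      ≈⟨ Σ.∑-cong (partitionsUpTo d) (λ λ′ λ∈ → let q = proj₁ (∈-partitionsUpTo⁻ {d} λ∈) in
           trans (*-cong (schurCoeff-E-1 q) (schurCoeff-schur p q)) (*-comm _ _)) ⟩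
    Σ.∑ (partitionsUpTo d) (λ λ′ → Σ.ind (ν == λ′) * columnSign λ′)
      ≈⟨ Σ.∑-δ columnSign (partitionsUpTo-Unique d) (∈-partitionsUpTo⁺ {d} p s) ⟩
    columnSign ν ∎

  -- Removing horizontal strips from λ leaves at most two columns 1ᵏ, and then with opposite signs.
  strips-cancel : ∀ {λ′} → IsPartition λ′ →
                  Σ.∑ (subpartitions λ′) (λ ν → Σ.ind (isStrip λ′ ν) * columnSign ν) ≈ isEmpty λ′
  strips-cancel {[]} p = trans (+-identityʳ _) (trans (*-identityˡ _) (*-identityˡ _))
  strips-cancel {a ∷ l} p with size l ℕ.≟ length l
  ... | no n = Σ.∑-zero subs (λ ν ν∈ → zero-term ν (∈-sub⁻ {a ∷ l} ν∈))
    where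
    subs = subpartitions (a ∷ l)
    zero-term : ∀ ν → IsPartition ν × T (contained ν (a ∷ l)) → Σ.ind (isStrip (a ∷ l) ν) * columnSign ν ≈ 0#
    zero-term ν (q , c) with T? (allOnes ν)
    ... | no ¬t = trans (*-congˡ (Σ.ind-*-zero ¬t)) (zeroʳ _)
    ... | yes t = Σ.ind-*-zero (λ u → n (proj₁ (strip-ones (length ν) p (contained⇒length ν (a ∷ l) c)
      (≡.subst (T ∘ isStrip (a ∷ l)) (onlyOnes⇒ones {ν} t) u))))
  ... | yes e = begin
    Σ.∑ subs f
      ≈⟨ Σ.∑-cong subs (λ ν ν∈ → split ν (∈-sub⁻ {a ∷ l} ν∈)) ⟩
    Σ.∑ subs (λ ν → Σ.ind (ones (suc m) == ν) * f ν + Σ.ind (ones m == ν) * f ν)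
      ≈⟨ Σ.∑-+ subs _ _ ⟩
    Σ.∑ subs (λ ν → Σ.ind (ones (suc m) == ν) * f ν) + Σ.∑ subs (λ ν → Σ.ind (ones m == ν) * f ν)
      ≈⟨ +-cong (Σ.∑-δ f (sub-Unique (a ∷ l)) (ones∈ (suc m) ℕ.≤-refl)) (Σ.∑-δ f (sub-Unique (a ∷ l)) (ones∈ m (ℕ.n≤1+n m))) ⟩
    f (ones (suc m)) + f (ones m)
      ≈⟨ +-cong (value (suc m) (strip-ones-full p e)) (value m (strip-ones-short p e)) ⟩
    - sign m + sign m
      ≈⟨ -‿inverseˡ (sign m) ⟩
    0# ∎
    where
    m = length l
    subs = subpartitions (a ∷ l)
    f : List ℕ → K
    f ν = Σ.ind (isStrip (a ∷ l) ν) * columnSign ν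
    ones∈ : ∀ k → k ≤ suc m → ones k ∈ subs
    ones∈ k le = ∈-sub⁺ {a ∷ l} (ones-partition k) (ones⊆ k p le)
    value : ∀ k → T (isStrip (a ∷ l) (ones k)) → f (ones k) ≈ sign k
    value k t = trans (Σ.ind-*-one t) (trans (Σ.ind-*-one (onlyOnes-ones k)) (reflexive (≡.cong sign (size-ones k))))
    ones-injective : ∀ {j k} → ones j ≡ ones k → j ≡ k
    ones-injective {j} {k} eq = ≡.trans (≡.sym (List.length-replicate j)) (≡.trans (≡.cong length eq) (List.length-replicate k))
    split : ∀ ν → IsPartition ν × T (contained ν (a ∷ l)) → f ν ≈ Σ.ind (ones (suc m) == ν) * f ν + Σ.ind (ones m == ν) * f ν
    split ν (q , c) with T? (isStrip (a ∷ l) ν) | T? (allOnes ν)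
    ... | no ¬u | _ = trans fz (sym (trans (+-cong (trans (*-congˡ fz) (zeroʳ _)) (trans (*-congˡ fz) (zeroʳ _))) (+-identityˡ _)))
      where fz = Σ.ind-*-zero ¬u
    ... | yes _ | no ¬t = trans fz (sym (trans (+-cong (trans (*-congˡ fz) (zeroʳ _)) (trans (*-congˡ fz) (zeroʳ _))) (+-identityˡ _)))
      where
      fz : f ν ≈ 0#
      fz = trans (*-congˡ (Σ.ind-*-zero ¬t)) (zeroʳ _)
    ... | yes u | yes t with strip-ones (length ν) p (contained⇒length ν (a ∷ l) c) (≡.subst (T ∘ isStrip (a ∷ l)) (onlyOnes⇒ones {ν} t) u)
    ...   | _ , inj₁ k≡ = sym (trans (+-cong
        (Σ.ind-*-one (≡⇒== (≡.sym ν≡)))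
        (Σ.ind-*-zero (λ v → ℕ.1+n≢n (ones-injective (≡.trans (≡.sym ν≡) (≡.sym (==⇒≡ (ones m) ν v)))))))
        (+-identityʳ _))
      where
      ν≡ : ν ≡ ones (suc m)
      ν≡ = ≡.trans (onlyOnes⇒ones {ν} t) (≡.cong ones k≡)
    ...   | _ , inj₂ k≡ = sym (trans (+-cong
        (Σ.ind-*-zero (λ v → ℕ.1+n≢n (ones-injective (≡.trans (==⇒≡ (ones (suc m)) ν v) ν≡))))
        (Σ.ind-*-one (≡⇒== (≡.sym ν≡))))
        (+-identityˡ _))
      where
      ν≡ : ν ≡ ones m
      ν≡ = ≡.trans (onlyOnes⇒ones {ν} t) (≡.cong ones k≡)

  -- specialise n f is f(1, x₁, x₂, …) when f has degree at most n.
  specialise : ℕ → Λ̂ → Λ̂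
  specialise n f μ = Σ.∑ (upTo (suc n)) (λ k → f (insert k μ))

  specialise-cong : ∀ n {f h} → f ≈̂ h → specialise n f ≈̂ specialise n h
  specialise-cong n e μ p = Σ.∑-cong (upTo (suc n)) (λ k _ → e (insert k μ) (insert-partition k p))

  ∑-ind-≡ : ∀ {n j} → j ≤ n → (g : ℕ → K) → Σ.∑ (upTo (suc n)) (λ k → Σ.ind (j ≡ᵇ k) * g k) ≈ g j
  ∑-ind-≡ {n} {j} le g = trans
    (Σ.∑-single {x = j} (Unique.upTo⁺ (suc n)) (∈-upTo⁺ (s≤s le)) (λ k _ k≢ → Σ.ind-*-zero (k≢ ∘ ≡.sym ∘ ℕ.≡ᵇ⇒≡ j k)))
    (Σ.ind-*-one (ℕ.≡⇒≡ᵇ j j ≡.refl))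

  chains-insert-K : ∀ {λ′} k μ → IsPartition λ′ →
    fromℕ (chains (insert k μ) λ′) ≈ Σ.∑ (subpartitions λ′) (λ ν → Σ.ind (skewCols λ′ ν ≡ᵇ k) * fromℕ (chains μ ν))
  chains-insert-K {λ′} k μ p = trans (reflexive (≡.cong fromℕ (chains-insert k μ p)))
    (trans (fromℕ-∑ (subpartitions λ′) (λ ν → ind (skewCols λ′ ν ≡ᵇ k) ℕ.* chains μ ν))
      (Σ.∑-cong (subpartitions λ′) (λ ν _ → fromℕ-ind-* (skewCols λ′ ν ≡ᵇ k) (chains μ ν))))

  skewCols≤size : ∀ {λ′ ν} → IsPartition λ′ → IsPartition ν → T (contained ν λ′) → skewCols λ′ ν ≤ size λ′
  skewCols≤size {λ′} {ν} p q c = ℕ.≤-trans (ℕ.m≤m+n (skewCols λ′ ν) (size ν)) (skewCols+size≤ q p c)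

  -- Summing over the width `k` of the outermost layer lifts the condition on it; `size λ′ ≤ n`
  -- ensures that every width is reached.
  specialise-chains : ∀ {n λ′} → IsPartition λ′ → size λ′ ≤ n → ∀ μ →
    specialise n (λ μ → fromℕ (chains μ λ′)) μ ≈ Σ.∑ (subpartitions λ′) (λ ν → fromℕ (chains μ ν))
  specialise-chains {n} {λ′} p s μ = begin
    Σ.∑ (upTo (suc n)) (λ k → fromℕ (chains (insert k μ) λ′))
      ≈⟨ Σ.∑-cong (upTo (suc n)) (λ k _ → chains-insert-K k μ p) ⟩
    Σ.∑ (upTo (suc n)) (λ k → Σ.∑ subs (λ ν → Σ.ind (skewCols λ′ ν ≡ᵇ k) * fromℕ (chains μ ν)))
      ≈⟨ Σ.∑-swap (upTo (suc n)) subs _ ⟩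
    Σ.∑ subs (λ ν → Σ.∑ (upTo (suc n)) (λ k → Σ.ind (skewCols λ′ ν ≡ᵇ k) * fromℕ (chains μ ν)))
      ≈⟨ Σ.∑-cong subs (λ ν ν∈ → let q , c = ∈-sub⁻ {λ′} ν∈ in
           ∑-ind-≡ (ℕ.≤-trans (skewCols≤size p q c) s) (λ _ → fromℕ (chains μ ν))) ⟩
    Σ.∑ subs (λ ν → fromℕ (chains μ ν)) ∎
    where subs = subpartitions λ′

  -- As in `specialise-chains`, but the degree condition of `schur` survives and says that the
  -- removed layer has as many boxes as columns.
  specialise-schur : ∀ {n λ′} → IsPartition λ′ → size λ′ ≤ n → ∀ μ →
    specialise n (schur λ′) μ ≈ Σ.∑ (subpartitions λ′) (λ ν → Σ.ind (isStrip λ′ ν) * schur ν μ)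
  specialise-schur {n} {λ′} p s μ = begin
    Σ.∑ (upTo (suc n)) (λ k → Σ.ind (size λ′ ≡ᵇ size (insert k μ)) * fromℕ (chains (insert k μ) λ′))
      ≈⟨ Σ.∑-cong (upTo (suc n)) (λ k _ → trans
           (*-cong (reflexive (≡.cong (λ z → Σ.ind (size λ′ ≡ᵇ z)) (size-insert k μ))) (chains-insert-K k μ p))
           (sym (Σ.∑-*ˡ subs _ _))) ⟩
    Σ.∑ (upTo (suc n)) (λ k → Σ.∑ subs (λ ν → Σ.ind (size λ′ ≡ᵇ k ℕ.+ size μ) * (Σ.ind (skewCols λ′ ν ≡ᵇ k) * fromℕ (chains μ ν))))
      ≈⟨ Σ.∑-swap (upTo (suc n)) subs _ ⟩
    Σ.∑ subs (λ ν → Σ.∑ (upTo (suc n)) (λ k → Σ.ind (size λ′ ≡ᵇ k ℕ.+ size μ) * (Σ.ind (skewCols λ′ ν ≡ᵇ k) * fromℕ (chains μ ν))))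
      ≈⟨ Σ.∑-cong subs (λ ν ν∈ → let q , c = ∈-sub⁻ {λ′} ν∈ in trans
           (trans (Σ.∑-cong (upTo (suc n)) (λ k _ → *-swapˡ _ _ _))
             (∑-ind-≡ (ℕ.≤-trans (skewCols≤size p q c) s) (λ k → Σ.ind (size λ′ ≡ᵇ k ℕ.+ size μ) * fromℕ (chains μ ν))))
           (strip ν q c)) ⟩
    Σ.∑ subs (λ ν → Σ.ind (isStrip λ′ ν) * schur ν μ) ∎
    where
    subs = subpartitions λ′
    strip : ∀ ν → IsPartition ν → T (contained ν λ′) →
      Σ.ind (size λ′ ≡ᵇ skewCols λ′ ν ℕ.+ size μ) * fromℕ (chains μ ν) ≈ Σ.ind (isStrip λ′ ν) * schur ν μ
    -- If `ν` is smaller than `μ`, no chain has weight `μ`. If it is larger, the degree condition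
    -- contradicts `skewCols+size≤`. For equal sizes the two conditions are the same equation.
    strip ν q c with ℕ.<-cmp (size ν) (size μ)
    ... | tri< lt _ _ = trans (trans (*-congˡ vanish) (zeroʳ _)) (sym (trans (*-congˡ (trans (*-congˡ vanish) (zeroʳ _))) (zeroʳ _)))
      where vanish = reflexive (≡.cong fromℕ (chains-vanish μ q lt))
    ... | tri> _ n≡ gt = trans
      (Σ.ind-*-zero (λ t → ℕ.<⇒≱ (ℕ.+-monoʳ-< (skewCols λ′ ν) gt)
        (ℕ.≤-trans (skewCols+size≤ q p c) (ℕ.≤-reflexive (ℕ.≡ᵇ⇒≡ (size λ′) (skewCols λ′ ν ℕ.+ size μ) t)))))
      (sym (trans (*-congˡ (schur-degree {ν} {μ} n≡)) (zeroʳ _)))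
    ... | tri≈ _ e _ = *-cong
      (Σ.ind-cong
        (λ t → ℕ.≡⇒≡ᵇ (skewCols λ′ ν ℕ.+ size ν) (size λ′) (≡.trans (≡.cong (skewCols λ′ ν ℕ.+_) e) (≡.sym (ℕ.≡ᵇ⇒≡ (size λ′) (skewCols λ′ ν ℕ.+ size μ) t))))
        (λ t → ℕ.≡⇒≡ᵇ (size λ′) (skewCols λ′ ν ℕ.+ size μ) (≡.trans (≡.sym (ℕ.≡ᵇ⇒≡ (skewCols λ′ ν ℕ.+ size ν) (size λ′) t)) (≡.cong (skewCols λ′ ν ℕ.+_) e))))
      (sym (Σ.ind-*-one (ℕ.≡⇒≡ᵇ (size ν) (size μ) e)))

  schur-[] : ∀ {λ′} → IsPartition λ′ → schur λ′ [] ≈ isEmpty λ′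
  schur-[] {[]}        p = trans (*-identityˡ _) (+-identityʳ 1#)
  schur-[] {zero ∷ l}  p with () ← head-pos p
  schur-[] {suc a ∷ l} p = zeroˡ _

  -- By linearity Schur functions suffice. There `specialise` gives a sum over horizontal strips,
  -- whose signs cancel except for the empty shape.
  hall-E-1-specialise : ∀ {n f} → Bounded n f → hall E-1 n (specialise n f) ≈ f []
  hall-E-1-specialise {n} {f} b = begin
    hall E-1 n (specialise n f)
      ≈⟨ hall-congʳ n (λ μ p _ → begin
           specialise n f μ
             ≈⟨ Σ.∑-cong (upTo (suc n)) (λ k _ → schur-expansion b (insert-partition k p)) ⟩
           Σ.∑ (upTo (suc n)) (λ k → Σ.∑ P (λ λ′ → schurCoeff f λ′ * schur λ′ (insert k μ)))
             ≈⟨ Σ.∑-swap (upTo (suc n)) P _ ⟩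
           Σ.∑ P (λ λ′ → Σ.∑ (upTo (suc n)) (λ k → schurCoeff f λ′ * schur λ′ (insert k μ)))
             ≈⟨ Σ.∑-cong P (λ λ′ _ → Σ.∑-*ˡ (upTo (suc n)) (schurCoeff f λ′) _) ⟩
           Σ.∑ P (λ λ′ → schurCoeff f λ′ * specialise n (schur λ′) μ) ∎) ⟩
    hall E-1 n (λ μ → Σ.∑ P (λ λ′ → schurCoeff f λ′ * specialise n (schur λ′) μ))
      ≈⟨ hall-∑ʳ n P E-1 (λ λ′ μ → schurCoeff f λ′ * specialise n (schur λ′) μ) ⟩
    Σ.∑ P (λ λ′ → hall E-1 n (λ μ → schurCoeff f λ′ * specialise n (schur λ′) μ))
      ≈⟨ Σ.∑-cong P (λ λ′ λ∈ → let p , s = ∈-partitionsUpTo⁻ {n} λ∈ in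
           trans (hall-*ʳ n (schurCoeff f λ′) E-1 (specialise n (schur λ′))) (*-congˡ (trans (strips p s) (sym (schur-[] p))))) ⟩
    Σ.∑ P (λ λ′ → schurCoeff f λ′ * schur λ′ [])
      ≈⟨ schur-expansion b [] ⟨
    f [] ∎
    where
    P = partitionsUpTo n
    strips : ∀ {λ′} → IsPartition λ′ → size λ′ ≤ n → hall E-1 n (specialise n (schur λ′)) ≈ isEmpty λ′
    strips {λ′} p s = begin
      hall E-1 n (specialise n (schur λ′))
        ≈⟨ hall-congʳ n (λ μ _ _ → specialise-schur p s μ) ⟩
      hall E-1 n (λ μ → Σ.∑ subs (λ ν → Σ.ind (isStrip λ′ ν) * schur ν μ))
        ≈⟨ hall-∑ʳ n subs E-1 (λ ν μ → Σ.ind (isStrip λ′ ν) * schur ν μ) ⟩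
      Σ.∑ subs (λ ν → hall E-1 n (λ μ → Σ.ind (isStrip λ′ ν) * schur ν μ))
        ≈⟨ Σ.∑-cong subs (λ ν ν∈ → let q , c = ∈-sub⁻ {λ′} ν∈ in
             trans (hall-*ʳ n _ E-1 (schur ν)) (*-congˡ (hall-E-1-schur q (ℕ.≤-trans (contained⇒size ν λ′ c) s)))) ⟩
      Σ.∑ subs (λ ν → Σ.ind (isStrip λ′ ν) * columnSign ν)
        ≈⟨ strips-cancel p ⟩
      isEmpty λ′ ∎
      where subs = subpartitions λ′

  -- Pairings with 1, with `E-1` and with the `g_λ`.

  schurCoeff-[] : ∀ f → schurCoeff f [] ≈ f []
  schurCoeff-[] f = begin
    schurCoeff f []                 ≈⟨ *-identityʳ _ ⟨
    schurCoeff f [] * 1#            ≈⟨ *-congˡ (kostka-diagonal []) ⟨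
    schurCoeff f [] * kostkaK [] [] ≈⟨ +-identityʳ _ ⟨
    schurCoeff f [] * kostkaK [] [] + 0# ≈⟨ expand f [] ⟨
    f []                            ∎

  schurCoeff-one : ∀ {λ′} → IsPartition λ′ → schurCoeff oneΛ̂ λ′ ≈ Σ.ind ([] == λ′)
  schurCoeff-one {λ′} p = trans (schurCoeff-cong p (λ μ q _ → one-schur q)) (schurCoeff-schur [] p)
    where
    one-schur : ∀ {μ} → IsPartition μ → oneΛ̂ μ ≈ schur [] μ
    one-schur {[]}        q = sym (trans (*-identityˡ _) (+-identityʳ 1#))
    one-schur {zero ∷ μ}  q with () ← head-pos q
    one-schur {suc a ∷ μ} q = sym (zeroˡ _)

  hall-one : ∀ d f → hall oneΛ̂ d f ≈ f []
  hall-one d f = begin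
    Σ.∑ (partitionsUpTo d) (λ λ′ → schurCoeff oneΛ̂ λ′ * schurCoeff f λ′)
      ≈⟨ Σ.∑-cong (partitionsUpTo d) (λ λ′ λ∈ → *-congʳ (schurCoeff-one (proj₁ (∈-partitionsUpTo⁻ {d} λ∈)))) ⟩
    Σ.∑ (partitionsUpTo d) (λ λ′ → Σ.ind ([] == λ′) * schurCoeff f λ′)
      ≈⟨ Σ.∑-δ (schurCoeff f) (partitionsUpTo-Unique d) (∈-partitionsUpTo⁺ {d} [] z≤n) ⟩
    schurCoeff f []
      ≈⟨ schurCoeff-[] f ⟩
    f [] ∎

  -- Removes the guard of `perpCoeff` and frees the degree bound; what is added or dropped lies
  -- beyond `deg f` and is zero.
  perp-hall : ∀ F (f : Λ) {n} → deg f ≤ n → ∀ {ν} → IsPartition ν →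
              coeff ((F ⊥) f) ν ≈ hall F n (λ μ → coeff f (merge μ ν))
  perp-hall F f {n} le {ν} p with size ν ≤? deg f
  ... | yes _ = sym (hall-extend le (λ μ q lt → bounded f (merge μ ν) (merge-partition q p)
      (ℕ.<-≤-trans lt (ℕ.≤-trans (ℕ.m≤m+n (size μ) (size ν)) (ℕ.≤-reflexive (≡.sym (size-merge μ ν)))))))
  ... | no ≰ = sym (hall-zeroʳ n (λ μ q _ → bounded f (merge μ ν) (merge-partition q p)
      (ℕ.<-≤-trans (ℕ.≰⇒> ≰) (ℕ.≤-trans (ℕ.m≤n+m (size ν) (size μ)) (ℕ.≤-reflexive (≡.sym (size-merge μ ν)))))))

  coeff-g : ∀ {λ′} ν → IsPartition λ′ → coeff (g λ′) ν ≈ fromℕ (chains ν λ′)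
  coeff-g {λ′} ν p with size ν ≤? size λ′
  ... | yes _ = reflexive (≡.cong fromℕ (rppCount-chains p ν))
  ... | no ≰  = sym (reflexive (≡.cong fromℕ (chains-vanish ν p (ℕ.≰⇒> ≰))))

  specialise-g : ∀ {n λ′} → IsPartition λ′ → size λ′ ≤ n → ∀ μ →
         specialise n (coeff (g λ′)) μ ≈ Σ.∑ (subpartitions λ′) (λ ν → coeff (g ν) μ)
  specialise-g {n} {λ′} p s μ = begin
    specialise n (coeff (g λ′)) μ ≈⟨ Σ.∑-cong (upTo (suc n)) (λ k _ → coeff-g (insert k μ) p) ⟩
    specialise n (λ μ → fromℕ (chains μ λ′)) μ ≈⟨ specialise-chains p s μ ⟩
    Σ.∑ (subpartitions λ′) (λ ν → fromℕ (chains μ ν))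
      ≈⟨ Σ.∑-cong (subpartitions λ′) (λ ν ν∈ → coeff-g μ (proj₁ (∈-sub⁻ {λ′} ν∈))) ⟨
    Σ.∑ (subpartitions λ′) (λ ν → coeff (g ν) μ) ∎

  g-[] : ∀ {λ′} → IsPartition λ′ → coeff (g λ′) [] ≈ isEmpty λ′
  g-[] {λ′} p = trans (coeff-g [] p) (fromℕ-ind (λ′ == []))

  schurCoeff-g : ∀ {λ′ κ} → IsPartition λ′ → IsPartition κ → size κ ≡ size λ′ → schurCoeff (coeff (g λ′)) κ ≈ Σ.ind (λ′ == κ)
  schurCoeff-g {λ′} p q e = trans (schurCoeff-cong q (λ μ r f → trans (coeff-g μ p)
      (sym (Σ.ind-*-one (ℕ.≡⇒≡ᵇ (size λ′) (size μ) (≡.sym (≡.trans f e)))))))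
    (schurCoeff-schur p q)

  +-cancelˡ : ∀ x {y z} → x + y ≈ x + z → y ≈ z
  +-cancelˡ x {y} {z} e = trans (sym (x≈y+z⇒x-y≈z refl)) (x≈y+z⇒x-y≈z e)

  -- The inductive step of the two inversions below: of the triangular pairing with `g_λ`, and of
  -- the sums over `μ ⊂ λ` in place of Möbius inversion.
  ∑-cancel : ∀ {A : Set} {xs : List A} {x} {φ ψ : A → K} → Unique xs → x ∈ xs →
             (∀ y → y ∈ xs → y ≢ x → φ y ≈ ψ y) → Σ.∑ xs φ ≈ Σ.∑ xs ψ → φ x ≈ ψ x
  ∑-cancel {xs = x ∷ xs} {φ = φ} {ψ} (x∉ ∷ u) (here ≡.refl) h e =
    +-cancelˡ (Σ.∑ xs φ) (trans (+-comm _ _) (trans e (trans (+-comm _ _) (+-congʳ (sym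
      (Σ.∑-cong xs (λ y y∈ → h y (there y∈) (λ { ≡.refl → All.lookup x∉ y∈ ≡.refl }))))))))
  ∑-cancel {xs = w ∷ xs} {φ = φ} (w∉ ∷ u) (there x∈) h e =
    ∑-cancel u x∈ (λ y y∈ → h y (there y∈))
      (+-cancelˡ (φ w) (trans e (+-congʳ (sym (h w (here ≡.refl) (All.lookup w∉ x∈))))))

  -- `g_λ` is `s_λ` plus terms of lower degree, so its pairing with `F` yields the Schur coefficient
  -- at `λ` once those of smaller size are known.
  nondegenerate : ∀ F H → (∀ μ → IsPartition μ → ⟨ F , g μ ⟩ ≈ ⟨ H , g μ ⟩) → F ≈̂ H
  nondegenerate F H e ν p = begin
    F ν ≈⟨ expand F p ⟩
    Σ.∑ (partitionsOf (size ν)) (λ λ′ → schurCoeff F λ′ * kostkaK λ′ ν)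
      ≈⟨ Σ.∑-cong (partitionsOf (size ν)) (λ λ′ λ∈ → *-congʳ (let q , s = ∈-partitionsOf⁻ {size ν} λ∈ in
           equal (suc (size ν)) λ′ q (s≤s (ℕ.≤-reflexive s)))) ⟩
    Σ.∑ (partitionsOf (size ν)) (λ λ′ → schurCoeff H λ′ * kostkaK λ′ ν)
      ≈⟨ expand H p ⟨
    H ν ∎
    where
    equal : ∀ n λ′ → IsPartition λ′ → size λ′ < n → schurCoeff F λ′ ≈ schurCoeff H λ′
    equal (suc n) λ′ q (s≤s le) = trans (sym (value F)) (trans
      (∑-cancel (partitionsUpTo-Unique (size λ′)) (∈-partitionsUpTo⁺ {size λ′} q ℕ.≤-refl) others (e λ′ q))
      (value H))
      where
      γ : List ℕ → K
      γ = schurCoeff (coeff (g λ′))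
      value : ∀ F → schurCoeff F λ′ * γ λ′ ≈ schurCoeff F λ′
      value F = trans (*-congˡ (trans (schurCoeff-g q q ≡.refl) (Σ.ind-true (==-refl λ′)))) (*-identityʳ _)
      others : ∀ κ → κ ∈ partitionsUpTo (size λ′) → κ ≢ λ′ → schurCoeff F κ * γ κ ≈ schurCoeff H κ * γ κ
      others κ κ∈ κ≢ with r , s ← ∈-partitionsUpTo⁻ {size λ′} κ∈ with ℕ.m≤n⇒m<n∨m≡n s
      ... | inj₁ lt = *-congʳ (equal n κ r (ℕ.<-≤-trans lt le))
      ... | inj₂ eq = trans (trans (*-congˡ γ≈0) (zeroʳ _)) (sym (trans (*-congˡ γ≈0) (zeroʳ _)))
        where γ≈0 = trans (schurCoeff-g q r eq) (Σ.ind-false (λ t → κ≢ (≡.sym (==⇒≡ λ′ κ t))))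

  isBox : List ℕ → K
  isBox μ = Σ.ind (μ == (1 ∷ []))

  -- (E(-1), g_μ) is determined by its sums over all μ ⊂ λ.
  pairing-E-1 : ∀ μ → IsPartition μ → ⟨ E-1 , g μ ⟩ + isBox μ ≈ isEmpty μ
  pairing-E-1 μ p = go (suc (size μ)) μ p (ℕ.n<1+n (size μ))
    where
    total : ∀ λ′ → IsPartition λ′ → Σ.∑ (subpartitions λ′) (λ μ → ⟨ E-1 , g μ ⟩) ≈ isEmpty λ′
    total λ′ p = begin
      Σ.∑ subs (λ μ → hall E-1 (size μ) (coeff (g μ)))
        ≈⟨ Σ.∑-cong subs (λ μ μ∈ → hall-extend (contained⇒size μ λ′ (proj₂ (∈-sub⁻ {λ′} μ∈))) (bounded (g μ))) ⟨
      Σ.∑ subs (λ μ → hall E-1 (size λ′) (coeff (g μ)))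
        ≈⟨ hall-∑ʳ (size λ′) subs E-1 (λ μ → coeff (g μ)) ⟨
      hall E-1 (size λ′) (λ ν → Σ.∑ subs (λ μ → coeff (g μ) ν))
        ≈⟨ hall-congʳ (size λ′) (λ ν _ _ → specialise-g p ℕ.≤-refl ν) ⟨
      hall E-1 (size λ′) (specialise (size λ′) (coeff (g λ′)))
        ≈⟨ hall-E-1-specialise (bounded (g λ′)) ⟩
      coeff (g λ′) []
        ≈⟨ g-[] p ⟩
      isEmpty λ′ ∎
      where subs = subpartitions λ′

    empties : ∀ λ′ → Σ.∑ (subpartitions λ′) isEmpty ≈ 1#
    empties λ′ = Σ.∑-single {x = []} (sub-Unique λ′) (∈-sub⁺ {λ′} [] tt) (λ y _ y≢ → Σ.ind-false (y≢ ∘ ==⇒≡ y []))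

    -- A nonempty shape contains the single box and the empty shape does not, so both sides of the
    -- claim sum to 1 over the subshapes of any shape.
    boxes-total : ∀ λ′ → IsPartition λ′ → isEmpty λ′ + Σ.∑ (subpartitions λ′) isBox ≈ 1#
    boxes-total []      p = trans (+-congˡ (+-identityʳ _)) (+-identityʳ 1#)
    boxes-total (a ∷ l) p = trans (+-identityˡ _) (Σ.∑-single {x = 1 ∷ []} (sub-Unique (a ∷ l))
      (∈-sub⁺ {a ∷ l} [ ℕ.≤-refl ] (∧-intro (ℕ.≤⇒≤ᵇ (head-pos p)) tt)) (λ y _ y≢ → Σ.ind-false (y≢ ∘ ==⇒≡ y (1 ∷ []))))

    go : ∀ n μ → IsPartition μ → size μ < n → ⟨ E-1 , g μ ⟩ + isBox μ ≈ isEmpty μ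
    go (suc n) λ′ p (s≤s le) = ∑-cancel (sub-Unique λ′) (self∈sub p)
      (λ μ μ∈ μ≢ → let q , c = ∈-sub⁻ {λ′} μ∈ in go n μ q (ℕ.<-≤-trans
        (ℕ.≰⇒> (λ ge → μ≢ (contained-size-≡ μ p c ge))) le))
      (begin
        Σ.∑ subs (λ μ → ⟨ E-1 , g μ ⟩ + isBox μ)          ≈⟨ Σ.∑-+ subs _ _ ⟩
        Σ.∑ subs (λ μ → ⟨ E-1 , g μ ⟩) + Σ.∑ subs isBox   ≈⟨ +-congʳ (total λ′ p) ⟩
        isEmpty λ′ + Σ.∑ subs isBox                       ≈⟨ boxes-total λ′ p ⟩
        1#                                                ≈⟨ empties λ′ ⟨
        Σ.∑ subs isEmpty                                  ∎)
      where subs = subpartitions λ′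

  -- `E-1` and its adjoint in terms of `G₁` and of the `e i`.

  module _ (G₁ : Λ̂) (isG : IsG (1 ∷ []) G₁) where

    E-1+G₁ : (λ ν → E-1 ν + G₁ ν) ≈̂ oneΛ̂
    E-1+G₁ = nondegenerate (λ ν → E-1 ν + G₁ ν) oneΛ̂ (λ μ p → begin
      hall (λ ν → E-1 ν + G₁ ν) (size μ) (coeff (g μ)) ≈⟨ hall-+ˡ (size μ) E-1 G₁ (coeff (g μ)) ⟩
      ⟨ E-1 , g μ ⟩ + ⟨ G₁ , g μ ⟩                      ≈⟨ +-congˡ (isG μ p) ⟩
      ⟨ E-1 , g μ ⟩ + isBox μ                          ≈⟨ pairing-E-1 μ p ⟩
      isEmpty μ                                        ≈⟨ g-[] p ⟨
      coeff (g μ) []                                   ≈⟨ hall-one (size μ) (coeff (g μ)) ⟨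
      ⟨ oneΛ̂ , g μ ⟩                                    ∎)

    E-1≈1-G₁ : E-1 ≈̂ (λ ν → oneΛ̂ ν - G₁ ν)
    E-1≈1-G₁ ν p = sym (x≈y+z⇒x-y≈z (trans (sym (E-1+G₁ ν p)) (+-comm _ _)))

    -- Pairing with 1 takes the constant term in `x`, so the adjoint of 1 is the identity; the rest
    -- is additivity in the first argument.
    perp-E-1≈id-perp-G₁ : ∀ f → coeff ((E-1 ⊥) f) ≈̂ (λ ν → coeff f ν - coeff ((G₁ ⊥) f) ν)
    perp-E-1≈id-perp-G₁ f ν p = sym (x≈y+z⇒x-y≈z (begin
      coeff f ν                                  ≈⟨ hall-one d fν ⟨
      hall oneΛ̂ d fν                             ≈⟨ hall-congˡ d (λ μ q _ → E-1+G₁ μ q) ⟨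
      hall (λ ν → E-1 ν + G₁ ν) d fν             ≈⟨ hall-+ˡ d E-1 G₁ fν ⟩
      hall E-1 d fν + hall G₁ d fν               ≈⟨ +-cong (perp-hall E-1 f ℕ.≤-refl p) (perp-hall G₁ f ℕ.≤-refl p) ⟨
      coeff ((E-1 ⊥) f) ν + coeff ((G₁ ⊥) f) ν   ≈⟨ +-comm _ _ ⟩
      coeff ((G₁ ⊥) f) ν + coeff ((E-1 ⊥) f) ν   ∎))
      where
      d = deg f
      fν : Λ̂
      fν μ = coeff f (merge μ ν)

  -- At `μ` only `i = size μ` can contribute, so the sum may be cut off at any bound from `size μ`
  -- on; the pairing sees just the degrees up to `deg f`.
  perp-E-1≈∑ : ∀ f → coeff ((E-1 ⊥) f) ≈̂ (λ ν → Σ.∑ (upTo (suc (deg f))) (λ i → sign i * coeff ((e i ⊥) f) ν))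
  perp-E-1≈∑ f ν p = begin
    coeff ((E-1 ⊥) f) ν ≈⟨ perp-hall E-1 f ℕ.≤-refl p ⟩
    hall E-1 d fν ≈⟨ hall-congˡ d (λ μ _ s → truncate μ s) ⟩
    hall (λ μ → Σ.∑ (upTo (suc d)) (λ i → sign i * e i μ)) d fν ≈⟨ hall-∑ˡ d (upTo (suc d)) (λ i μ → sign i * e i μ) fν ⟩
    Σ.∑ (upTo (suc d)) (λ i → hall (λ μ → sign i * e i μ) d fν)
      ≈⟨ Σ.∑-cong (upTo (suc d)) (λ i _ → trans (hall-*ˡ d (sign i) (e i) fν) (*-congˡ (sym (perp-hall (e i) f ℕ.≤-refl p)))) ⟩
    Σ.∑ (upTo (suc d)) (λ i → sign i * coeff ((e i ⊥) f) ν) ∎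
    where
    d = deg f
    fν : Λ̂
    fν μ = coeff f (merge μ ν)
    truncate : ∀ μ → size μ ≤ d → E-1 μ ≈ Σ.∑ (upTo (suc d)) (λ i → sign i * e i μ)
    truncate μ s with T? (allOnes μ)
    ... | no ¬t = trans (zero-sum (size μ)) (sym (zero-sum d))
      where
      zero-sum : ∀ n → Σ.∑ (upTo (suc n)) (λ i → sign i * e i μ) ≈ 0#
      zero-sum n = Σ.∑-zero (upTo (suc n)) (λ i _ → trans (*-congˡ (Σ.ind-false (¬t ∘ proj₁ ∘ ∧-elim))) (zeroʳ _))
    ... | yes t = trans (single (size μ) ℕ.≤-refl) (sym (single d s))
      where
      single : ∀ n → size μ ≤ n → Σ.∑ (upTo (suc n)) (λ i → sign i * e i μ) ≈ sign (size μ) * e (size μ) μ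
      single n le = Σ.∑-single {x = size μ} (Unique.upTo⁺ (suc n)) (∈-upTo⁺ (s≤s le)) (λ i _ i≢ →
        trans (*-congˡ (Σ.ind-false (λ u → i≢ (≡.trans (≡.sym (ℕ.≡ᵇ⇒≡ (length μ) i (proj₂ (∧-elim {allOnes μ} u)))) (onlyOnes⇒length {μ} t))))) (zeroʳ _))

  -- For fixed `ν` the function `μ ↦ f (merge μ ν)` is the coefficient of `m_ν(y)` in `f(x, y)`, and
  -- its constant term in `x` is `f ν`.
  hall-E-1-perp : ∀ {n f ν} → Bounded n f → IsPartition ν → hall E-1 n (λ μ → specialise n f (merge μ ν)) ≈ f ν
  hall-E-1-perp {n} {f} {ν} b p = trans
    (hall-congʳ n (λ μ q _ → Σ.∑-cong (upTo (suc n)) (λ k _ → reflexive (≡.cong f (insert-mergeˡ k q p)))))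
    (hall-E-1-specialise {n} {λ μ → f (merge μ ν)} (λ μ q lt → b (merge μ ν) (merge-partition q p)
      (ℕ.<-≤-trans lt (ℕ.≤-trans (ℕ.m≤m+n (size μ) (size ν)) (ℕ.≤-reflexive (≡.sym (size-merge μ ν)))))))

  -- The operator `I` as a specialisation, and its inverse.

  module _ (I : Λ → Λ) (linear : IsLinear I) (isI : IsI I) where
    open IsLinear linear renaming (cong to I-cong)

    0Λ : Λ
    coeff 0Λ _ = 0#
    deg 0Λ = 0
    bounded 0Λ _ _ _ = refl

    I-zero : ∀ f → (∀ ν → IsPartition ν → coeff f ν ≈ 0#) → ∀ ν → IsPartition ν → coeff (I f) ν ≈ 0#
    I-zero f z ν p = begin
      coeff (I f) ν         ≈⟨ I-cong f (0# ·Λ f) (λ μ q → trans (z μ q) (sym (zeroˡ _))) ν p ⟩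
      coeff (I (0# ·Λ f)) ν ≈⟨ scalar 0# f ν p ⟩
      0# * coeff (I f) ν    ≈⟨ zeroˡ _ ⟩
      0#                    ∎

    combination : (List ℕ → K) → List (List ℕ) → Λ
    combination a = foldr (λ λ′ h → (a λ′ ·Λ g λ′) +Λ h) 0Λ

    coeff-combination : ∀ a xs ν → coeff (combination a xs) ν ≡ Σ.∑ xs (λ λ′ → a λ′ * coeff (g λ′) ν)
    coeff-combination a []       ν = ≡.refl
    coeff-combination a (x ∷ xs) ν = ≡.cong (a x * coeff (g x) ν +_) (coeff-combination a xs ν)

    I-combination : ∀ {n} a xs → (∀ λ′ → λ′ ∈ xs → IsPartition λ′ × size λ′ ≤ n) →
                    coeff (I (combination a xs)) ≈̂ specialise n (coeff (combination a xs))
    I-combination {n} a []       h ν p = trans (I-zero 0Λ (λ _ _ → refl) ν p) (sym (Σ.∑-zero (upTo (suc n)) (λ _ _ → refl)))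
    I-combination {n} a (x ∷ xs) h ν p = begin
      coeff (I ((a x ·Λ g x) +Λ combination a xs)) ν
        ≈⟨ additive (a x ·Λ g x) (combination a xs) ν p ⟩
      coeff (I (a x ·Λ g x)) ν + coeff (I (combination a xs)) ν
        ≈⟨ +-cong (trans (scalar (a x) (g x) ν p) (*-congˡ (trans (isI x (proj₁ hx) ν p) (sym (specialise-g (proj₁ hx) (proj₂ hx) ν)))))
             (I-combination a xs (λ λ′ λ∈ → h λ′ (there λ∈)) ν p) ⟩
      a x * specialise n (coeff (g x)) ν + specialise n (coeff (combination a xs)) ν
        ≈⟨ +-congʳ (Σ.∑-*ˡ (upTo (suc n)) (a x) _) ⟨
      Σ.∑ (upTo (suc n)) (λ k → a x * coeff (g x) (insert k ν)) + specialise n (coeff (combination a xs)) ν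
        ≈⟨ Σ.∑-+ (upTo (suc n)) _ _ ⟨
      specialise n (coeff (combination a (x ∷ xs))) ν ∎
      where hx = h x (here ≡.refl)

    -- The top-degree part of f is removed by subtracting a combination of the g_λ with |λ| = d.
    I-specialise-below : ∀ {n} d → d ≤ suc n → ∀ f → (∀ ν → IsPartition ν → d ≤ size ν → coeff f ν ≈ 0#) → coeff (I f) ≈̂ specialise n (coeff f)
    -- `d` is a strict bound on the degree, so `d = 0` leaves only the zero function.
    I-specialise-below {n} zero    le f z ν p = trans (I-zero f (λ μ q → z μ q z≤n) ν p)
      (sym (Σ.∑-zero (upTo (suc n)) (λ k _ → z (insert k ν) (insert-partition k p) z≤n)))
    I-specialise-below {n} (suc d) (s≤s le) f z ν p = begin
      coeff (I f) ν
        ≈⟨ I-cong f (f′ +Λ h) (λ μ q → restore (coeff f μ) (coeff h μ)) ν p ⟩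
      coeff (I (f′ +Λ h)) ν
        ≈⟨ additive f′ h ν p ⟩
      coeff (I f′) ν + coeff (I h) ν
        ≈⟨ +-cong (I-specialise-below d (ℕ.m≤n⇒m≤1+n le) f′ vanish ν p) (I-combination a (partitionsOf d) top ν p) ⟩
      specialise n (coeff f′) ν + specialise n (coeff h) ν
        ≈⟨ Σ.∑-+ (upTo (suc n)) _ _ ⟨
      specialise n (coeff (f′ +Λ h)) ν
        ≈⟨ specialise-cong n (λ μ q → restore (coeff f μ) (coeff h μ)) ν p ⟨
      specialise n (coeff f) ν ∎
      where
      -- `g_λ` and `s_λ` agree in degree `|λ|`, so the Schur coefficients of `f` in degree `d` are
      -- the multiples of the `g_λ` that cancel its top part.
      a : List ℕ → K
      a = schurCoeff (coeff f)
      h f′ : Λ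
      h  = combination a (partitionsOf d)
      f′ = f +Λ ((- 1#) ·Λ h)
      top : ∀ λ′ → λ′ ∈ partitionsOf d → IsPartition λ′ × size λ′ ≤ n
      top λ′ λ∈ with q , e ← ∈-partitionsOf⁻ {d} λ∈ = q , ℕ.≤-trans (ℕ.≤-reflexive e) le
      restore : ∀ x y → x ≈ x + - 1# * y + y
      restore x y = sym (trans (+-assoc x _ y) (trans (+-congˡ (trans (+-congʳ (-1*x≈-x y)) (-‿inverseˡ y))) (+-identityʳ x)))
      vanish : ∀ μ → IsPartition μ → d ≤ size μ → coeff f′ μ ≈ 0#
      vanish μ q ge = trans (+-congˡ (-1*x≈-x (coeff h μ))) (trans (+-congʳ same) (-‿inverseʳ (coeff h μ)))
        where
        same : coeff f μ ≈ coeff h μ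
        same with ℕ.m≤n⇒m<n∨m≡n ge
        ... | inj₁ lt = trans (z μ q lt) (sym (trans (reflexive (coeff-combination a (partitionsOf d) μ))
          (Σ.∑-zero (partitionsOf d) (λ λ′ λ∈ → let r , e = ∈-partitionsOf⁻ {d} λ∈ in
            trans (*-congˡ (bounded (g λ′) μ q (≡.subst (_< size μ) (≡.sym e) lt))) (zeroʳ _)))))
        ... | inj₂ ≡.refl = trans (expand (coeff f) q) (sym (trans (reflexive (coeff-combination a (partitionsOf (size μ)) μ))
          (Σ.∑-cong (partitionsOf (size μ)) (λ λ′ λ∈ → let r , e = ∈-partitionsOf⁻ {size μ} λ∈ in
            *-congˡ (trans (coeff-g μ r) (sym (kostka-chains μ r (≡.sym e))))))))

    I≈specialise : ∀ f {n} → deg f ≤ n → coeff (I f) ≈̂ specialise n (coeff f)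
    I≈specialise f {n} le = I-specialise-below (suc n) ℕ.≤-refl f (λ ν p lt → bounded f ν p (ℕ.≤-trans (s≤s le) lt))

    perp-E-1∘I : ∀ f → ((E-1 ⊥) (I f)) ≈Λ f
    perp-E-1∘I f ν p = begin
      coeff ((E-1 ⊥) (I f)) ν                      ≈⟨ perp-hall E-1 (I f) (ℕ.m≤m⊔n (deg (I f)) (deg f)) p ⟩
      hall E-1 n (λ μ → coeff (I f) (merge μ ν))   ≈⟨ hall-congʳ n (λ μ q _ →
        I≈specialise f (ℕ.m≤n⊔m (deg (I f)) (deg f)) (merge μ ν) (merge-partition q p)) ⟩
      hall E-1 n (λ μ → specialise n (coeff f) (merge μ ν)) ≈⟨ hall-E-1-perp
        (λ μ q lt → bounded f μ q (ℕ.≤-<-trans (ℕ.m≤n⊔m (deg (I f)) (deg f)) lt)) p ⟩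
      coeff f ν                                    ∎
      -- `deg (I f)` is whatever bound `I` supplies and need not be comparable with `deg f` in a
      -- fixed direction.
      where n = deg (I f) ℕ.⊔ deg f

    -- `I` sets to 1 a variable belonging to `y`, while `E-1` is paired in `x`. As `f(x, 1, y)` is
    -- symmetric in all its variables, that variable may be moved over to `x`, where the pairing
    -- undoes it.
    I∘perp-E-1 : ∀ f → (I ((E-1 ⊥) f)) ≈Λ f
    I∘perp-E-1 f ν p = begin
      coeff (I ((E-1 ⊥) f)) ν
        ≈⟨ I≈specialise ((E-1 ⊥) f) ℕ.≤-refl ν p ⟩
      Σ.∑ (upTo (suc n)) (λ k → coeff ((E-1 ⊥) f) (insert k ν))
        ≈⟨ Σ.∑-cong (upTo (suc n)) (λ k _ → perp-hall E-1 f ℕ.≤-refl (insert-partition k p)) ⟩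
      Σ.∑ (upTo (suc n)) (λ k → hall E-1 n (λ μ → coeff f (merge μ (insert k ν))))
        ≈⟨ hall-∑ʳ n (upTo (suc n)) E-1 (λ k μ → coeff f (merge μ (insert k ν))) ⟨
      hall E-1 n (λ μ → Σ.∑ (upTo (suc n)) (λ k → coeff f (merge μ (insert k ν))))
        ≈⟨ hall-congʳ n (λ μ q _ → Σ.∑-cong (upTo (suc n)) (λ k _ → reflexive (≡.cong (coeff f) (insert-mergeʳ k q p)))) ⟨
      hall E-1 n (λ μ → specialise n (coeff f) (merge μ ν))
        ≈⟨ hall-E-1-perp (bounded f) p ⟩
      coeff f ν ∎
      where n = deg f

theorem4p8 : ∀ {c ℓ} (R : CommutativeRing c ℓ) →
    let open CommutativeRing R in
    let open SymFun R in
    (G₁ : Λ̂) → IsG (1 ∷ []) G₁ →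
    (E-1 ≈̂ (λ ν → oneΛ̂ ν - G₁ ν))
    ×
    ((I : Λ → Λ) → IsLinear I → IsI I →
    ((∀ f → ((E-1 ⊥) (I f)) ≈Λ f)
    × (∀ f → (I ((E-1 ⊥) f)) ≈Λ f)
    × (∀ f → coeff ((E-1 ⊥) f) ≈̂ (λ ν → coeff f ν - coeff ((G₁ ⊥) f) ν))
    × (∀ f → coeff ((E-1 ⊥) f)
    ≈̂ (λ ν → sumK (map (λ i → sign i * coeff ((e i ⊥) f) ν) (upTo (suc (deg f))))))))
theorem4p8 R G₁ isG =
  E-1≈1-G₁ G₁ isG , λ I linear isI →
    perp-E-1∘I I linear isI , I∘perp-E-1 I linear isI , perp-E-1≈id-perp-G₁ G₁ isG , perp-E-1≈∑
  where open Invertibility R
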